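{- For all integers $r$ and $k$ with $k\geq 2r+2\geq 8$, there exists $N_{r,k}$ such that for every integer $n>N_{r,k}$, $$\mathrm{ex}^{conn}_r(n,\textup{Berge- }P_k)=\binom{\lfloor k/2\rfloor-1}{r-1}\left(n-\lceil k/2\rceil\right)+\binom{\lceil k/2\rceil}{r}.$$
   Context: An $r$-graph is a hypergraph all of whose hyperedges are $r$-element subsets of the vertex set. $P_k$ denotes the path on $k$ vertices. For a graph $F$, an $r$-graph $\mathcal{H}$ is a Berge-$F$ if there is a bijection $\phi:E(F)\to E(\mathcal{H})$ with $e\subseteq\phi(e)$ for every $e\in E(F)$; $\mathcal{H}$ is Berge-$F$-free if it contains no subhypergraph that is a Berge-$F$. A hypergraph is connected if its vertex set cannot be partitioned into two nonempty parts such that no hyperedge meets both parts. $\mathrm{ex}^{conn}_r(n,\textup{Berge- }P_k)$ denotes the maximum number of hyperedges in a connected $n$-vertex $r$-graph that is Berge-$P_k$-free. -}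

module Defs where

open import Data.Nat using (ℕ; suc; _∸_; _+_; _*_; _≤_; ⌊_/2⌋; ⌈_/2⌉)
open import Data.Nat.Combinatorics using (_C_)
open import Data.Fin using (Fin; inject₁) renaming (suc to fsuc)
open import Data.Fin.Subset using (Subset; _∈_; _∉_; ∣_∣)
open import Data.List using (List; length; lookup)
open import Data.List.Relation.Unary.All using (All)
open import Data.List.Relation.Unary.Any using (Any)
open import Data.List.Relation.Unary.Unique.Propositional using (Unique)
open import Data.Product using (Σ; _×_; ∃; ∃-syntax)
open import Function.Definitions using (Injective)
open import Relation.Binary.PropositionalEquality using (_≡_)
open import Relation.Nullary using (¬_)

record RGraph (r n : ℕ) : Set where
  field
    edges   : List (Subset n)
    uniform : All (λ e → ∣ e ∣ ≡ r) edges
    simple  : Unique edges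
open RGraph public

size : ∀ {r n} → RGraph r n → ℕ
size H = length (edges H)

edge : ∀ {r n} (H : RGraph r n) → Fin (size H) → Subset n
edge H i = lookup (edges H) i

Connected : ∀ {r n} → RGraph r n → Set
Connected {n = n} H =
  (S : Subset n) → (∃[ u ] u ∈ S) → (∃[ w ] w ∉ S) →
  Any (λ e → (∃[ u ] (u ∈ S × u ∈ e)) × (∃[ w ] (w ∉ S × w ∈ e))) (edges H)

BergePath : ∀ {r n} → ℕ → RGraph r n → Set
BergePath {n = n} m H =
  Σ (Fin (suc m) → Fin n) λ v →
  Σ (Fin m → Fin (size H)) λ e →
    Injective _≡_ _≡_ v × Injective _≡_ _≡_ e ×
    ((i : Fin m) → (v (inject₁ i) ∈ edge H (e i)) × (v (fsuc i) ∈ edge H (e i)))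

-- Berge-P_k (P_k has k vertices, k - 1 edges; used for k ≥ 1)
BergeP : ∀ {r n} → ℕ → RGraph r n → Set
BergeP k H = BergePath (k ∸ 1) H

BergePFree : ∀ {r n} → ℕ → RGraph r n → Set
BergePFree k H = ¬ BergeP k H

ExConnIs : ℕ → ℕ → ℕ → ℕ → Set
ExConnIs r n k m =
  (Σ (RGraph r n) λ H → Connected H × BergePFree k H × size H ≡ m) ×
  ((H : RGraph r n) → Connected H → BergePFree k H → size H ≤ m)

extremalValue : ℕ → ℕ → ℕ → ℕ
extremalValue r k n = ((⌊ k /2⌋ ∸ 1) C (r ∸ 1)) * (n ∸ ⌈ k /2⌉) + (⌈ k /2⌉ C r)

{-# OPTIONS --safe #-}
-- Put s = ⌊k/2⌋ - 1, so that k is 2s + 2 or 2s + 3, and let r = ρ + 1.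
--
-- Red-blue graph. Match hyperedges to pairs of their vertices as far as possible (ignoring the pairs inside
-- a set S of hubs); the matched pairs form a graph. By the Hall-König alternating argument each hyperedge is
-- either matched (red) or all its pairs are matched (blue, a clique). A path of the graph is a Berge path, and
-- deleting a vertex of degree at most s in the graph costs at most C(s, ρ) hyperedges. The end of a path that
-- cannot be prolonged has all its neighbours on the path or among the hubs, and its deletion does not
-- disconnect anything, so bounds on path lengths make the graph s-degenerate.
--
-- Structure. As Berge paths have bounded length, a large connected hypergraph contains a bounded set S such
-- that the rest has many components of bounded size, many of them attached to the same part of S. If one of
-- these meets fewer than C(s, ρ) hyperedges per vertex, it can be removed. Otherwise each contains a dense
-- component K of the red-blue graph, many of these have the same set P of neighbours in S, and chaining
-- through P forces |P| = s, since all other sizes give a Berge path with 2s + 3 vertices. Matching again with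
-- hub set P, every path with l vertices outside P that ends in P extends to l + 2s vertices, and the count of
-- hyperedges outside P gives the exact bound. Every removal gains a hyperedge against the bound, so for n
-- large enough the process cannot go on without reaching this case.
module Submission where

open import Defs
open import Data.Bool using (true; false)
import Data.Bool.Properties as Bool
open import Data.Empty using (⊥; ⊥-elim)
open import Data.Fin using (Fin; zero; suc; toℕ; inject₁) renaming (_<_ to _<ᶠ_)
open import Data.Fin.Properties using (any?; suc-injective; toℕ-injective; toℕ-inject₁) renaming (_≟_ to _≟ᶠ_; _<?_ to _<ᶠ?_; <-cmp to <ᶠ-cmp)
open import Data.Fin.Subset using (Subset; inside; outside; _∈_; _∉_; _⊆_; _∪_; _─_; ⁅_⁆; ∣_∣; Nonempty) renaming (⊥ to ∅; ⊤ to full)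
open import Data.Fin.Subset.Properties using (_∈?_; _⊆?_; nonempty?; p⊆q⇒∣p∣≤∣q∣; p⊂q⇒∣p∣<∣q∣; x∈p∪q⁺; x∈p∪q⁻; ∉⊥; ∣⊥∣≡0; ∣⊤∣≡n; ∈⊤; x∈⁅x⁆; x∈⁅y⁆⇒x≡y; ∣⁅x⁆∣≡1; ⊆-antisym; drop-there)
open import Data.List using (List; _∷_; []; _++_; map; length; filter; allFin; cartesianProduct) renaming (tabulate to tabulateˡ; lookup to lookupˡ)
open import Data.List.Membership.Propositional using (find; lose) renaming (_∈_ to _∈ₗ_; _∉_ to _∉ₗ_)
open import Data.List.Membership.Propositional.Properties using (∈-map⁺; ∈-map⁻; ∈-++⁺ˡ; ∈-++⁺ʳ; ∈-++⁻; ∈-allFin; ∈-filter⁺; ∈-filter⁻; ∈-cartesianProduct⁺; ∈-lookup)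
open import Data.List.Properties using (length-map; length-++; length-tabulate)
open import Data.List.Relation.Unary.All as All using (All; []; _∷_)
import Data.List.Relation.Unary.All.Properties as AllP
open import Data.List.Relation.Unary.AllPairs using (AllPairs; []; _∷_)
import Data.List.Relation.Unary.AllPairs.Properties as AllPairs
open import Data.List.Relation.Unary.Any as Any using (Any; here; there)
open import Data.List.Relation.Unary.Any.Properties using (lookup-index)
open import Data.List.Relation.Unary.Linked using (Linked; []; [-]; _∷_)
open import Data.List.Relation.Unary.Unique.Propositional using (Unique)
import Data.List.Relation.Unary.Unique.Propositional.Properties as Uniq
open import Data.Maybe using (Maybe; just; nothing)
import Data.Maybe.Properties as Maybe
open import Data.Nat
open import Data.Nat.Combinatorics using (_C_; nC1≡n; nCk+nC[k+1]≡[n+1]C[k+1]; k>n⇒nCk≡0)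
open import Data.Nat.Properties hiding (suc-injective)
open import Data.Nat.Tactic.RingSolver using (solve-∀)
open import Data.Product using (Σ; ∃; ∃-syntax; _×_; _,_; proj₁; proj₂)
import Data.Product.Properties as Prod
open import Data.Sum using (_⊎_; inj₁; inj₂; [_,_]′)
open import Data.Vec using (_∷_; []; here; there; tabulate)
open import Data.Vec.Properties using (≡-dec; []=⇒lookup; lookup⇒[]=; lookup∘tabulate)
open import Function using (_∘_; id; case_of_)
open import Function.Definitions using (Injective)
open import Relation.Binary.Definitions using (DecidableEquality; tri<; tri≈; tri>)
open import Relation.Binary.PropositionalEquality
open import Relation.Nullary using (¬_; Dec; yes; no; does)
open import Relation.Nullary.Decidable using (dec-true; _×-dec_; _⊎-dec_; ¬?)

-- Ignoring the pairs inside the hub set leaves each represented pair with a vertex outside it. So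
-- deleting the vertices outside the hub set accounts for every hyperedge not contained in it, and a
-- path of the graph can be kept off the hyperedges of a given Berge path by avoiding non-hub
-- vertices only. The obstacle that recurs is the transition from a path of the hypergraph to a path
-- of the graph: a hyperedge of the former may represent an edge of the latter. The value s of |P|
-- comes from two competing ways to be long. A path through all of P has two vertices per hub, so
-- more than s hubs are too many. If the vertices of a dense component see fewer than s hubs, the
-- rest of a large degree must be found inside the component and forces a long arm, and two such
-- arms make up for the missing hubs. The hypothesis k ≥ 2r + 2 says that ρ < s. It is what lets red
-- hyperedges, one per neighbour, obey the bound for the blue ones.

private
  variable
    n : ℕ

-- Abstract, so that set comprehensions are never unfolded during conversion checking.
module _ {n : ℕ} {P : Fin n → Set} (P? : ∀ x → Dec (P x)) where

  abstract
    sub : Subset n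
    sub = tabulate (λ x → does (P? x))

    ∈-sub⁺ : ∀ {x} → P x → x ∈ sub
    ∈-sub⁺ {x} px = lookup⇒[]= x sub (trans (lookup∘tabulate (λ y → does (P? y)) x) (dec-true (P? x) px))

    ∈-sub⁻ : ∀ {x} → x ∈ sub → P x
    ∈-sub⁻ {x} x∈ with P? x | trans (sym (lookup∘tabulate (λ y → does (P? y)) x)) ([]=⇒lookup x∈)
    ... | yes px | _ = px
    ... | no _ | ()

-- Cardinalities and elements of subsets

∣∪∣≤ : (p q : Subset n) → ∣ p ∪ q ∣ ≤ ∣ p ∣ + ∣ q ∣
∣∪∣≤ [] [] = z≤n
∣∪∣≤ (false ∷ p) (false ∷ q) = ∣∪∣≤ p q
∣∪∣≤ (false ∷ p) (true ∷ q) rewrite +-suc ∣ p ∣ ∣ q ∣ = s≤s (∣∪∣≤ p q)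
∣∪∣≤ (true ∷ p) (false ∷ q) = s≤s (∣∪∣≤ p q)
∣∪∣≤ (true ∷ p) (true ∷ q) rewrite +-suc ∣ p ∣ ∣ q ∣ = s≤s (m≤n⇒m≤1+n (∣∪∣≤ p q))

∣─∣ : {p q : Subset n} → q ⊆ p → ∣ p ─ q ∣ + ∣ q ∣ ≡ ∣ p ∣
∣─∣ {p = []} {[]} _ = refl
∣─∣ {p = false ∷ p} {false ∷ q} h = ∣─∣ (λ x → drop-there (h (there x)))
∣─∣ {p = true ∷ p} {false ∷ q} h = cong suc (∣─∣ (λ x → drop-there (h (there x))))
∣─∣ {p = false ∷ p} {true ∷ q} h with h here
... | ()
∣─∣ {p = true ∷ p} {true ∷ q} h = trans (+-suc ∣ p ─ q ∣ ∣ q ∣) (cong suc (∣─∣ (λ x → drop-there (h (there x)))))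

∈-─⁺ : {p q : Subset n} {x : Fin n} → x ∈ p → x ∉ q → x ∈ p ─ q
∈-─⁺ {p = true ∷ p} {false ∷ q} here _ = here
∈-─⁺ {p = true ∷ p} {true ∷ q} here x∉ = ⊥-elim (x∉ here)
∈-─⁺ {p = _ ∷ p} {false ∷ q} (there x∈) x∉ = there (∈-─⁺ x∈ (x∉ ∘ there))
∈-─⁺ {p = _ ∷ p} {true ∷ q} (there x∈) x∉ = there (∈-─⁺ x∈ (x∉ ∘ there))

∈-─⁻ : (p q : Subset n) {x : Fin n} → x ∈ p ─ q → x ∈ p × x ∉ q
∈-─⁻ (true ∷ p) (false ∷ q) here = here , λ ()
∈-─⁻ (_ ∷ p) (false ∷ q) (there x∈) with ∈-─⁻ p q x∈
... | a , b = there a , λ { (there x) → b x }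
∈-─⁻ (_ ∷ p) (true ∷ q) (there x∈) with ∈-─⁻ p q x∈
... | a , b = there a , λ { (there x) → b x }

Disjointˢ : Subset n → Subset n → Set
Disjointˢ p q = ∀ {x} → x ∈ p → x ∉ q

∣∪∣-disjoint : {p q : Subset n} → Disjointˢ p q → ∣ p ∣ + ∣ q ∣ ≤ ∣ p ∪ q ∣
∣∪∣-disjoint {p = []} {[]} _ = z≤n
∣∪∣-disjoint {p = false ∷ p} {false ∷ q} d = ∣∪∣-disjoint (λ x y → d (there x) (there y))
∣∪∣-disjoint {p = false ∷ p} {true ∷ q} d rewrite +-suc ∣ p ∣ ∣ q ∣ = s≤s (∣∪∣-disjoint (λ x y → d (there x) (there y)))
∣∪∣-disjoint {p = true ∷ p} {false ∷ q} d = s≤s (∣∪∣-disjoint (λ x y → d (there x) (there y)))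
∣∪∣-disjoint {p = true ∷ p} {true ∷ q} d = ⊥-elim (d here here)

Nonempty⇒1≤ : {p : Subset n} → Nonempty p → 1 ≤ ∣ p ∣
Nonempty⇒1≤ {p = p} (x , x∈) = subst (_≤ ∣ p ∣) (∣⁅x⁆∣≡1 x) (p⊆q⇒∣p∣≤∣q∣ (λ {y} y∈ → subst (_∈ p) (sym (x∈⁅y⁆⇒x≡y x y∈)) x∈))

1≤⇒Nonempty : (p : Subset n) → 1 ≤ ∣ p ∣ → Nonempty p
1≤⇒Nonempty (true ∷ p) _ = zero , here
1≤⇒Nonempty (false ∷ p) h with 1≤⇒Nonempty p h
... | x , x∈ = suc x , there x∈

elements : Subset n → List (Fin n)
elements [] = []
elements (true ∷ p) = zero ∷ map suc (elements p)
elements (false ∷ p) = map suc (elements p)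

∈-elements⁺ : {p : Subset n} {x : Fin n} → x ∈ p → x ∈ₗ elements p
∈-elements⁺ here = here refl
∈-elements⁺ {p = true ∷ p} (there x∈) = there (∈-map⁺ suc (∈-elements⁺ x∈))
∈-elements⁺ {p = false ∷ p} (there x∈) = ∈-map⁺ suc (∈-elements⁺ x∈)

∈-elements⁻ : {p : Subset n} {x : Fin n} → x ∈ₗ elements p → x ∈ p
∈-elements⁻ {p = true ∷ p} (here refl) = here
∈-elements⁻ {p = true ∷ p} (there x∈) with ∈-map⁻ suc x∈
... | y , y∈ , refl = there (∈-elements⁻ y∈)
∈-elements⁻ {p = false ∷ p} x∈ with ∈-map⁻ suc x∈
... | y , y∈ , refl = there (∈-elements⁻ y∈)

length-elements : (p : Subset n) → length (elements p) ≡ ∣ p ∣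
length-elements [] = refl
length-elements (true ∷ p) = cong suc (trans (length-map suc (elements p)) (length-elements p))
length-elements (false ∷ p) = trans (length-map suc (elements p)) (length-elements p)

Unique-elements : (p : Subset n) → Unique (elements p)
Unique-elements [] = []
Unique-elements (true ∷ p) = All.tabulate (λ x∈ → λ { refl → case ∈-map⁻ suc x∈ of λ { (_ , _ , ()) } }) ∷ Uniq.map⁺ suc-injective (Unique-elements p)
Unique-elements (false ∷ p) = Uniq.map⁺ suc-injective (Unique-elements p)

-- Binomial coefficients

module _ where
  private
    pascal : ∀ m k → suc m C suc k ≡ m C k + m C suc k
    pascal m k = sym (nCk+nC[k+1]≡[n+1]C[k+1] m k)

  C-pascal : ∀ m k → suc m C suc k ≡ m C k + m C suc k
  C-pascal = pascal

  C-zero : ∀ m → m C 0 ≡ 1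
  C-zero zero = refl
  C-zero (suc m) = refl

  C-monoˡ : ∀ {a b} k → a ≤ b → a C k ≤ b C k
  C-monoˡ {a} {b} zero _ = ≤-reflexive (trans (C-zero a) (sym (C-zero b)))
  C-monoˡ {zero} (suc k) z≤n = z≤n
  C-monoˡ {suc a} {suc b} (suc k) (s≤s h) rewrite pascal a k | pascal b k = +-mono-≤ (C-monoˡ k h) (C-monoˡ (suc k) h)

  1≤C : ∀ {a k} → k ≤ a → 1 ≤ a C k
  1≤C {a} {zero} _ = ≤-reflexive (sym (C-zero a))
  1≤C {suc a} {suc k} (s≤s h) rewrite pascal a k = ≤-trans (1≤C h) (m≤m+n _ _)

  n≤C : ∀ {a k} → 1 ≤ k → k < a → a ≤ a C k
  n≤C {suc a} {suc zero} _ _ = ≤-reflexive (sym (nC1≡n (suc a)))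
  n≤C {suc a} {suc (suc k)} _ (s≤s h) rewrite pascal a (suc k) | +-comm (a C suc k) (a C suc (suc k)) = +-mono-≤ (1≤C h) (n≤C (s≤s z≤n) h)

  -- Raising the upper index from some `c` with `k ≤ c` adds `c C k`, which is at least 1; this
  -- happens `a` times.
  C-shift : ∀ a b k → k ≤ b → a + b C (suc k) ≤ (a + b) C (suc k)
  C-shift zero b k k≤b = ≤-refl
  C-shift (suc a) b k k≤b rewrite pascal (a + b) k = +-mono-≤ (1≤C (≤-trans k≤b (m≤n+m b a))) (C-shift a b k k≤b)

  -- Equality holds for a = s, b = 0, q = s - 1: this is where k ≥ 2r + 2 enters.
  mixed-bound : ∀ {a b s q} → a + b ≤ s → 1 ≤ q → q < s → a + b C q ≤ s C q
  mixed-bound {a} {b} {s} {suc q} h 1≤q q<s with q ≤? b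
  ... | yes q≤b = ≤-trans (C-shift a b q q≤b) (C-monoˡ (suc q) h)
  ... | no q≰b rewrite k>n⇒nCk≡0 {n = b} {k = suc q} (m≤n⇒m≤1+n (≰⇒> q≰b)) | +-identityʳ a = ≤-trans (≤-trans (m≤m+n a b) h) (n≤C 1≤q q<s)

-- Families of sets

choose : Subset n → ℕ → List (Subset n)
choose [] zero = [] ∷ []
choose [] (suc q) = []
choose (false ∷ D) q = map (outside ∷_) (choose D q)
choose (true ∷ D) zero = map (outside ∷_) (choose D zero)
choose (true ∷ D) (suc q) = map (inside ∷_) (choose D q) ++ map (outside ∷_) (choose D (suc q))

length-choose : (D : Subset n) (q : ℕ) → length (choose D q) ≡ ∣ D ∣ C q
length-choose [] zero = refl
length-choose [] (suc q) = refl
length-choose (false ∷ D) q = trans (length-map _ (choose D q)) (length-choose D q)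
length-choose (true ∷ D) zero = trans (length-map _ (choose D 0)) (trans (length-choose D 0) (trans (C-zero ∣ D ∣) (sym (C-zero (suc ∣ D ∣)))))
length-choose (true ∷ D) (suc q) = begin
  length (map (inside ∷_) (choose D q) ++ map (outside ∷_) (choose D (suc q)))
    ≡⟨ length-++ (map (inside ∷_) (choose D q)) ⟩
  length (map (inside ∷_) (choose D q)) + length (map (outside ∷_) (choose D (suc q)))
    ≡⟨ cong₂ _+_ (trans (length-map _ (choose D q)) (length-choose D q)) (trans (length-map _ (choose D (suc q))) (length-choose D (suc q))) ⟩
  ∣ D ∣ C q + ∣ D ∣ C suc q
    ≡⟨ sym (C-pascal ∣ D ∣ q) ⟩
  suc ∣ D ∣ C suc q ∎
  where open ≡-Reasoning

∈-choose⁺ : {D p : Subset n} → p ⊆ D → p ∈ₗ choose D ∣ p ∣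
∈-choose⁺ {D = []} {[]} _ = here refl
∈-choose⁺ {D = false ∷ D} {false ∷ p} h = ∈-map⁺ (outside ∷_) (∈-choose⁺ (λ x → drop-there (h (there x))))
∈-choose⁺ {D = false ∷ D} {true ∷ p} h with h here
... | ()
∈-choose⁺ {D = true ∷ D} {true ∷ p} h = ∈-++⁺ˡ (∈-map⁺ (inside ∷_) (∈-choose⁺ (λ x → drop-there (h (there x)))))
∈-choose⁺ {D = true ∷ D} {false ∷ p} h with ∣ p ∣ | ∈-choose⁺ {D = D} {p} (λ x → drop-there (h (there x)))
... | zero | r = ∈-map⁺ (outside ∷_) r
... | suc q | r = ∈-++⁺ʳ (map (inside ∷_) (choose D q)) (∈-map⁺ (outside ∷_) r)

∈-choose⁻ : (D : Subset n) (q : ℕ) {p : Subset n} → p ∈ₗ choose D q → p ⊆ D × ∣ p ∣ ≡ q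
∈-choose⁻ [] zero (here refl) = (λ x → x) , refl
∈-choose⁻ (false ∷ D) q p∈ with ∈-map⁻ (outside ∷_) p∈
... | p , p∈′ , refl with ∈-choose⁻ D q p∈′
...   | a , b = (λ { (there x) → there (a x) }) , b
∈-choose⁻ (true ∷ D) zero p∈ with ∈-map⁻ (outside ∷_) p∈
... | p , p∈′ , refl with ∈-choose⁻ D 0 p∈′
...   | a , b = (λ { (there x) → there (a x) }) , b
∈-choose⁻ (true ∷ D) (suc q) p∈ with ∈-++⁻ (map (inside ∷_) (choose D q)) p∈
... | inj₁ p∈₁ with ∈-map⁻ (inside ∷_) p∈₁
...   | p , p∈′ , refl with ∈-choose⁻ D q p∈′
...     | a , b = (λ { here → here ; (there x) → there (a x) }) , cong suc b
∈-choose⁻ (true ∷ D) (suc q) p∈ | inj₂ p∈₂ with ∈-map⁻ (outside ∷_) p∈₂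
...   | p , p∈′ , refl with ∈-choose⁻ D (suc q) p∈′
...     | a , b = (λ { (there x) → there (a x) }) , b

Unique-choose : (D : Subset n) (q : ℕ) → Unique (choose D q)
Unique-choose [] zero = [] ∷ []
Unique-choose [] (suc q) = []
Unique-choose (false ∷ D) q = Uniq.map⁺ (λ { refl → refl }) (Unique-choose D q)
Unique-choose (true ∷ D) zero = Uniq.map⁺ (λ { refl → refl }) (Unique-choose D zero)
Unique-choose (true ∷ D) (suc q) = Uniq.++⁺ (Uniq.map⁺ (λ { refl → refl }) (Unique-choose D q)) (Uniq.map⁺ (λ { refl → refl }) (Unique-choose D (suc q)))
  λ { (a , b) → case ∈-map⁻ (inside ∷_) a of λ { (_ , _ , refl) → case ∈-map⁻ (outside ∷_) b of λ { (_ , _ , ()) } } }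

-- Injective counting

∈-split-length : ∀ {A : Set} {x : A} {ys} → x ∈ₗ ys → ∃ λ zs → length ys ≡ suc (length zs) × (∀ {y} → y ∈ₗ ys → y ≢ x → y ∈ₗ zs)
∈-split-length {ys = y ∷ ys} (here refl) = ys , refl , λ { (here refl) ne → ⊥-elim (ne refl) ; (there h) _ → h }
∈-split-length {ys = y ∷ ys} (there x∈) with ∈-split-length x∈
... | zs , eq , f = y ∷ zs , cong suc eq , λ { (here refl) _ → here refl ; (there h) ne → there (f h ne) }

unique-length≤ : ∀ {A : Set} {xs ys : List A} → Unique xs → (∀ {x} → x ∈ₗ xs → x ∈ₗ ys) → length xs ≤ length ys
unique-length≤ {xs = []} _ _ = z≤n
unique-length≤ {xs = x ∷ xs} (a ∷ u) h with ∈-split-length (h (here refl))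
... | zs , eq , f rewrite eq = s≤s (unique-length≤ u (λ y∈ → f (h (there y∈)) (λ { refl → All.lookup a y∈ refl })))

map-unique : ∀ {A B : Set} (f : A → B) {xs} → (∀ {x y} → x ∈ₗ xs → y ∈ₗ xs → f x ≡ f y → x ≡ y) → Unique xs → Unique (map f xs)
map-unique f {[]} _ _ = []
map-unique f {x ∷ xs} inj (a ∷ u) = All.tabulate (λ y∈ eq → case ∈-map⁻ f y∈ of λ { (z , z∈ , refl) → All.lookup a z∈ (inj (here refl) (there z∈) eq) }) ∷ map-unique f (λ x∈ y∈ → inj (there x∈) (there y∈)) u

card-inj : ∀ {m} {B : Set} (Q : Subset m) (ys : List B) (f : Fin m → B) →
  (∀ {x} → x ∈ Q → f x ∈ₗ ys) → (∀ {x y} → x ∈ Q → y ∈ Q → f x ≡ f y → x ≡ y) → ∣ Q ∣ ≤ length ys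
card-inj Q ys f into inj = subst (_≤ length ys) (trans (length-map f (elements Q)) (length-elements Q))
  (unique-length≤ (map-unique f (λ x∈ y∈ → inj (∈-elements⁻ x∈) (∈-elements⁻ y∈)) (Unique-elements Q))
    (λ y∈ → case ∈-map⁻ f y∈ of λ { (x , x∈ , refl) → into (∈-elements⁻ x∈) }))

family-bound : ∀ {m} (Q : Subset m) (g : Fin m → Subset n) (D : Subset n) q →
  (∀ {x} → x ∈ Q → g x ⊆ D × ∣ g x ∣ ≡ q) → (∀ {x y} → x ∈ Q → y ∈ Q → g x ≡ g y → x ≡ y) → ∣ Q ∣ ≤ ∣ D ∣ C q
family-bound Q g D q h inj = subst (∣ Q ∣ ≤_) (length-choose D q)
  (card-inj Q (choose D q) g (λ {x} x∈ → subst (λ z → g x ∈ₗ choose D z) (proj₂ (h x∈)) (∈-choose⁺ (proj₁ (h x∈)))) inj)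

∣∣≤length : (p : Subset n) (ys : List (Fin n)) → (∀ {x} → x ∈ p → x ∈ₗ ys) → ∣ p ∣ ≤ length ys
∣∣≤length p ys h = card-inj p ys id h (λ _ _ e → e)

-- Matchings with deficiency

module Matching {m : ℕ} {B : Set} (_≟B_ : DecidableEquality B) (adm : Fin m → List B) where

  record Valid (μ : Fin m → Maybe B) : Set where
    field
      admissible : ∀ {e b} → μ e ≡ just b → b ∈ₗ adm e
      injective  : ∀ {e f b} → μ e ≡ just b → μ f ≡ just b → e ≡ f
  open Valid public

  Matched : (Fin m → Maybe B) → Fin m → Set
  Matched μ e = ∃ λ b → μ e ≡ just b

  -- Only the sets of used values are compared: flipping an alternating path passes values from one
  -- element to another.
  _≼_ : (μ ν : Fin m → Maybe B) → Set
  μ ≼ ν = ∀ {e b} → μ e ≡ just b → ∃ λ f → ν f ≡ just b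

  -- This is the obstruction in Hall's theorem. For hyperedges and their pairs it says that each
  -- eligible pair of a member of `Z` is an edge of the graph with a representative in `Z`.
  Closed : (Fin m → Maybe B) → Subset m → Set
  Closed μ Z = ∀ {e b} → e ∈ Z → b ∈ₗ adm e → ∃ λ f → f ∈ Z × μ f ≡ just b

  upd : (Fin m → Maybe B) → Fin m → Maybe B → Fin m → Maybe B
  upd μ f v e with e ≟ᶠ f
  ... | yes _ = v
  ... | no _ = μ e

  upd-same : ∀ μ f v → upd μ f v f ≡ v
  upd-same μ f v with f ≟ᶠ f
  ... | yes _ = refl
  ... | no ¬p = ⊥-elim (¬p refl)

  upd-other : ∀ μ {f} v {e} → e ≢ f → upd μ f v e ≡ μ e
  upd-other μ {f} v {e} ne with e ≟ᶠ f
  ... | yes p = ⊥-elim (ne p)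
  ... | no _ = refl

  nothing≢just : ∀ {v : Maybe B} {b} → v ≡ nothing → v ≢ just b
  nothing≢just refl ()

  upd-valid : ∀ {μ f b} → Valid μ → b ∈ₗ adm f → (∀ {e} → μ e ≡ just b → e ≡ f) → Valid (upd μ f (just b))
  upd-valid {μ} {f} {b} v b∈ free = record { admissible = adm′ ; injective = inj′ }
    where
    adm′ : ∀ {e c} → upd μ f (just b) e ≡ just c → c ∈ₗ adm e
    adm′ {e} eq with e ≟ᶠ f
    adm′ refl | yes refl = b∈
    adm′ eq   | no _ = admissible v eq
    inj′ : ∀ {e g c} → upd μ f (just b) e ≡ just c → upd μ f (just b) g ≡ just c → e ≡ g
    inj′ {e} {g} p q with e ≟ᶠ f | g ≟ᶠ f
    inj′ p q       | yes e≡f | yes g≡f = trans e≡f (sym g≡f)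
    inj′ refl q    | yes e≡f | no g≢f = ⊥-elim (g≢f (free q))
    inj′ p refl    | no e≢f | yes g≡f = ⊥-elim (e≢f (free p))
    inj′ p q       | no _ | no _ = injective v p q

  erase-valid : ∀ {μ f} → Valid μ → Valid (upd μ f nothing)
  erase-valid {μ} {f} v = record { admissible = λ p → admissible v (back p) ; injective = λ p q → injective v (back p) (back q) }
    where
    back : ∀ {e c} → upd μ f nothing e ≡ just c → μ e ≡ just c
    back {e} p with e ≟ᶠ f
    back () | yes _
    back p  | no _ = p

  -- `Z` is the part already found to be closed. Its values must survive every later augmentation,
  -- since they witness that it is closed.
  module Augment {μ : Fin m → Maybe B} (vμ : Valid μ) {Z : Subset m} (cZ : Closed μ Z)
                 {e₀ : Fin m} (e₀∉Z : e₀ ∉ Z) (un : μ e₀ ≡ nothing) where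

    record Augmented : Set where
      field
        ν     : Fin m → Maybe B
        valid : Valid ν
        keeps : μ ≼ ν
        dom   : ∀ {e} → Matched μ e ⊎ e ≡ e₀ → Matched ν e
        onZ   : ∀ {e} → e ∈ Z → ν e ≡ μ e

    -- An alternating path from e₀ to f, flipped: f takes over the role of the unmatched element.
    record Exposed (T : Subset m) (f : Fin m) : Set where
      field
        ν     : Fin m → Maybe B
        valid : Valid ν
        free  : ν f ≡ nothing
        keeps : μ ≼ ν
        kept  : ν ≼ μ
        dom   : ∀ {e} → e ≢ f → Matched μ e ⊎ e ≡ e₀ → Matched ν e
        agree : ∀ {e} → e ∉ T ⊎ e ∈ Z → ν e ≡ μ e

    weaken : ∀ {T U f} → T ⊆ U → Exposed T f → Exposed U f
    weaken T⊆U x = record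
      { ν = ν ; valid = valid ; free = free ; keeps = keeps ; kept = kept ; dom = dom
      ; agree = λ { (inj₁ e∉) → agree (inj₁ (e∉ ∘ T⊆U)) ; (inj₂ e∈) → agree (inj₂ e∈) } }
      where open Exposed x

    finish : ∀ {T f b} → f ∉ Z → Exposed T f → b ∈ₗ adm f → (∀ {g} → μ g ≢ just b) → Augmented
    finish {T} {f} {b} f∉Z x b∈ unb = record
      { ν = upd ν f (just b)
      ; valid = upd-valid valid b∈ (λ p → ⊥-elim (unb (proj₂ (kept p))))
      ; keeps = λ p → case keeps p of λ { (g , q) → g , trans (upd-other ν (just b) (unfree q)) q }
      ; dom = dom′
      ; onZ = λ {e} e∈ → trans (upd-other ν {f} (just b) {e} (λ { refl → f∉Z e∈ })) (agree (inj₂ e∈)) }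
      where
      open Exposed x
      unfree : ∀ {g c} → ν g ≡ just c → g ≢ f
      unfree q refl = nothing≢just free q
      dom′ : ∀ {e} → Matched μ e ⊎ e ≡ e₀ → Matched (upd ν f (just b)) e
      dom′ {e} h with e ≟ᶠ f
      ... | yes _ = b , refl
      ... | no e≢f = dom e≢f h

    -- The value `b` moves from `g` to `f`. As `g` lies outside `T`, the flips made so far have not
    -- touched it, so `b` is still its value.
    swap : ∀ {T f g b} → f ∈ T → f ∉ Z → g ∉ T → Z ⊆ T → Exposed T f → b ∈ₗ adm f → μ g ≡ just b → Exposed (T ∪ ⁅ g ⁆) g
    swap {T} {f} {g} {b} f∈ f∉Z g∉ Z⊆T x b∈ μg = record
      { ν = ν₂
      ; valid = upd-valid (erase-valid valid) b∈ (λ {e} p → ⊥-elim (unb {e} p))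
      ; free = trans (upd-other ν₁ (just b) g≢f) (upd-same ν g nothing)
      ; keeps = λ p → case keeps p of λ { (h , q) → keep₂ {h} q }
      ; kept = λ {h} → kept₂ {h}
      ; dom = λ {e} → dom₂ {e}
      ; agree = λ {e} → agree₂ {e} }
      where
      open Exposed x
      g≢f : g ≢ f
      g≢f refl = g∉ f∈
      ν₁ ν₂ : Fin m → Maybe B
      ν₁ = upd ν g nothing
      ν₂ = upd ν₁ f (just b)
      νg : ν g ≡ just b
      νg = trans (agree (inj₁ g∉)) μg
      unb : ∀ {e} → ν₁ e ≢ just b
      unb {e} p with e ≟ᶠ g
      unb () | yes _
      unb p  | no e≢g = e≢g (injective valid p νg)
      keep₂ : ∀ {h c} → ν h ≡ just c → ∃ λ h′ → ν₂ h′ ≡ just c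
      keep₂ {h} {c} q with h ≟ᶠ g
      ... | yes refl = f , trans (upd-same ν₁ f (just b)) (trans (sym νg) q)
      ... | no h≢g = h , trans (upd-other ν₁ {f} (just b) {h} (λ { refl → nothing≢just free q })) (trans (upd-other ν nothing h≢g) q)
      kept₂ : ∀ {h c} → ν₂ h ≡ just c → ∃ λ h′ → μ h′ ≡ just c
      kept₂ {h} p with h ≟ᶠ f
      kept₂ {h} refl | yes _ = g , μg
      kept₂ {h} p | no _ with h ≟ᶠ g
      kept₂ {h} () | no _ | yes _
      kept₂ {h} p | no _ | no _ = kept p
      dom₂ : ∀ {e} → e ≢ g → Matched μ e ⊎ e ≡ e₀ → Matched ν₂ e
      dom₂ {e} e≢g h with e ≟ᶠ f
      ... | yes _ = b , refl
      ... | no e≢f with e ≟ᶠ g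
      ...   | yes p = ⊥-elim (e≢g p)
      ...   | no _ = dom e≢f h
      agree₂ : ∀ {e} → e ∉ T ∪ ⁅ g ⁆ ⊎ e ∈ Z → ν₂ e ≡ μ e
      agree₂ {e} h = trans (upd-other ν₁ (just b) e≢f) (trans (upd-other ν nothing e≢g) (agree h′))
        where
        e≢f : e ≢ f
        e≢f refl = [ (λ a → a (x∈p∪q⁺ (inj₁ f∈))) , f∉Z ]′ h
        e≢g : e ≢ g
        e≢g refl = [ (λ a → a (x∈p∪q⁺ (inj₂ (x∈⁅x⁆ g)))) , (λ z → g∉ (Z⊆T z)) ]′ h
        h′ : e ∉ T ⊎ e ∈ Z
        h′ = [ (λ a → inj₁ (λ t → a (x∈p∪q⁺ (inj₁ t)))) , inj₂ ]′ h

    search : ∀ fuel (T : Subset m) → Z ⊆ T → e₀ ∈ T → (∀ {f} → f ∈ T → f ∈ Z ⊎ Exposed T f) → m ≤ ∣ T ∣ + fuel →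
      Augmented ⊎ (∃ λ T → Z ⊆ T × e₀ ∈ T × Closed μ T)
    search fuel T Z⊆T e₀∈ ex bound
      with any? (λ f → (f ∈? T) ×-dec Any.any? (λ b → ¬? (any? (λ g → (g ∈? T) ×-dec (Maybe.≡-dec _≟B_ (μ g) (just b))))) (adm f))
    ... | no none = inj₂ (T , Z⊆T , e₀∈ , closed)
      where
      closed : Closed μ T
      closed {f} {b} f∈ b∈ with any? (λ g → (g ∈? T) ×-dec (Maybe.≡-dec _≟B_ (μ g) (just b)))
      ... | yes p = p
      ... | no ¬p = ⊥-elim (none (f , f∈ , lose b∈ ¬p))
    ... | yes (f , f∈ , anyb) with find anyb
    ...   | b , b∈ , notT with ex f∈
    ...     | inj₁ f∈Z = case cZ f∈Z b∈ of λ { (g , g∈ , p) → ⊥-elim (notT (g , Z⊆T g∈ , p)) }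
    ...     | inj₂ x with f ∈? Z
    ...       | yes f∈Z = case cZ f∈Z b∈ of λ { (g , g∈ , p) → ⊥-elim (notT (g , Z⊆T g∈ , p)) }
    ...       | no f∉Z with any? (λ g → Maybe.≡-dec _≟B_ (μ g) (just b))
    ...         | no unb = inj₁ (finish f∉Z x b∈ (λ {g} p → unb (g , p)))
    ...         | yes (g , μg) with fuel
    ...           | zero = ⊥-elim (<⇒≱ (p⊂q⇒∣p∣<∣q∣ {p = T} {q = full} ((λ _ → ∈⊤) , g , ∈⊤ , λ g∈ → notT (g , g∈ , μg)))
                              (subst (_≤ ∣ T ∣) (sym (∣⊤∣≡n m)) (subst (m ≤_) (+-identityʳ ∣ T ∣) bound)))
    ...           | suc fuel′ = search fuel′ (T ∪ ⁅ g ⁆) (λ z → x∈p∪q⁺ (inj₁ (Z⊆T z))) (x∈p∪q⁺ (inj₁ e₀∈)) ex′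
                      (≤-trans bound (subst (_≤ ∣ T ∪ ⁅ g ⁆ ∣ + fuel′) (sym (+-suc ∣ T ∣ fuel′)) (+-monoˡ-≤ fuel′ grow)))
        where
        g∉ : g ∉ T
        g∉ g∈ = notT (g , g∈ , μg)
        grow : suc ∣ T ∣ ≤ ∣ T ∪ ⁅ g ⁆ ∣
        grow = p⊂q⇒∣p∣<∣q∣ ((λ t → x∈p∪q⁺ (inj₁ t)) , g , x∈p∪q⁺ (inj₂ (x∈⁅x⁆ g)) , g∉)
        ex′ : ∀ {h} → h ∈ T ∪ ⁅ g ⁆ → h ∈ Z ⊎ Exposed (T ∪ ⁅ g ⁆) h
        ex′ {h} h∈ with x∈p∪q⁻ T ⁅ g ⁆ h∈
        ... | inj₂ h∈g rewrite x∈⁅y⁆⇒x≡y g h∈g = inj₂ (swap f∈ f∉Z g∉ Z⊆T x b∈ μg)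
        ... | inj₁ h∈T with ex h∈T
        ...   | inj₁ z = inj₁ z
        ...   | inj₂ y = inj₂ (weaken (λ t → x∈p∪q⁺ (inj₁ t)) y)

    augment : Augmented ⊎ (∃ λ T → Z ⊆ T × e₀ ∈ T × Closed μ T)
    augment = search m (Z ∪ ⁅ e₀ ⁆) (λ z → x∈p∪q⁺ (inj₁ z)) (x∈p∪q⁺ (inj₂ (x∈⁅x⁆ e₀))) start (m≤n+m m _)
      where
      start : ∀ {f} → f ∈ Z ∪ ⁅ e₀ ⁆ → f ∈ Z ⊎ Exposed (Z ∪ ⁅ e₀ ⁆) f
      start {f} f∈ with x∈p∪q⁻ Z ⁅ e₀ ⁆ f∈
      ... | inj₁ z = inj₁ z
      ... | inj₂ y rewrite x∈⁅y⁆⇒x≡y e₀ y = inj₂ record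
        { ν = μ ; valid = vμ ; free = un ; keeps = λ p → _ , p ; kept = λ p → _ , p
        ; dom = λ ne → [ id , (λ eq → ⊥-elim (ne eq)) ]′ ; agree = λ _ → refl }

  -- An element of `blue` may well be matched, since closedness asks for representatives inside
  -- `blue`.
  record Deficient (μ₀ : Fin m → Maybe B) : Set where
    field
      μ       : Fin m → Maybe B
      valid   : Valid μ
      extends : μ₀ ≼ μ
      blue    : Subset m
      closed  : Closed μ blue
      cover   : ∀ e → e ∈ blue ⊎ Matched μ e

  maximum-matching : ∀ {μ₀} → Valid μ₀ → Deficient μ₀
  maximum-matching {μ₀} v₀ = go (allFin m) μ₀ ∅ v₀ (λ p → _ , p) (λ e∈ → ⊥-elim (∉⊥ e∈)) (λ e → inj₁ (∈-allFin e))
    where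
    go : (todo : List (Fin m)) (μ : Fin m → Maybe B) (Z : Subset m) → Valid μ → μ₀ ≼ μ → Closed μ Z →
      (∀ e → e ∈ₗ todo ⊎ (e ∈ Z ⊎ Matched μ e)) → Deficient μ₀
    go [] μ Z v ext cl cov = record { μ = μ ; valid = v ; extends = ext ; blue = Z ; closed = cl
      ; cover = λ e → [ (λ ()) , id ]′ (cov e) }
    go (e₀ ∷ todo) μ Z v ext cl cov with e₀ ∈? Z | μ e₀ in eq
    ... | yes e₀∈ | _ = go todo μ Z v ext cl (λ e → [ (λ { (here refl) → inj₂ (inj₁ e₀∈) ; (there p) → inj₁ p }) , inj₂ ]′ (cov e))
    ... | no _ | just b = go todo μ Z v ext cl (λ e → [ (λ { (here refl) → inj₂ (inj₂ (b , eq)) ; (there p) → inj₁ p }) , inj₂ ]′ (cov e))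
    ... | no e₀∉ | nothing with Augment.augment v cl e₀∉ eq
    ...   | inj₂ (T , Z⊆T , e₀∈ , clT) = go todo μ T v ext clT
              (λ e → [ (λ { (here refl) → inj₂ (inj₁ e₀∈) ; (there p) → inj₁ p }) , [ inj₂ ∘ inj₁ ∘ Z⊆T , inj₂ ∘ inj₂ ]′ ]′ (cov e))
    ...   | inj₁ a = go todo ν Z valid (λ p → keeps (proj₂ (ext p)))
              (λ e∈ b∈ → case cl e∈ b∈ of λ { (f , f∈ , p) → f , f∈ , trans (onZ f∈) p })
              (λ e → [ (λ { (here refl) → inj₂ (inj₂ (dom (inj₂ refl))) ; (there p) → inj₁ p }) , [ inj₂ ∘ inj₁ , (λ x → inj₂ (inj₂ (dom (inj₁ x)))) ]′ ]′ (cov e))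
      where open Augment.Augmented a

-- Reachability and paths for a binary relation on Fin n

module Graph {n : ℕ} (_~_ : Fin n → Fin n → Set) where

  data Reach (W : Subset n) (Root : Fin n → Set) : Fin n → Set where
    root : ∀ {x} → x ∈ W → Root x → Reach W Root x
    step : ∀ {x y} → Reach W Root x → x ~ y → y ∈ W → Reach W Root y

  Conn : Subset n → Set
  Conn W = ∀ {x y} → x ∈ W → y ∈ W → Reach W (x ≡_) y

  reach∈ : ∀ {W Root x} → Reach W Root x → x ∈ W
  reach∈ (root x∈ _) = x∈
  reach∈ (step _ _ y∈) = y∈

  reach-⊆ : ∀ {W W′ Root x} → W ⊆ W′ → Reach W Root x → Reach W′ Root x
  reach-⊆ h (root x∈ r) = root (h x∈) r
  reach-⊆ h (step p e y∈) = step (reach-⊆ h p) e (h y∈)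

  reach-trans : ∀ {W Root x y} → Reach W Root x → Reach W (x ≡_) y → Reach W Root y
  reach-trans p (root _ refl) = p
  reach-trans p (step q e y∈) = step (reach-trans p q) e y∈

  reach-sym : (∀ {x y} → x ~ y → y ~ x) → ∀ {W x y} → Reach W (x ≡_) y → Reach W (y ≡_) x
  reach-sym s (root x∈ refl) = root x∈ refl
  reach-sym s (step p e y∈) = reach-trans (step (root y∈ refl) (s e) (reach∈ p)) (reach-sym s p)

  crossing : ∀ {W x y} (T : Subset n) → Reach W (x ≡_) y → x ∈ T → y ∉ T →
    ∃[ u ] ∃[ v ] (u ∈ T × u ∈ W × v ∉ T × v ∈ W × u ~ v)
  crossing T (root _ refl) x∈ y∉ = ⊥-elim (y∉ x∈)
  crossing T (step {z} {y} p e y∈) x∈ y∉ with z ∈? T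
  ... | yes z∈ = z , y , z∈ , reach∈ p , y∉ , y∈ , e
  ... | no z∉ = crossing T p x∈ z∉

  ClosedIn : Subset n → Subset n → Set
  ClosedIn W X = ∀ {y z} → y ∈ X → z ∈ W → y ~ z → z ∈ X

  record Component (W X : Subset n) : Set where
    field
      inhabited : Nonempty X
      within    : X ⊆ W
      closed    : ClosedIn W X
      connected : Conn X

  -- The head of the list is the end at which the path grows. `Root` constrains only the other end:
  -- it is `v ≡_` for paths from `v` and `Gr μ b` for paths from a neighbour of a hub `b`.
  data RPath (R : Subset n) (Root : Fin n → Set) : List (Fin n) → Set where
    start : ∀ {x} → x ∈ R → Root x → RPath R Root (x ∷ [])
    grow  : ∀ {x y xs} → RPath R Root (x ∷ xs) → x ~ y → y ∈ R → y ∉ₗ x ∷ xs → RPath R Root (y ∷ x ∷ xs)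

  rpath∈ : ∀ {R Root xs} → RPath R Root xs → ∀ {x} → x ∈ₗ xs → x ∈ R
  rpath∈ (start x∈ _) (here refl) = x∈
  rpath∈ (grow _ _ y∈ _) (here refl) = y∈
  rpath∈ (grow p _ _ _) (there x∈) = rpath∈ p x∈

  rpath-unique : ∀ {R Root xs} → RPath R Root xs → Unique xs
  rpath-unique (start _ _) = [] ∷ []
  rpath-unique (grow p _ _ y∉) = All.tabulate (λ { z∈ refl → y∉ z∈ }) ∷ rpath-unique p

  rpath-⊆ : ∀ {R R′ Root xs} → R ⊆ R′ → RPath R Root xs → RPath R′ Root xs
  rpath-⊆ h (start x∈ r) = start (h x∈) r
  rpath-⊆ h (grow p e y∈ y∉) = grow (rpath-⊆ h p) e (h y∈) y∉

  suffix : ∀ {R Root zs y} → RPath R Root zs → y ∈ₗ zs → ∃ λ ys → RPath R Root (y ∷ ys)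
  suffix p@(start _ _) (here refl) = _ , p
  suffix p@(grow _ _ _ _) (here refl) = _ , p
  suffix (grow p _ _ _) (there y∈) = suffix p y∈

  rpath-take : ∀ {R Root xs} l → 1 ≤ l → l ≤ length xs → RPath R Root xs → ∃ λ ys → RPath R Root ys × length ys ≡ l
  rpath-take {xs = x ∷ []} (suc zero) _ _ p@(start _ _) = _ , p , refl
  rpath-take (suc (suc l)) _ (s≤s ()) (start _ _)
  rpath-take {xs = x ∷ xs} l 1≤l h p@(grow q _ _ _) with l ≟ suc (length xs)
  ... | yes eq = _ , p , sym eq
  ... | no ne = rpath-take l 1≤l (s≤s⁻¹ (≤∧≢⇒< h ne)) q

  reach⇒rpath : ∀ {R Root y} → Reach R Root y → ∃ λ ys → RPath R Root (y ∷ ys)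
  reach⇒rpath (root x∈ r) = [] , start x∈ r
  reach⇒rpath {y = y} (step p e y∈) with reach⇒rpath p
  ... | zs , q with Any.any? (y ≟ᶠ_) (_ ∷ zs)
  ...   | yes y∈q = suffix q y∈q
  ...   | no y∉q = _ , grow q e y∈ y∉q

  rpath⇒reach : ∀ {R Root zs x y} → RPath R Root zs → x ∉ₗ zs → y ∈ₗ zs → Reach (R ─ ⁅ x ⁆) Root y
  rpath⇒reach {x = x} (start z∈ r) x∉ (here refl) = root (∈-─⁺ z∈ (λ h → x∉ (here (sym (x∈⁅y⁆⇒x≡y x h))))) r
  rpath⇒reach {x = x} (grow p e z∈ _) x∉ (here refl) = step (rpath⇒reach p (x∉ ∘ there) (here refl)) e (∈-─⁺ z∈ (λ h → x∉ (here (sym (x∈⁅y⁆⇒x≡y x h)))))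
  rpath⇒reach (grow p _ _ _) x∉ (there y∈) = rpath⇒reach p (x∉ ∘ there) y∈

  -- A walk that passes through `x` continues at a neighbour of `x`. That neighbour lies on the
  -- path, so it is also reached along the path before `x`.
  delete-end : ∀ {R Root x xs} → RPath R Root (x ∷ xs) → (∀ {z} → z ∈ R → x ~ z → z ∈ₗ x ∷ xs) →
    ∀ {y} → Reach R Root y → y ≢ x → Reach (R ─ ⁅ x ⁆) Root y
  delete-end {x = x} p mx (root y∈ r) y≢x = root (∈-─⁺ y∈ (λ h → y≢x (x∈⁅y⁆⇒x≡y x h))) r
  delete-end {R} {Root} {x} {xs} p mx (step {z} {y} q e y∈) y≢x with z ≟ᶠ x
  ... | no z≢x = step (delete-end p mx q z≢x) e (∈-─⁺ y∈ (λ h → y≢x (x∈⁅y⁆⇒x≡y x h)))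
  ... | yes refl with mx y∈ e
  ...   | here eq = ⊥-elim (y≢x eq)
  ...   | there y∈xs = tail p y∈xs
    where
    tail : ∀ {xs} → RPath R Root (x ∷ xs) → y ∈ₗ xs → Reach (R ─ ⁅ x ⁆) Root y
    tail (grow q _ _ x∉) h = rpath⇒reach q x∉ h

  module _ (_~?_ : ∀ x y → Dec (x ~ y)) where

    component : ∀ (W : Subset n) {x} → x ∈ W → ∃ λ X → x ∈ X × X ⊆ W × ClosedIn W X × (∀ {y} → y ∈ X → Reach X (x ≡_) y)
    component W {x} x∈W = search n ⁅ x ⁆ (x∈⁅x⁆ x) (λ h → subst (_∈ W) (sym (x∈⁅y⁆⇒x≡y x h)) x∈W)
        (λ h → root h (sym (x∈⁅y⁆⇒x≡y x h))) (m≤n+m n _)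
      where
      search : ∀ fuel X → x ∈ X → X ⊆ W → (∀ {y} → y ∈ X → Reach X (x ≡_) y) → n ≤ ∣ X ∣ + fuel →
        ∃ λ X → x ∈ X × X ⊆ W × ClosedIn W X × (∀ {y} → y ∈ X → Reach X (x ≡_) y)
      search fuel X x∈ X⊆ re bound with any? (λ y → (y ∈? X) ×-dec any? (λ z → ((z ∈? W) ×-dec ¬? (z ∈? X)) ×-dec (y ~? z)))
      ... | no none = X , x∈ , X⊆ , closed , re
        where
        closed : ClosedIn W X
        closed {y} {z} y∈ z∈ e with z ∈? X
        ... | yes p = p
        ... | no z∉ = ⊥-elim (none (y , y∈ , z , (z∈ , z∉) , e))
      ... | yes (y , y∈ , z , (z∈ , z∉) , e) with fuel
      ...   | zero = ⊥-elim (<⇒≱ (p⊂q⇒∣p∣<∣q∣ {p = X} {q = full} ((λ _ → ∈⊤) , z , ∈⊤ , z∉))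
                       (subst (_≤ ∣ X ∣) (sym (∣⊤∣≡n n)) (subst (n ≤_) (+-identityʳ ∣ X ∣) bound)))
      ...   | suc fuel′ = search fuel′ (X ∪ ⁅ z ⁆) (up x∈) X′⊆ re′
                (≤-trans bound (subst (_≤ ∣ X ∪ ⁅ z ⁆ ∣ + fuel′) (sym (+-suc ∣ X ∣ fuel′)) (+-monoˡ-≤ fuel′ growth)))
        where
        up : X ⊆ X ∪ ⁅ z ⁆
        up t = x∈p∪q⁺ (inj₁ t)
        growth : suc ∣ X ∣ ≤ ∣ X ∪ ⁅ z ⁆ ∣
        growth = p⊂q⇒∣p∣<∣q∣ (up , z , x∈p∪q⁺ (inj₂ (x∈⁅x⁆ z)) , z∉)
        X′⊆ : X ∪ ⁅ z ⁆ ⊆ W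
        X′⊆ h with x∈p∪q⁻ X ⁅ z ⁆ h
        ... | inj₁ a = X⊆ a
        ... | inj₂ a rewrite x∈⁅y⁆⇒x≡y z a = z∈
        re′ : ∀ {u} → u ∈ X ∪ ⁅ z ⁆ → Reach (X ∪ ⁅ z ⁆) (x ≡_) u
        re′ h with x∈p∪q⁻ X ⁅ z ⁆ h
        ... | inj₁ a = reach-⊆ up (re a)
        ... | inj₂ a rewrite x∈⁅y⁆⇒x≡y z a = step (reach-⊆ up (re y∈)) e (x∈p∪q⁺ (inj₂ (x∈⁅x⁆ z)))

    component-of : (∀ {x y} → x ~ y → y ~ x) → ∀ (W : Subset n) {x} → x ∈ W → ∃ λ X → x ∈ X × Component W X
    component-of s W {x} x∈ with component W x∈
    ... | X , x∈X , X⊆ , cl , re = X , x∈X , record { inhabited = x , x∈X ; within = X⊆ ; closed = cl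
      ; connected = λ y∈ z∈ → reach-trans (reach-sym s (re y∈)) (re z∈) }

    maximal-rpath : ∀ {R Root x xs} → RPath R Root (x ∷ xs) →
      ∃[ y ] ∃[ ys ] (RPath R Root (y ∷ ys) × (∀ {z} → z ∈ R → y ~ z → z ∈ₗ y ∷ ys))
    maximal-rpath {R} {Root} = go n (m≤n+m n _)
      where
      go : ∀ fuel {x xs} → n ≤ length (x ∷ xs) + fuel → RPath R Root (x ∷ xs) →
        ∃[ y ] ∃[ ys ] (RPath R Root (y ∷ ys) × (∀ {z} → z ∈ R → y ~ z → z ∈ₗ y ∷ ys))
      go fuel {x} {xs} bound p with any? (λ z → ((z ∈? R) ×-dec ¬? (Any.any? (z ≟ᶠ_) (x ∷ xs))) ×-dec (x ~? z))
      ... | no none = x , xs , p , λ {z} z∈ e → case Any.any? (z ≟ᶠ_) (x ∷ xs) of λ { (yes q) → q ; (no ¬q) → ⊥-elim (none (z , (z∈ , ¬q) , e)) }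
      ... | yes (z , (z∈ , z∉) , e) with fuel
      ...   | suc fuel′ = go fuel′ (subst (n ≤_) (+-suc (length (x ∷ xs)) fuel′) bound) (grow p e z∈ z∉)
      ...   | zero = ⊥-elim (<⇒≱ {length (x ∷ xs)} {n} (subst (suc (length (x ∷ xs)) ≤_) (length-tabulate-id n)
                (unique-length≤ {xs = z ∷ x ∷ xs} {ys = allFin n} (rpath-unique (grow p e z∈ z∉)) (λ {y} _ → ∈-allFin y)))
                (subst (n ≤_) (+-identityʳ _) bound))
        where
        length-tabulate-id : ∀ n → length (allFin n) ≡ n
        length-tabulate-id n = length-tabulate id

-- The extremal hypergraph

enlarge : ∀ {n} {p D : Subset n} q → p ⊆ D → ∣ p ∣ ≤ q → q ≤ ∣ D ∣ → ∃ λ p′ → p ⊆ p′ × p′ ⊆ D × ∣ p′ ∣ ≡ q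
enlarge {p = []} {[]} zero _ _ _ = [] , id , id , refl
enlarge {p = false ∷ p} {false ∷ D} q h lo hi with enlarge q (λ x∈ → drop-there (h (there x∈))) lo hi
... | p′ , a , b , c = outside ∷ p′ , (λ { (there x∈) → there (a x∈) }) , (λ { (there x∈) → there (b x∈) }) , c
enlarge {p = true ∷ p} {false ∷ D} q h lo hi with h here
... | ()
enlarge {p = true ∷ p} {true ∷ D} (suc q) h (s≤s lo) (s≤s hi) with enlarge q (λ x∈ → drop-there (h (there x∈))) lo hi
... | p′ , a , b , c = inside ∷ p′ , (λ { here → here ; (there x∈) → there (a x∈) }) , (λ { here → here ; (there x∈) → there (b x∈) }) , cong suc c
enlarge {p = false ∷ p} {true ∷ D} q h lo hi with q ≤? ∣ D ∣
... | yes q≤ with enlarge q (λ x∈ → drop-there (h (there x∈))) lo q≤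
...   | p′ , a , b , c = outside ∷ p′ , (λ { (there x∈) → there (a x∈) }) , (λ { (there x∈) → there (b x∈) }) , c
enlarge {p = false ∷ p} {true ∷ D} zero h lo hi | no q≰ = ⊥-elim (q≰ z≤n)
enlarge {p = false ∷ p} {true ∷ D} (suc q) h lo (s≤s hi) | no q≰ with enlarge {p = p} {D} q (λ x∈ → drop-there (h (there x∈)))
    (≤-trans (p⊆q⇒∣p∣≤∣q∣ {p = p} {q = D} (λ x∈ → drop-there (h (there x∈)))) (s≤s⁻¹ (≰⇒> q≰))) hi
... | p′ , a , b , c = inside ∷ p′ , (λ { (there x∈) → there (a x∈) }) , (λ { here → here ; (there x∈) → there (b x∈) }) , cong suc c

-- The vertices of Fin (t + (d + s)) are t pendant ones, then d extra ones, then the core A; d + s is ⌈k/2⌉.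
core extras : (t d s : ℕ) → Subset (t + (d + s))
core zero zero s = full
core zero (suc d) s = outside ∷ core zero d s
core (suc t) d s = outside ∷ core t d s
extras zero zero s = ∅
extras zero (suc d) s = inside ∷ extras zero d s
extras (suc t) d s = outside ∷ extras t d s

∣core∣ : (t d s : ℕ) → ∣ core t d s ∣ ≡ s
∣core∣ zero zero s = ∣⊤∣≡n s
∣core∣ zero (suc d) s = ∣core∣ zero d s
∣core∣ (suc t) d s = ∣core∣ t d s

∣extras∣ : (t d s : ℕ) → ∣ extras t d s ∣ ≡ d
∣extras∣ zero zero s = ∣⊥∣≡0 s
∣extras∣ zero (suc d) s = cong suc (∣extras∣ zero d s)
∣extras∣ (suc t) d s = ∣extras∣ t d s

core-or-extra : (d s : ℕ) (x : Fin (d + s)) → x ∉ core zero d s → x ∈ extras zero d s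
core-or-extra zero s x x∉ = ⊥-elim (x∉ ∈⊤)
core-or-extra (suc d) s zero _ = here
core-or-extra (suc d) s (suc x) x∉ = there (core-or-extra d s x (x∉ ∘ there))

extremal : (t d s ρ : ℕ) → List (Subset (t + (d + s)))
extremal zero d s ρ = choose full (suc ρ)
extremal (suc t) d s ρ = map (inside ∷_) (choose (core t d s) ρ) ++ map (outside ∷_) (extremal t d s ρ)

length-extremal : (t d s ρ : ℕ) → length (extremal t d s ρ) ≡ (s C ρ) * t + (d + s) C suc ρ
length-extremal zero d s ρ = begin
  length (choose (full {d + s}) (suc ρ)) ≡⟨ length-choose (full {d + s}) (suc ρ) ⟩
  ∣ full {d + s} ∣ C suc ρ ≡⟨ cong (λ z → z C suc ρ) (∣⊤∣≡n (d + s)) ⟩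
  (d + s) C suc ρ ≡⟨ pad (s C ρ) ((d + s) C suc ρ) ⟩
  (s C ρ) * 0 + (d + s) C suc ρ ∎
  where
  open ≡-Reasoning
  pad : ∀ c q → q ≡ c * 0 + q
  pad c q = cong (_+ q) (sym (*-zeroʳ c))
length-extremal (suc t) d s ρ = begin
  length (map (inside ∷_) (choose (core t d s) ρ) ++ map (outside ∷_) (extremal t d s ρ))
    ≡⟨ length-++ (map (inside ∷_) (choose (core t d s) ρ)) ⟩
  length (map (inside ∷_) (choose (core t d s) ρ)) + length (map (outside ∷_) (extremal t d s ρ))
    ≡⟨ cong₂ _+_ (length-map (inside ∷_) (choose (core t d s) ρ)) (length-map (outside ∷_) (extremal t d s ρ)) ⟩
  length (choose (core t d s) ρ) + length (extremal t d s ρ)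
    ≡⟨ cong₂ _+_ (length-choose (core t d s) ρ) (length-extremal t d s ρ) ⟩
  ∣ core t d s ∣ C ρ + ((s C ρ) * t + (d + s) C suc ρ)
    ≡⟨ cong (λ z → z C ρ + ((s C ρ) * t + (d + s) C suc ρ)) (∣core∣ t d s) ⟩
  s C ρ + ((s C ρ) * t + (d + s) C suc ρ)
    ≡⟨ arrange (s C ρ) t ((d + s) C suc ρ) ⟩
  (s C ρ) * suc t + (d + s) C suc ρ ∎
  where
  open ≡-Reasoning
  arrange : ∀ c t q → c + (c * t + q) ≡ c * suc t + q
  arrange = solve-∀

unique-extremal : (t d s ρ : ℕ) → Unique (extremal t d s ρ)
unique-extremal zero d s ρ = Unique-choose full (suc ρ)
unique-extremal (suc t) d s ρ = Uniq.++⁺ (Uniq.map⁺ (λ { refl → refl }) (Unique-choose (core t d s) ρ)) (Uniq.map⁺ (λ { refl → refl }) (unique-extremal t d s ρ))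
  λ { (a , b) → case ∈-map⁻ (inside ∷_) a of λ { (_ , _ , refl) → case ∈-map⁻ (outside ∷_) b of λ { (_ , _ , ()) } } }

uniform-extremal : (t d s ρ : ℕ) → All (λ e → ∣ e ∣ ≡ suc ρ) (extremal t d s ρ)
uniform-extremal zero d s ρ = All.tabulate (λ e∈ → proj₂ (∈-choose⁻ full (suc ρ) e∈))
uniform-extremal (suc t) d s ρ = AllP.++⁺ (AllP.map⁺ (All.tabulate (λ e∈ → cong suc (proj₂ (∈-choose⁻ (core t d s) ρ e∈))))) (AllP.map⁺ (uniform-extremal t d s ρ))

-- A hyperedge through a pendant vertex has all its other vertices in the core; only the complete
-- part has two vertices off the core, and those are extras.
extremal-outside : ∀ t d s ρ {e x y} → e ∈ₗ extremal t d s ρ → x ∈ e → y ∈ e → x ∉ core t d s → y ∉ core t d s →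
  x ≡ y ⊎ (x ∈ extras t d s × y ∈ extras t d s)
extremal-outside zero d s ρ {x = x} {y} _ _ _ x∉ y∉ = inj₂ (core-or-extra d s x x∉ , core-or-extra d s y y∉)
extremal-outside (suc t) d s ρ e∈ x∈ y∈ x∉ y∉ with ∈-++⁻ (map (inside ∷_) (choose (core t d s) ρ)) e∈
... | inj₁ e∈₁ with ∈-map⁻ (inside ∷_) e∈₁
extremal-outside (suc t) d s ρ e∈ here here x∉ y∉ | inj₁ e∈₁ | p , p∈ , refl = inj₁ refl
extremal-outside (suc t) d s ρ e∈ (there x∈) y∈ x∉ y∉ | inj₁ e∈₁ | p , p∈ , refl = ⊥-elim (x∉ (there (proj₁ (∈-choose⁻ (core t d s) ρ p∈) x∈)))
extremal-outside (suc t) d s ρ e∈ here (there y∈) x∉ y∉ | inj₁ e∈₁ | p , p∈ , refl = ⊥-elim (y∉ (there (proj₁ (∈-choose⁻ (core t d s) ρ p∈) y∈)))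
extremal-outside (suc t) d s ρ e∈ x∈ y∈ x∉ y∉ | inj₂ e∈₂ with ∈-map⁻ (outside ∷_) e∈₂
extremal-outside (suc t) d s ρ e∈ (there x∈) (there y∈) x∉ y∉ | inj₂ e∈₂ | p , p∈ , refl with extremal-outside t d s ρ p∈ x∈ y∈ (x∉ ∘ there) (y∉ ∘ there)
... | inj₁ eq = inj₁ (cong suc eq)
... | inj₂ (a , b) = inj₂ (there a , there b)

extremal-joins : (t d s ρ : ℕ) → 1 ≤ ρ → ρ < s → ∀ {x a} → a ∈ core t d s → ∃ λ e → e ∈ₗ extremal t d s ρ × x ∈ e × a ∈ e
extremal-joins zero d s ρ 1≤ρ ρ<s {x} {a} _ with enlarge {p = ⁅ x ⁆ ∪ ⁅ a ⁆} {D = full} (suc ρ) (λ _ → ∈⊤)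
    (≤-trans (∣∪∣≤ ⁅ x ⁆ ⁅ a ⁆) (≤-trans (≤-reflexive (cong₂ _+_ (∣⁅x⁆∣≡1 x) (∣⁅x⁆∣≡1 a))) (s≤s 1≤ρ)))
    (≤-trans ρ<s (≤-trans (m≤n+m s d) (≤-reflexive (sym (∣⊤∣≡n (d + s))))))
... | p , sb , p⊆ , sz = p , subst (λ z → p ∈ₗ choose full z) sz (∈-choose⁺ p⊆) , sb (x∈p∪q⁺ (inj₁ (x∈⁅x⁆ x))) , sb (x∈p∪q⁺ (inj₂ (x∈⁅x⁆ a)))
extremal-joins (suc t) d s ρ 1≤ρ ρ<s {suc x} (there a∈) with extremal-joins t d s ρ 1≤ρ ρ<s {x} a∈
... | e , e∈ , x∈ , a∈e = outside ∷ e , ∈-++⁺ʳ (map (inside ∷_) (choose (core t d s) ρ)) (∈-map⁺ (outside ∷_) e∈) , there x∈ , there a∈e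
extremal-joins (suc t) d s ρ 1≤ρ ρ<s {zero} {suc a} (there a∈) with enlarge {p = ⁅ a ⁆} {D = core t d s} ρ (λ h → subst (_∈ core t d s) (sym (x∈⁅y⁆⇒x≡y a h)) a∈)
    (≤-trans (≤-reflexive (∣⁅x⁆∣≡1 a)) 1≤ρ) (≤-trans (<⇒≤ ρ<s) (≤-reflexive (sym (∣core∣ t d s))))
... | p , sb , p⊆ , sz = inside ∷ p , ∈-++⁺ˡ (∈-map⁺ (inside ∷_) (subst (λ z → p ∈ₗ choose (core t d s) z) sz (∈-choose⁺ p⊆))) , here , there (sb (x∈⁅x⁆ a))

hits : ∀ {n} → Subset n → List (Fin n) → ℕ
hits D xs = length (filter (_∈? D) xs)

hits≤ : ∀ {n} (D : Subset n) {xs} → Unique xs → hits D xs ≤ ∣ D ∣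
hits≤ D {xs} u = subst (hits D xs ≤_) (length-elements D) (unique-length≤ (Uniq.filter⁺ (_∈? D) u)
  (λ x∈ → ∈-elements⁺ (proj₂ (∈-filter⁻ (_∈? D) {xs = xs} x∈))))

hits-∷-yes : ∀ {n} {D : Subset n} {x xs} → x ∈ D → hits D (x ∷ xs) ≡ suc (hits D xs)
hits-∷-yes {D = D} {x} x∈ with x ∈? D
... | yes _ = refl
... | no ¬p = ⊥-elim (¬p x∈)

hits-∷-≤ : ∀ {n} (D : Subset n) x xs → hits D xs ≤ hits D (x ∷ xs)
hits-∷-≤ D x xs with x ∈? D
... | yes _ = n≤1+n _
... | no _ = ≤-refl

-- Each vertex of A accounts for itself and one neighbour, and each further vertex of D for one step outside A.
alternation : ∀ {n} (A D : Subset n) {xs} → Linked (λ x y → x ∈ A ⊎ y ∈ A ⊎ (x ∈ D × y ∈ D)) xs →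
  length xs ≤ 2 * hits A xs + (1 + (hits D xs ∸ 1))
alternation A D [] = z≤n
alternation A D {x ∷ []} [-] = m≤n⇒m≤o+n (2 * hits A (x ∷ [])) (s≤s z≤n)
alternation A D {x ∷ y ∷ zs} (r ∷ rs) with x ∈? A
... | yes x∈ = ≤-trans (s≤s (≤-trans (alternation A D rs) (+-monoʳ-≤ (2 * hits A (y ∷ zs)) (+-monoʳ-≤ 1 (∸-monoˡ-≤ 1 (hits-∷-≤ D x (y ∷ zs)))))))
    (≤-trans (n≤1+n _) (≤-reflexive (cong (_+ (1 + (hits D (x ∷ y ∷ zs) ∸ 1))) (sym (*-suc 2 (hits A (y ∷ zs)))))))
... | no x∉ with r
...   | inj₁ x∈ = ⊥-elim (x∉ x∈)
-- `x` is the one neighbour charged to `y`, so both vertices are removed together.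
...   | inj₂ (inj₁ y∈) = begin
  2 + length zs ≤⟨ +-monoʳ-≤ 2 (shorter rs) ⟩
  2 + (2 * hits A zs + (1 + (hits D zs ∸ 1))) ≡⟨ sym (+-assoc 2 (2 * hits A zs) (1 + (hits D zs ∸ 1))) ⟩
  2 + 2 * hits A zs + (1 + (hits D zs ∸ 1)) ≡⟨ cong (_+ (1 + (hits D zs ∸ 1))) (sym (*-suc 2 (hits A zs))) ⟩
  2 * suc (hits A zs) + (1 + (hits D zs ∸ 1)) ≤⟨ +-mono-≤ (≤-reflexive (cong (2 *_) (sym (hits-∷-yes y∈)))) (+-monoʳ-≤ 1 (∸-monoˡ-≤ 1 (≤-trans (hits-∷-≤ D y zs) (hits-∷-≤ D x (y ∷ zs))))) ⟩
  2 * hits A (y ∷ zs) + (1 + (hits D (x ∷ y ∷ zs) ∸ 1)) ∎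
  where
  open ≤-Reasoning
  shorter : ∀ {y zs} → Linked (λ x y → x ∈ A ⊎ y ∈ A ⊎ (x ∈ D × y ∈ D)) (y ∷ zs) → length zs ≤ 2 * hits A zs + (1 + (hits D zs ∸ 1))
  shorter [-] = z≤n
  shorter (_ ∷ q) = alternation A D q
...   | inj₂ (inj₂ (x∈D , y∈D)) = begin
  suc (length (y ∷ zs)) ≤⟨ s≤s (alternation A D rs) ⟩
  suc (2 * hits A (y ∷ zs) + (1 + (hits D (y ∷ zs) ∸ 1))) ≡⟨ sym (+-suc (2 * hits A (y ∷ zs)) _) ⟩
  2 * hits A (y ∷ zs) + (2 + (hits D (y ∷ zs) ∸ 1)) ≡⟨ cong (λ z → 2 * hits A (y ∷ zs) + (2 + (z ∸ 1))) (hits-∷-yes y∈D) ⟩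
  2 * hits A (y ∷ zs) + (1 + suc (hits D zs)) ≡⟨ cong (λ z → 2 * hits A (y ∷ zs) + (1 + z)) (sym (hits-∷-yes y∈D)) ⟩
  2 * hits A (y ∷ zs) + (1 + (suc (hits D (y ∷ zs)) ∸ 1)) ≡⟨ cong (λ z → 2 * hits A (y ∷ zs) + (1 + (z ∸ 1))) (sym (hits-∷-yes x∈D)) ⟩
  2 * hits A (y ∷ zs) + (1 + (hits D (x ∷ y ∷ zs) ∸ 1)) ∎
  where open ≤-Reasoning

linked-tabulate : ∀ {n m} {R : Fin n → Fin n → Set} (f : Fin m → Fin n) → (∀ i j → toℕ j ≡ suc (toℕ i) → R (f i) (f j)) → Linked R (tabulateˡ f)
linked-tabulate {m = zero} f h = []
linked-tabulate {m = suc zero} f h = [-]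
linked-tabulate {m = suc (suc m)} f h = h zero (suc zero) refl ∷ linked-tabulate (f ∘ suc) (λ i j eq → h (suc i) (suc j) (cong suc eq))

lookup-uniq : ∀ {A : Set} {xs : List A} → Unique xs → ∀ {i j} → lookupˡ xs i ≡ lookupˡ xs j → i ≡ j
lookup-uniq (a ∷ u) {zero} {zero} _ = refl
lookup-uniq {xs = x ∷ xs} (a ∷ u) {zero} {suc j} eq = ⊥-elim (All.lookup a (∈-lookup j) eq)
lookup-uniq {xs = x ∷ xs} (a ∷ u) {suc i} {zero} eq = ⊥-elim (All.lookup a (∈-lookup i) (sym eq))
lookup-uniq (a ∷ u) {suc i} {suc j} eq = cong suc (lookup-uniq u eq)

extremalGraph : (t d s ρ : ℕ) → RGraph (suc ρ) (t + (d + s))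
extremalGraph t d s ρ = record { edges = extremal t d s ρ ; uniform = uniform-extremal t d s ρ ; simple = unique-extremal t d s ρ }

extremal-connected : (t d s ρ : ℕ) → 1 ≤ ρ → ρ < s → Connected (extremalGraph t d s ρ)
extremal-connected t d s ρ 1≤ρ ρ<s S (u , u∈) (w , w∉) with 1≤⇒Nonempty (core t d s) (≤-trans (s≤s z≤n) (≤-trans ρ<s (≤-reflexive (sym (∣core∣ t d s)))))
... | a , a∈ with a ∈? S
...   | yes a∈S = case extremal-joins t d s ρ 1≤ρ ρ<s {w} a∈ of λ { (e , e∈ , w∈ , a∈e) → lose e∈ ((a , a∈S , a∈e) , (w , w∉ , w∈)) }
...   | no a∉S = case extremal-joins t d s ρ 1≤ρ ρ<s {u} a∈ of λ { (e , e∈ , u∈e , a∈e) → lose e∈ ((u , u∈ , u∈e) , (a , a∉S , a∈e)) }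

-- By `alternation` a path has at most `2 * s + d` vertices: the extras allow `d - 1` steps outside
-- the core, and one vertex is free.
extremal-free : (t d s ρ : ℕ) → 1 ≤ d → BergePFree (suc (2 * s + d)) (extremalGraph t d s ρ)
extremal-free t d s ρ 1≤d (v , e , v-inj , _ , inc) = <⇒≱ ≤-refl (begin
  suc (2 * s + d) ≡⟨ sym (length-tabulate v) ⟩
  length (tabulateˡ v) ≤⟨ alternation A D (linked-tabulate v consecutive) ⟩
  2 * hits A (tabulateˡ v) + (1 + (hits D (tabulateˡ v) ∸ 1)) ≤⟨ +-mono-≤ (*-monoʳ-≤ 2 (≤-trans (hits≤ A (Uniq.tabulate⁺ v-inj)) (≤-reflexive (∣core∣ t d s))))
      (+-monoʳ-≤ 1 (∸-monoˡ-≤ 1 (≤-trans (hits≤ D (Uniq.tabulate⁺ v-inj)) (≤-reflexive (∣extras∣ t d s))))) ⟩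
  2 * s + (1 + (d ∸ 1)) ≡⟨ cong (2 * s +_) (m+[n∸m]≡n 1≤d) ⟩
  2 * s + d ∎)
  where
  open ≤-Reasoning
  A = core t d s
  D = extras t d s
  consecutive : ∀ i j → toℕ j ≡ suc (toℕ i) → v i ∈ A ⊎ v j ∈ A ⊎ (v i ∈ D × v j ∈ D)
  consecutive i (suc j) eq with v i ∈? A | v (suc j) ∈? A
  ... | yes p | _ = inj₁ p
  ... | no _ | yes q = inj₂ (inj₁ q)
  ... | no p | no q with extremal-outside t d s ρ (∈-lookup (e j)) (subst (λ z → v z ∈ _) (toℕ-injective (trans (toℕ-inject₁ j) (cong pred eq))) (proj₁ (inc j))) (proj₂ (inc j)) p q
  ...   | inj₂ r = inj₂ (inj₂ r)
  ...   | inj₁ r = ⊥-elim (1+n≢n (trans (sym eq) (sym (cong toℕ (v-inj r)))))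

-- Counting by relations, avoidance and pigeonholing

rel-length≤ : ∀ {A B : Set} (R : A → B → Set) {xs ys} → Unique xs → (∀ {x} → x ∈ₗ xs → ∃ λ y → y ∈ₗ ys × R x y) →
  (∀ {x x′ y} → R x y → R x′ y → x ≡ x′) → length xs ≤ length ys
rel-length≤ R {[]} _ _ _ = z≤n
rel-length≤ R {x ∷ xs} (a ∷ u) h inj with h (here refl)
... | y , y∈ , rxy with ∈-split-length y∈
...   | zs , eq , f rewrite eq = s≤s (rel-length≤ R u (λ {x′} x′∈ → case h (there x′∈) of λ
          { (y′ , y′∈ , r′) → y′ , f y′∈ (λ { refl → All.lookup a x′∈ (inj rxy r′) }) , r′ }) inj)

card-rel : ∀ {m n} (Q : Subset m) (D : Subset n) (R : Fin m → Fin n → Set) →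
  (∀ {x} → x ∈ Q → ∃ λ y → y ∈ D × R x y) → (∀ {x x′ y} → R x y → R x′ y → x ≡ x′) → ∣ Q ∣ ≤ ∣ D ∣
card-rel Q D R h inj = subst₂ _≤_ (length-elements Q) (length-elements D) (rel-length≤ R (Unique-elements Q)
  (λ x∈ → case h (∈-elements⁻ x∈) of λ { (y , y∈ , r) → y , ∈-elements⁺ y∈ , r }) inj)

∣─⁅⁆∣ : ∀ {n} {p : Subset n} {x} → x ∈ p → suc ∣ p ─ ⁅ x ⁆ ∣ ≡ ∣ p ∣
∣─⁅⁆∣ {p = p} {x} x∈ = trans (sym (+-comm ∣ p ─ ⁅ x ⁆ ∣ 1)) (trans (cong (∣ p ─ ⁅ x ⁆ ∣ +_) (sym (∣⁅x⁆∣≡1 x)))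
  (∣─∣ (λ h → subst (_∈ p) (sym (x∈⁅y⁆⇒x≡y x h)) x∈)))

reach-map : ∀ {n} {_~_ _≈_ : Fin n → Fin n → Set} → (∀ {x y} → x ~ y → x ≈ y) →
  ∀ {W Root x} → Graph.Reach _~_ W Root x → Graph.Reach _≈_ W Root x
reach-map f (Graph.root x∈ r) = Graph.root x∈ r
reach-map f (Graph.step p e y∈) = Graph.step (reach-map f p) (f e) y∈

closed-reach : ∀ {n} {_~_ : Fin n → Fin n → Set} {W X Y : Subset n} → Graph.ClosedIn _~_ W X → Y ⊆ W →
  ∀ {x y} → Graph.Reach _~_ Y (x ≡_) y → x ∈ X → y ∈ X
closed-reach cl Y⊆ (Graph.root _ refl) x∈ = x∈
closed-reach cl Y⊆ (Graph.step p e y∈) x∈ = cl (closed-reach cl Y⊆ p x∈) (Y⊆ y∈) e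

-- By disjointness each element of `T` spoils at most one of the sets. A discarded set is charged to
-- one of its elements in `T`, which is then dropped from `T`.
avoid : ∀ {n} (Zs : List (Subset n)) (T : Subset n) → AllPairs Disjointˢ Zs →
  ∃ λ Zs′ → (∀ {Z} → Z ∈ₗ Zs′ → Z ∈ₗ Zs) × AllPairs Disjointˢ Zs′ × All (Disjointˢ T) Zs′ × length Zs ≤ length Zs′ + ∣ T ∣
avoid [] T _ = [] , id , [] , [] , z≤n
avoid (Z ∷ Zs) T (d ∷ ds) with any? (λ x → (x ∈? T) ×-dec (x ∈? Z))
... | no none with avoid Zs T ds
...   | Zs′ , sb , ds′ , dT , len = Z ∷ Zs′ , (λ { (here e) → here e ; (there h) → there (sb h) }) ,
          All.tabulate (λ h → All.lookup d (sb h)) ∷ ds′ , (λ x∈ x∈Z → none (_ , x∈ , x∈Z)) ∷ dT , s≤s len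
avoid (Z ∷ Zs) T (d ∷ ds) | yes (x , x∈T , x∈Z) with avoid Zs (T ─ ⁅ x ⁆) ds
...   | Zs′ , sb , ds′ , dT , len = Zs′ , there ∘ sb , ds′ , All.tabulate disj ,
          subst (suc (length Zs) ≤_) (trans (sym (+-suc (length Zs′) _)) (cong (length Zs′ +_) (∣─⁅⁆∣ x∈T))) (s≤s len)
  where
  disj : ∀ {Z′} → Z′ ∈ₗ Zs′ → Disjointˢ T Z′
  disj h {y} y∈T y∈Z′ with y ≟ᶠ x
  ... | yes refl = All.lookup d (sb h) x∈Z y∈Z′
  ... | no y≢x = All.lookup dT h (∈-─⁺ y∈T (λ q → y≢x (x∈⁅y⁆⇒x≡y x q))) y∈Z′

listSet : ∀ {n} → List (Fin n) → Subset n
listSet xs = sub (λ y → Any.any? (y ≟ᶠ_) xs)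

∈-listSet⁺ : ∀ {n} (xs : List (Fin n)) {x} → x ∈ₗ xs → x ∈ listSet xs
∈-listSet⁺ xs = ∈-sub⁺ (λ y → Any.any? (y ≟ᶠ_) xs)

∈-listSet⁻ : ∀ {n} (xs : List (Fin n)) {x} → x ∈ listSet xs → x ∈ₗ xs
∈-listSet⁻ xs = ∈-sub⁻ (λ y → Any.any? (y ≟ᶠ_) xs)

∣listSet∣≤ : ∀ {n} (xs : List (Fin n)) → ∣ listSet xs ∣ ≤ length xs
∣listSet∣≤ xs = ∣∣≤length (listSet xs) xs (∈-listSet⁻ xs)

-- Shrinking the region to the path itself bounds its size, and hence the number of zones that have
-- to be avoided because of it.
rpath-tight : ∀ {n} {_~_ : Fin n → Fin n → Set} {R Root xs} → Graph.RPath _~_ R Root xs → Graph.RPath _~_ (listSet xs) Root xs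
rpath-tight (Graph.start {x} _ r) = Graph.start (∈-listSet⁺ (x ∷ []) (here refl)) r
rpath-tight {xs = x ∷ xs} (Graph.grow p e _ y∉) = Graph.grow (Graph.rpath-⊆ _ (λ h → ∈-listSet⁺ (x ∷ xs) (there (∈-listSet⁻ xs h))) (rpath-tight p)) e
  (∈-listSet⁺ (x ∷ xs) (here refl)) y∉

powerset : ∀ {n} → Subset n → List (Subset n)
powerset [] = [] ∷ []
powerset (false ∷ S) = map (outside ∷_) (powerset S)
powerset (true ∷ S) = map (inside ∷_) (powerset S) ++ map (outside ∷_) (powerset S)

length-powerset : ∀ {n} (S : Subset n) → length (powerset S) ≡ 2 ^ ∣ S ∣
length-powerset [] = refl
length-powerset (false ∷ S) = trans (length-map _ (powerset S)) (length-powerset S)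
length-powerset (true ∷ S) = trans (length-++ (map (inside ∷_) (powerset S)))
  (cong₂ _+_ (trans (length-map _ (powerset S)) (length-powerset S)) (trans (trans (length-map _ (powerset S)) (length-powerset S)) (sym (+-identityʳ _))))

∈-powerset : ∀ {n} {p S : Subset n} → p ⊆ S → p ∈ₗ powerset S
∈-powerset {p = []} {[]} _ = here refl
∈-powerset {p = true ∷ p} {false ∷ S} h with h here
... | ()
∈-powerset {p = false ∷ p} {false ∷ S} h = ∈-map⁺ (outside ∷_) (∈-powerset (λ x → drop-there (h (there x))))
∈-powerset {p = true ∷ p} {true ∷ S} h = ∈-++⁺ˡ (∈-map⁺ (inside ∷_) (∈-powerset (λ x → drop-there (h (there x)))))
∈-powerset {p = false ∷ p} {true ∷ S} h = ∈-++⁺ʳ (map (inside ∷_) (powerset S)) (∈-map⁺ (outside ∷_) (∈-powerset (λ x → drop-there (h (there x)))))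

pigeonhole : ∀ {A B : Set} (_≟B_ : DecidableEquality B) (f : A → B) {Q : A → A → Set} M (ys : List B) {xs : List A} → AllPairs Q xs →
  (∀ {x} → x ∈ₗ xs → f x ∈ₗ ys) → M * length ys < length xs →
  ∃[ y ] ∃[ zs ] (All (λ z → f z ≡ y) zs × AllPairs Q zs × (∀ {z} → z ∈ₗ zs → z ∈ₗ xs) × M < length zs)
pigeonhole _≟B_ f M [] {[]} _ h lt = ⊥-elim (<⇒≱ lt z≤n)
pigeonhole _≟B_ f M [] {x ∷ xs} _ h lt with h (here refl)
... | ()
pigeonhole _≟B_ f M (y ∷ ys) {xs} q h lt with M <? length (filter (λ x → f x ≟B y) xs)
... | yes big = y , filter (λ x → f x ≟B y) xs , AllP.all-filter (λ x → f x ≟B y) xs , AllPairs.filter⁺ (λ x → f x ≟B y) q ,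
        (λ z∈ → proj₁ (∈-filter⁻ (λ x → f x ≟B y) {xs = xs} z∈)) , big
... | no few with pigeonhole _≟B_ f M ys {filter (λ x → ¬? (f x ≟B y)) xs} (AllPairs.filter⁺ (λ x → ¬? (f x ≟B y)) q) h′ lt′
  where
  h′ : ∀ {x} → x ∈ₗ filter (λ x → ¬? (f x ≟B y)) xs → f x ∈ₗ ys
  h′ x∈ with ∈-filter⁻ (λ x → ¬? (f x ≟B y)) {xs = xs} x∈
  ... | x∈xs , ne with h x∈xs
  ...   | here e = ⊥-elim (ne e)
  ...   | there e = e
  split : ∀ xs → length xs ≡ length (filter (λ x → f x ≟B y) xs) + length (filter (λ x → ¬? (f x ≟B y)) xs)
  split [] = refl
  split (x ∷ xs) with f x ≟B y
  ... | yes _ = cong suc (split xs)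
  ... | no _ = trans (cong suc (split xs)) (sym (+-suc _ _))
  lt′ : M * length ys < length (filter (λ x → ¬? (f x ≟B y)) xs)
  lt′ = +-cancelˡ-< M _ _ (<-≤-trans (subst (_< length xs) (*-suc M (length ys)) lt)
          (≤-trans (≤-reflexive (split xs)) (+-monoˡ-≤ _ (≮⇒≥ few))))
... | z , zs , a , b , c , d = z , zs , a , b , (λ z∈ → proj₁ (∈-filter⁻ (λ x → ¬? (f x ≟B y)) {xs = xs} (c z∈))) , d

≡-subset? : ∀ {n} → DecidableEquality (Subset n)
≡-subset? = ≡-dec Bool._≟_

-- A path through `p` hubs with arms of `x + 1` and `y + 1` vertices at its two end hubs has
-- `2 * p + x + y + 1` vertices, here at least `2 * s + 3`. The hypothesis to be refuted is this
-- count being below `k`, free of subtraction.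
long-arms-exceed : ∀ {k s p x y} → k ≤ 3 + 2 * s → s < x + p → s < y + p → ¬ (2 * p + (suc y + suc (suc x)) < 2 + k)
long-arms-exceed {k} {s} {p} {x} {y} k≤ lx ly h = <⇒≱ h (begin
  2 + k ≤⟨ +-monoʳ-≤ 2 k≤ ⟩
  2 + (3 + 2 * s) ≡⟨ lhs s ⟩
  suc s + suc s + 3 ≤⟨ +-monoˡ-≤ 3 (+-mono-≤ lx ly) ⟩
  x + p + (y + p) + 3 ≡⟨ rhs x y p ⟩
  2 * p + (suc y + suc (suc x)) ∎)
  where
  open ≤-Reasoning
  lhs : ∀ s → 2 + (3 + 2 * s) ≡ suc s + suc s + 3
  lhs = solve-∀
  rhs : ∀ x y p → x + p + (y + p) + 3 ≡ 2 * p + (suc y + suc (suc x))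
  rhs = solve-∀

many-hubs-exceed : ∀ {k s p} → k ≤ 3 + 2 * s → s < p → ¬ (2 * p + 3 < 2 + k)
many-hubs-exceed {k} {s} {p} k≤ s<p h = <⇒≱ h (begin
  2 + k ≤⟨ +-monoʳ-≤ 2 k≤ ⟩
  2 + (3 + 2 * s) ≡⟨ lhs s ⟩
  2 * suc s + 3 ≤⟨ +-monoˡ-≤ 3 (*-monoʳ-≤ 2 s<p) ⟩
  2 * p + 3 ∎)
  where
  open ≤-Reasoning
  lhs : ∀ s → 2 + (3 + 2 * s) ≡ 2 * suc s + 3
  lhs = solve-∀

-- Constants and the arithmetic of removals

module Constants (ρ k : ℕ) where

  -- A piece of order `large M (suc d)` still has `M * suc (large M d)` vertices after the loss of
  -- one hyperedge. It then splits into a piece of more than `large M d` vertices or at least `M`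
  -- pieces below that.
  large : ℕ → ℕ → ℕ
  large M zero = 0
  large M (suc d) = suc ρ + M * suc (large M d)

  large-≤ : ∀ {M} d → 1 ≤ M → large M d ≤ large M (suc d)
  large-≤ {suc M} d _ = ≤-trans (n≤1+n _) (≤-trans (m≤m+n (suc (large (suc M) d)) (M * suc (large (suc M) d))) (m≤n+m _ (suc ρ)))

  abstract

    σ M₁ M₀ T N₀ : ℕ
    -- The set `S` consists of a start vertex and the vertices of at most `k - 1` hyperedges.
    σ = 1 + suc ρ * (k ∸ 1)
    -- Both factors `2 ^ σ` are pigeonholes over the subsets of `S`: here by hub neighbourhoods of
    -- components, in `M₀` by attachments of pieces. Of the components that remain, two carry the
    -- arms, `σ` suffice to link the hubs, and `4 * k` are the zones required around a core.
    M₁ = (2 + (σ + 4 * k)) * 2 ^ σ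
    M₀ = suc (M₁ * 2 ^ σ)
    T = large M₀ (k ∸ 1)
    N₀ = suc (M₀ * suc T)

    σ-def : σ ≡ 1 + suc ρ * (k ∸ 1)
    σ-def = refl

    M₁-def : M₁ ≡ (2 + (σ + 4 * k)) * 2 ^ σ
    M₁-def = refl

    M₀-def : M₀ ≡ suc (M₁ * 2 ^ σ)
    M₀-def = refl

    T-def : T ≡ large M₀ (k ∸ 1)
    T-def = refl

    N₀-def : N₀ ≡ suc (M₀ * suc T)
    N₀-def = refl

  1≤M₀ : 1 ≤ M₀
  1≤M₀ = subst (1 ≤_) (sym M₀-def) (s≤s z≤n)

  1≤M₁ : 1 ≤ M₁
  1≤M₁ = subst (1 ≤_) (sym M₁-def) (*-mono-≤ {1} {2 + (σ + 4 * k)} {1} {2 ^ σ} (s≤s z≤n) (m^n>0 2 σ))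

another : ∀ {n} {zs : List (Subset n)} {X} → AllPairs Disjointˢ zs → X ∈ₗ zs → 2 ≤ length zs → ∃ λ Y → Y ∈ₗ zs × Disjointˢ X Y
another {zs = Z ∷ Y ∷ zs} (d ∷ _) (here refl) _ = Y , there (here refl) , All.lookup d (here refl)
another {zs = Z ∷ zs} (d ∷ _) (there X∈) _ = Z , here refl , λ x∈ x∈Z → All.lookup d X∈ x∈Z x∈
another {zs = Z ∷ []} _ (here refl) (s≤s ())

remove-bounded : ∀ {c s e v v′ x t a a′} → a ≤ a′ + t → t < c * x → v′ + x ≡ v → a′ + c * s ≤ c * v′ + e → a + c * s ≤ c * v + e
remove-bounded {c} {s} {e} {v} {v′} {x} {t} {a} {a′} h₁ h₂ refl h₃ = begin
  a + c * s ≤⟨ +-monoˡ-≤ (c * s) h₁ ⟩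
  a′ + t + c * s ≡⟨ lhs a′ t (c * s) ⟩
  a′ + c * s + t ≤⟨ +-mono-≤ h₃ (<⇒≤ h₂) ⟩
  c * v′ + e + c * x ≡⟨ rhs c v′ e x ⟩
  c * (v′ + x) + e ∎
  where
  open ≤-Reasoning
  lhs : ∀ a t s → a + t + s ≡ a + s + t
  lhs = solve-∀
  rhs : ∀ c v e x → c * v + e + c * x ≡ c * (v + x) + e
  rhs = solve-∀

-- The removed set touches at least one hyperedge fewer than `c * x`. With weight `u` this spare
-- hyperedge pays for the `x ≤ u` lost vertices.
remove-progress : ∀ {c B u v v′ x t a a′} → a ≤ a′ + t → t < c * x → v′ + x ≡ v → x ≤ u →
  u * a′ + v′ ≤ u * (c * v′) + B → u * a + v ≤ u * (c * v) + B
remove-progress {c} {B} {u} {v} {v′} {x} {t} {a} {a′} h₁ h₂ refl x≤u h₃ = begin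
  u * a + (v′ + x) ≤⟨ +-mono-≤ (*-monoʳ-≤ u h₁) (+-monoʳ-≤ v′ x≤u) ⟩
  u * (a′ + t) + (v′ + u) ≡⟨ lhs u a′ t v′ ⟩
  u * a′ + v′ + u * suc t ≤⟨ +-mono-≤ h₃ (*-monoʳ-≤ u h₂) ⟩
  u * (c * v′) + B + u * (c * x) ≡⟨ rhs u c v′ B x ⟩
  u * (c * (v′ + x)) + B ∎
  where
  open ≤-Reasoning
  lhs : ∀ u a t v → u * (a + t) + (v + u) ≡ u * a + v + u * suc t
  lhs = solve-∀
  rhs : ∀ u c v B x → u * (c * v) + B + u * (c * x) ≡ u * (c * (v + x)) + B
  rhs = solve-∀

-- For large `v` the summand `v` on the left outweighs both `B` and the weighted term `c * s`.
progress-bounded : ∀ {c s B u v a} → suc u * a + v ≤ suc u * (c * v) + B → B + suc u * (c * s) ≤ v → a + c * s ≤ c * v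
progress-bounded {c} {s} {B} {u} {v} {a} h₁ h₂ = *-cancelˡ-≤ (suc u) (+-cancelʳ-≤ B _ _ (begin
  suc u * (a + c * s) + B ≡⟨ lhs (suc u) a (c * s) B ⟩
  suc u * a + (B + suc u * (c * s)) ≤⟨ +-monoʳ-≤ (suc u * a) h₂ ⟩
  suc u * a + v ≤⟨ h₁ ⟩
  suc u * (c * v) + B ∎))
  where
  open ≤-Reasoning
  lhs : ∀ u a b B → u * (a + b) + B ≡ u * a + (B + u * b)
  lhs = solve-∀

module Hypergraph {n m ρ : ℕ} (E : Fin m → Subset n) (E-injective : ∀ {e f} → E e ≡ E f → e ≡ f) (uniform : ∀ e → ∣ E e ∣ ≡ suc ρ)
                  (2≤ρ : 2 ≤ ρ) where

  1≤ρ : 1 ≤ ρ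
  1≤ρ = ≤-trans (s≤s z≤n) 2≤ρ

  -- The red-blue graph of a hypergraph relative to a set S of hubs

  -- The order picks one orientation of each pair, so that no unordered pair is represented twice.
  -- Hyperedges not inside `V` have no eligible pair, which restricts the matching to the hypergraph
  -- induced on `V` without reindexing.
  Eligible : (V S : Subset n) → Fin m → Fin n × Fin n → Set
  Eligible V S e (x , y) = x <ᶠ y × x ∈ E e × y ∈ E e × E e ⊆ V × ¬ (x ∈ S × y ∈ S)

  eligible? : ∀ V S e p → Dec (Eligible V S e p)
  eligible? V S e (x , y) = (x <ᶠ? y) ×-dec (x ∈? E e) ×-dec (y ∈? E e) ×-dec (E e ⊆? V) ×-dec ¬? ((x ∈? S) ×-dec (y ∈? S))

  pairs : (V S : Subset n) → Fin m → List (Fin n × Fin n)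
  pairs V S e = filter (eligible? V S e) (cartesianProduct (allFin n) (allFin n))

  ∈-pairs⁺ : ∀ {V S e p} → Eligible V S e p → p ∈ₗ pairs V S e
  ∈-pairs⁺ {V} {S} {e} {x , y} h = ∈-filter⁺ (eligible? V S e) (∈-cartesianProduct⁺ (∈-allFin x) (∈-allFin y)) h

  ∈-pairs⁻ : ∀ {V S e p} → p ∈ₗ pairs V S e → Eligible V S e p
  ∈-pairs⁻ {V} {S} {e} h = proj₂ (∈-filter⁻ (eligible? V S e) {xs = cartesianProduct (allFin n) (allFin n)} h)

  module Mt (V S : Subset n) = Matching (Prod.≡-dec _≟ᶠ_ _≟ᶠ_) (pairs V S)

  Rep : (Fin m → Maybe (Fin n × Fin n)) → Fin m → Fin n → Fin n → Set
  Rep μ e x y = μ e ≡ just (x , y) ⊎ μ e ≡ just (y , x)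

  Gr : (Fin m → Maybe (Fin n × Fin n)) → Fin n → Fin n → Set
  Gr μ x y = ∃ λ e → Rep μ e x y

  rep-sym : ∀ {μ e x y} → Rep μ e x y → Rep μ e y x
  rep-sym (inj₁ p) = inj₂ p
  rep-sym (inj₂ p) = inj₁ p

  gr-sym : ∀ {μ x y} → Gr μ x y → Gr μ y x
  gr-sym {μ} {x} {y} (e , p) = e , rep-sym {μ} {e} {x} {y} p

  rep? : ∀ μ e x y → Dec (Rep μ e x y)
  rep? μ e x y = Maybe.≡-dec (Prod.≡-dec _≟ᶠ_ _≟ᶠ_) (μ e) (just (x , y)) ⊎-dec Maybe.≡-dec (Prod.≡-dec _≟ᶠ_ _≟ᶠ_) (μ e) (just (y , x))

  gr? : ∀ μ x y → Dec (Gr μ x y)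
  gr? μ x y = any? (λ e → rep? μ e x y)

  module Colouring (V S : Subset n) {μ : Fin m → Maybe (Fin n × Fin n)} (valid : Mt.Valid V S μ) where

    private
      elig : ∀ {e p} → μ e ≡ just p → Eligible V S e p
      elig eq = ∈-pairs⁻ {V} {S} (Mt.admissible {V} {S} valid eq)

    rep∈ : ∀ {e x y} → Rep μ e x y → x ∈ E e × y ∈ E e
    rep∈ (inj₁ p) = case elig p of λ { (_ , a , b , _) → a , b }
    rep∈ (inj₂ p) = case elig p of λ { (_ , a , b , _) → b , a }

    rep-⊆ : ∀ {e x y} → Rep μ e x y → E e ⊆ V
    rep-⊆ (inj₁ p) = case elig p of λ { (_ , _ , _ , h , _) → h }
    rep-⊆ (inj₂ p) = case elig p of λ { (_ , _ , _ , h , _) → h }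

    rep-hub : ∀ {e x y} → Rep μ e x y → x ∈ S → y ∉ S
    rep-hub (inj₁ p) xs ys = case elig p of λ { (_ , _ , _ , _ , h) → h (xs , ys) }
    rep-hub (inj₂ p) xs ys = case elig p of λ { (_ , _ , _ , _ , h) → h (ys , xs) }

    <ᶠ-irr : ∀ {x y : Fin n} → x <ᶠ y → x ≢ y
    <ᶠ-irr p refl = <-irrefl refl p

    rep-≢ : ∀ {e x y} → Rep μ e x y → x ≢ y
    rep-≢ (inj₁ p) = <ᶠ-irr (proj₁ (elig p))
    rep-≢ (inj₂ p) = <ᶠ-irr (proj₁ (elig p)) ∘ sym

    rep-injective : ∀ {e f x y} → Rep μ e x y → Rep μ f x y → e ≡ f
    rep-injective (inj₁ p) (inj₁ q) = Mt.injective {V} {S} valid p q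
    rep-injective (inj₂ p) (inj₂ q) = Mt.injective {V} {S} valid p q
    rep-injective (inj₁ p) (inj₂ q) = ⊥-elim (<-asym (proj₁ (elig p)) (proj₁ (elig q)))
    rep-injective (inj₂ p) (inj₁ q) = ⊥-elim (<-asym (proj₁ (elig p)) (proj₁ (elig q)))

    rep-pair : ∀ {e x y u v} → Rep μ e x y → Rep μ e u v → u ≡ x ⊎ u ≡ y
    rep-pair (inj₁ p) (inj₁ q) with trans (sym p) q
    ... | refl = inj₁ refl
    rep-pair (inj₁ p) (inj₂ q) with trans (sym p) q
    ... | refl = inj₂ refl
    rep-pair (inj₂ p) (inj₁ q) with trans (sym p) q
    ... | refl = inj₂ refl
    rep-pair (inj₂ p) (inj₂ q) with trans (sym p) q
    ... | refl = inj₁ refl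

    gr-irrefl : ∀ {x} → ¬ Gr μ x x
    gr-irrefl (e , p) = rep-≢ p refl

    module _ {blue : Subset m} (closed : Mt.Closed V S μ blue) (cover : ∀ e → e ∈ blue ⊎ Mt.Matched V S μ e) where

      open Graph (Gr μ)

      Counted : Fin m → Set
      Counted e = E e ⊆ V × ¬ (E e ⊆ S)

      -- A blue hyperedge is a clique of the graph; a red one is counted by the pair that it represents.
      outsideOf : Fin m → Subset n
      outsideOf e with e ∈? blue | μ e
      ... | yes _ | _ = E e ─ S
      ... | no _ | just (x , y) = (⁅ x ⁆ ∪ ⁅ y ⁆) ─ S
      ... | no _ | nothing = ∅

      ∈-pair : ∀ {x y z : Fin n} → z ∈ ⁅ x ⁆ ∪ ⁅ y ⁆ → z ≡ x ⊎ z ≡ y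
      ∈-pair {x} {y} h with x∈p∪q⁻ ⁅ x ⁆ ⁅ y ⁆ h
      ... | inj₁ a = inj₁ (x∈⁅y⁆⇒x≡y x a)
      ... | inj₂ a = inj₂ (x∈⁅y⁆⇒x≡y y a)

      blue-adjacent : ∀ {e x y} → e ∈ blue → E e ⊆ V → x ∈ E e → y ∈ E e → x ≢ y → ¬ (x ∈ S × y ∈ S) → ∃ λ f → f ∈ blue × Rep μ f x y
      blue-adjacent {e} {x} {y} e∈ act x∈ y∈ x≢y h with <ᶠ-cmp x y
      ... | tri≈ _ eq _ = ⊥-elim (x≢y eq)
      ... | tri< lt _ _ = case closed e∈ (∈-pairs⁺ {V} {S} {e} (lt , x∈ , y∈ , act , h)) of λ { (f , f∈ , p) → f , f∈ , inj₁ p }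
      ... | tri> _ _ gt = case closed e∈ (∈-pairs⁺ {V} {S} {e} (gt , y∈ , x∈ , act , λ { (a , b) → h (b , a) })) of λ { (f , f∈ , p) → f , f∈ , inj₂ p }

      outsideOf-∉S : ∀ {e x} → x ∈ outsideOf e → x ∉ S
      outsideOf-∉S {e} x∈ with e ∈? blue | μ e
      ... | yes _ | _ = proj₂ (∈-─⁻ (E e) S x∈)
      ... | no _ | just (a , b) = proj₂ (∈-─⁻ (⁅ a ⁆ ∪ ⁅ b ⁆) S x∈)
      ... | no _ | nothing = ⊥-elim (∉⊥ x∈)

      outsideOf-∈ : ∀ {e x} → x ∈ outsideOf e → x ∈ E e
      outsideOf-∈ {e} x∈ with e ∈? blue | μ e in eq
      ... | yes _ | _ = proj₁ (∈-─⁻ (E e) S x∈)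
      ... | no _ | nothing = ⊥-elim (∉⊥ x∈)
      ... | no _ | just (a , b) with ∈-pair (proj₁ (∈-─⁻ (⁅ a ⁆ ∪ ⁅ b ⁆) S x∈))
      ...   | inj₁ refl = proj₁ (rep∈ (inj₁ eq))
      ...   | inj₂ refl = proj₂ (rep∈ (inj₁ eq))

      outsideOf-nonempty : ∀ {e} → Counted e → Nonempty (outsideOf e)
      outsideOf-nonempty {e} (act , ns) with e ∈? blue | μ e in eq
      ... | no ¬p | nothing = case cover e of λ { (inj₁ p) → ⊥-elim (¬p p) ; (inj₂ (_ , p)) → case trans (sym eq) p of λ () }
      ... | no _ | just (a , b) with a ∈? S
      ...   | no a∉ = a , ∈-─⁺ (x∈p∪q⁺ (inj₁ (x∈⁅x⁆ a))) a∉
      ...   | yes a∈ = b , ∈-─⁺ (x∈p∪q⁺ (inj₂ (x∈⁅x⁆ b))) (rep-hub (inj₁ eq) a∈)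
      outsideOf-nonempty {e} (act , ns) | yes _ | _ with nonempty? (E e ─ S)
      ... | yes p = p
      ... | no ¬p = ⊥-elim (ns (λ {x} x∈ → case x ∈? S of λ { (yes q) → q ; (no ¬q) → ⊥-elim (¬p (x , ∈-─⁺ x∈ ¬q)) }))

      outsideOf-clique : ∀ {e x y} → Counted e → x ∈ outsideOf e → y ∈ outsideOf e → x ≢ y → Gr μ x y
      outsideOf-clique {e} {x} {y} (act , _) x∈ y∈ x≢y with e ∈? blue | μ e in eq
      ... | no _ | nothing = ⊥-elim (∉⊥ x∈)
      ... | yes e∈ | _ = case blue-adjacent e∈ act (proj₁ (∈-─⁻ (E e) S x∈)) (proj₁ (∈-─⁻ (E e) S y∈)) x≢y
                           (λ { (a , _) → proj₂ (∈-─⁻ (E e) S x∈) a }) of λ { (f , _ , p) → f , p }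
      ... | no _ | just (a , b) with ∈-pair (proj₁ (∈-─⁻ (⁅ a ⁆ ∪ ⁅ b ⁆) S x∈)) | ∈-pair (proj₁ (∈-─⁻ (⁅ a ⁆ ∪ ⁅ b ⁆) S y∈))
      ...   | inj₁ refl | inj₁ refl = ⊥-elim (x≢y refl)
      ...   | inj₁ refl | inj₂ refl = e , inj₁ eq
      ...   | inj₂ refl | inj₁ refl = e , inj₂ eq
      ...   | inj₂ refl | inj₂ refl = ⊥-elim (x≢y refl)

      counted? : ∀ e → Dec (Counted e)
      counted? e = (E e ⊆? V) ×-dec ¬? (E e ⊆? S)

      inner? : ∀ R e → Dec (Counted e × outsideOf e ⊆ R)
      inner? R e = counted? e ×-dec (outsideOf e ⊆? R)

      at? : ∀ R x e → Dec ((Counted e × outsideOf e ⊆ R) × x ∈ outsideOf e)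
      at? R x e = inner? R e ×-dec (x ∈? outsideOf e)

      nbr? : ∀ R x y → Dec ((y ∈ R ⊎ y ∈ S) × Gr μ x y)
      nbr? R x y = ((y ∈? R) ⊎-dec (y ∈? S)) ×-dec gr? μ x y

      mass : Subset n → ℕ
      mass R = ∣ sub (inner? R) ∣

      -- Hubs are never deleted, so hub neighbours count whatever `R` is, and `N x ∅` consists of
      -- them alone.
      N : Fin n → Subset n → Subset n
      N x R = sub (nbr? R x)

      private
        red? : ∀ R x y → Dec ((y ∈ R ⊎ y ∈ S) × (∃ λ e → e ∉ blue × Rep μ e x y))
        red? R x y = ((y ∈? R) ⊎-dec (y ∈? S)) ×-dec any? (λ e → ¬? (e ∈? blue) ×-dec rep? μ e x y)

        blue? : ∀ R x y → Dec ((y ∈ R ⊎ y ∈ S) × (∃ λ e → e ∈ blue × Rep μ e x y))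
        blue? R x y = ((y ∈? R) ⊎-dec (y ∈? S)) ×-dec any? (λ e → (e ∈? blue) ×-dec rep? μ e x y)

        atRed? : ∀ R x e → Dec (((Counted e × outsideOf e ⊆ R) × x ∈ outsideOf e) × e ∉ blue)
        atRed? R x e = at? R x e ×-dec ¬? (e ∈? blue)

        atBlue? : ∀ R x e → Dec (((Counted e × outsideOf e ⊆ R) × x ∈ outsideOf e) × e ∈ blue)
        atBlue? R x e = at? R x e ×-dec (e ∈? blue)

        split-N : ∀ R x → ∣ sub (red? R x) ∣ + ∣ sub (blue? R x) ∣ ≤ ∣ N x R ∣
        split-N R x = ≤-trans (∣∪∣-disjoint disj) (p⊆q⇒∣p∣≤∣q∣ into)
          where
          disj : Disjointˢ (sub (red? R x)) (sub (blue? R x))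
          disj y∈ y∈′ with ∈-sub⁻ (red? R x) y∈ | ∈-sub⁻ (blue? R x) y∈′
          ... | _ , e , e∉ , p | _ , f , f∈ , q with rep-injective p q
          ...   | refl = e∉ f∈
          into : sub (red? R x) ∪ sub (blue? R x) ⊆ N x R
          into y∈ with x∈p∪q⁻ (sub (red? R x)) (sub (blue? R x)) y∈
          ... | inj₁ h = case ∈-sub⁻ (red? R x) h of λ { (a , e , _ , p) → ∈-sub⁺ (nbr? R x) (a , e , p) }
          ... | inj₂ h = case ∈-sub⁻ (blue? R x) h of λ { (a , e , _ , p) → ∈-sub⁺ (nbr? R x) (a , e , p) }

        in-R-or-S : ∀ {e R y} → e ∈ blue → outsideOf e ⊆ R → y ∈ E e → y ∈ R ⊎ y ∈ S
        in-R-or-S {e} {R} {y} e∈ h y∈ with y ∈? S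
        ... | yes p = inj₂ p
        ... | no ¬p with e ∈? blue
        ...   | yes _ = inj₁ (h (∈-─⁺ y∈ ¬p))
        ...   | no q = ⊥-elim (q e∈)

        pair-rep : ∀ {e R x} → e ∉ blue → outsideOf e ⊆ R → x ∈ outsideOf e → ∃ λ y → (y ∈ R ⊎ y ∈ S) × Rep μ e x y
        pair-rep {e} {R} {x} e∉ h x∈ with e ∈? blue | μ e in eq
        ... | yes p | _ = ⊥-elim (e∉ p)
        ... | no _ | nothing = ⊥-elim (∉⊥ x∈)
        ... | no _ | just (a , b) with ∈-pair (proj₁ (∈-─⁻ (⁅ a ⁆ ∪ ⁅ b ⁆) S x∈))
        ...   | inj₁ refl = b , (case b ∈? S of λ { (yes p) → inj₂ p ; (no ¬p) → inj₁ (h (∈-─⁺ (x∈p∪q⁺ (inj₂ (x∈⁅x⁆ b))) ¬p)) }) , inj₁ refl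
        ...   | inj₂ refl = a , (case a ∈? S of λ { (yes p) → inj₂ p ; (no ¬p) → inj₁ (h (∈-─⁺ (x∈p∪q⁺ (inj₁ (x∈⁅x⁆ a))) ¬p)) }) , inj₂ refl

        red-count : ∀ R x → ∣ sub (atRed? R x) ∣ ≤ ∣ sub (red? R x) ∣
        red-count R x = card-rel _ _ (λ e y → Rep μ e x y)
          (λ e∈ → case ∈-sub⁻ (atRed? R x) e∈ of λ { (((_ , h) , x∈) , e∉) → case pair-rep e∉ h x∈ of λ { (y , a , p) → y , ∈-sub⁺ (red? R x) (a , _ , e∉ , p) , p } })
          rep-injective

        -- All pairs at `x` in a blue hyperedge are represented by blue hyperedges. So the hyperedge
        -- without `x` is a set of `ρ` blue neighbours, and it determines the hyperedge.
        blue-count : ∀ R x → ∣ sub (atBlue? R x) ∣ ≤ ∣ sub (blue? R x) ∣ C ρ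
        blue-count R x = family-bound _ (λ e → E e ─ ⁅ x ⁆) _ ρ fam inj
          where
          fam : ∀ {e} → e ∈ sub (atBlue? R x) → (E e ─ ⁅ x ⁆) ⊆ sub (blue? R x) × ∣ E e ─ ⁅ x ⁆ ∣ ≡ ρ
          fam {e} e∈ with ∈-sub⁻ (atBlue? R x) e∈
          ... | (((act , _) , h) , x∈) , e∈b = (λ {y} y∈ → case ∈-─⁻ (E e) ⁅ x ⁆ y∈ of λ { (y∈E , y∉x) → ∈-sub⁺ (blue? R x) (in-R-or-S e∈b h y∈E ,
              blue-adjacent e∈b act (outsideOf-∈ x∈) y∈E (λ { refl → y∉x (x∈⁅x⁆ x) }) (λ { (a , _) → outsideOf-∉S {e} x∈ a })) })
            , cong pred (trans (∣─⁅⁆∣ (outsideOf-∈ x∈)) (uniform e))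
          inj : ∀ {e f} → e ∈ sub (atBlue? R x) → f ∈ sub (atBlue? R x) → E e ─ ⁅ x ⁆ ≡ E f ─ ⁅ x ⁆ → e ≡ f
          inj {e} {f} e∈ f∈ eq with ∈-sub⁻ (atBlue? R x) e∈ | ∈-sub⁻ (atBlue? R x) f∈
          ... | ((_ , x∈e) , _) | ((_ , x∈f) , _) = E-injective (⊆-antisym (half eq x∈f) (half (sym eq) x∈e))
            where
            half : ∀ {e f} → E e ─ ⁅ x ⁆ ≡ E f ─ ⁅ x ⁆ → x ∈ outsideOf f → E e ⊆ E f
            half {e} {f} eq x∈ {y} y∈ with y ≟ᶠ x
            ... | yes refl = outsideOf-∈ x∈
            ... | no y≢x = proj₁ (∈-─⁻ (E f) ⁅ x ⁆ (subst (y ∈_) eq (∈-─⁺ y∈ (λ h → y≢x (x∈⁅y⁆⇒x≡y x h)))))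

      -- With `a` red and `b` blue neighbours, `x` lies in at most `a` red and `b C ρ` blue
      -- hyperedges, and `a + b` is at most the degree. The slack `q` is treated like further red
      -- neighbours.
      at-bound : ∀ {R x t} q → ∣ N x R ∣ + q ≤ t → ρ < t → ∣ sub (at? R x) ∣ + q ≤ t C ρ
      at-bound {R} {x} {t} q h ρ<t = begin
        ∣ sub (at? R x) ∣ + q ≤⟨ +-monoˡ-≤ q (≤-trans (p⊆q⇒∣p∣≤∣q∣ into) (∣∪∣≤ (sub (atRed? R x)) (sub (atBlue? R x)))) ⟩
        (∣ sub (atRed? R x) ∣ + ∣ sub (atBlue? R x) ∣) + q ≤⟨ +-monoˡ-≤ q (+-mono-≤ (red-count R x) (blue-count R x)) ⟩
        (a + b C ρ) + q ≡⟨ swap-q (b C ρ) ⟩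
        (a + q) + b C ρ ≤⟨ mixed-bound {a + q} {b} (≤-trans (≤-reflexive (sym (swap-q b))) (≤-trans (+-monoˡ-≤ q (split-N R x)) h)) 1≤ρ ρ<t ⟩
        t C ρ ∎
        where
        open ≤-Reasoning
        a = ∣ sub (red? R x) ∣
        b = ∣ sub (blue? R x) ∣
        swap-q : ∀ c → (a + c) + q ≡ (a + q) + c
        swap-q c = trans (+-assoc a c q) (trans (cong (a +_) (+-comm c q)) (sym (+-assoc a q c)))
        into : sub (at? R x) ⊆ sub (atRed? R x) ∪ sub (atBlue? R x)
        into {e} e∈ with e ∈? blue
        ... | yes p = x∈p∪q⁺ (inj₂ (∈-sub⁺ (atBlue? R x) (∈-sub⁻ (at? R x) e∈ , p)))
        ... | no p = x∈p∪q⁺ (inj₁ (∈-sub⁺ (atRed? R x) (∈-sub⁻ (at? R x) e∈ , p)))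

      mass-delete : ∀ R x → mass R ≤ mass (R ─ ⁅ x ⁆) + ∣ sub (at? R x) ∣
      mass-delete R x = ≤-trans (p⊆q⇒∣p∣≤∣q∣ into) (∣∪∣≤ (sub (inner? (R ─ ⁅ x ⁆))) (sub (at? R x)))
        where
        into : sub (inner? R) ⊆ sub (inner? (R ─ ⁅ x ⁆)) ∪ sub (at? R x)
        into {e} e∈ with ∈-sub⁻ (inner? R) e∈ | x ∈? outsideOf e
        ... | h | yes p = x∈p∪q⁺ (inj₂ (∈-sub⁺ (at? R x) (h , p)))
        ... | c , h | no ¬p = x∈p∪q⁺ (inj₁ (∈-sub⁺ (inner? (R ─ ⁅ x ⁆)) (c , λ {y} y∈ → ∈-─⁺ (h y∈) (λ y∈x → ¬p (subst (_∈ outsideOf e) (x∈⁅y⁆⇒x≡y x y∈x) y∈)))))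

      mass-positive : ∀ R → 1 ≤ mass R → Nonempty R
      mass-positive R h with 1≤⇒Nonempty (sub (inner? R)) h
      ... | e , e∈ with ∈-sub⁻ (inner? R) e∈
      ...   | c , sb = case outsideOf-nonempty c of λ { (x , x∈) → x , sb x∈ }

      -- The sets `outsideOf e` are cliques, so none of them meets both `K` and its complement.
      mass-split : ∀ {R K} → R ⊆ V ─ S → ClosedIn (V ─ S) K → mass R ≤ mass K + mass (R ─ K)
      mass-split {R} {K} R⊆ cl = ≤-trans (p⊆q⇒∣p∣≤∣q∣ into) (∣∪∣≤ (sub (inner? K)) (sub (inner? (R ─ K))))
        where
        into : sub (inner? R) ⊆ sub (inner? K) ∪ sub (inner? (R ─ K))
        into {e} e∈ with ∈-sub⁻ (inner? R) e∈
        ... | c , h with outsideOf-nonempty c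
        ...   | x , x∈ with x ∈? K
        ...     | yes x∈K = x∈p∪q⁺ (inj₁ (∈-sub⁺ (inner? K) (c , all)))
          where
          all : outsideOf e ⊆ K
          all {y} y∈ with y ≟ᶠ x
          ... | yes refl = x∈K
          ... | no ne = cl x∈K (R⊆ (h y∈)) (outsideOf-clique c x∈ y∈ (ne ∘ sym))
        ...     | no x∉K = x∈p∪q⁺ (inj₂ (∈-sub⁺ (inner? (R ─ K)) (c , none)))
          where
          none : outsideOf e ⊆ R ─ K
          none {y} y∈ with y ≟ᶠ x
          ... | yes refl = ∈-─⁺ (h y∈) x∉K
          ... | no ne = ∈-─⁺ (h y∈) (λ y∈K → x∉K (cl y∈K (R⊆ (h x∈)) (outsideOf-clique c y∈ x∈ ne)))

      Overfull : ℕ → (Fin n → Set) → Subset n → Set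
      Overfull t Root R = ∃[ R′ ] ∃[ x ] ∃[ xs ] (R′ ⊆ R × RPath R′ Root (x ∷ xs) × (∀ {z} → z ∈ R′ → Gr μ x z → z ∈ₗ x ∷ xs) × t < ∣ N x R′ ∣)

      -- Delete the end of a path that cannot be prolonged, as long as its degree is at most t.
      degenerate : ∀ t q {Root R} → ρ < t → Nonempty R → (∀ {y} → y ∈ R → Reach R Root y) →
        (∀ {x} → x ∈ R → ∣ N x ∅ ∣ + q ≤ t) → Overfull t Root R ⊎ mass R + q ≤ (t C ρ) * ∣ R ∣
      degenerate t q {Root} ρ<t = go _ ≤-refl
        where
        go : ∀ fuel {R} → ∣ R ∣ ≤ fuel → Nonempty R → (∀ {y} → y ∈ R → Reach R Root y) →
          (∀ {x} → x ∈ R → ∣ N x ∅ ∣ + q ≤ t) → Overfull t Root R ⊎ mass R + q ≤ (t C ρ) * ∣ R ∣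
        go zero {R} bnd ne _ _ = ⊥-elim (<⇒≱ (Nonempty⇒1≤ ne) bnd)
        go (suc fuel) {R} bnd (x₀ , x₀∈) re hub with reach⇒rpath (re x₀∈)
        ... | _ , p₀ with maximal-rpath (gr? μ) p₀
        ...   | x , xs , p , mx with t <? ∣ N x R ∣
        ...     | yes big = inj₁ (R , x , xs , id , p , mx , big)
        ...     | no ¬big with nonempty? (R ─ ⁅ x ⁆)
        -- The slack `q` is spent on the last vertex: all its neighbours are hubs, and the
        -- assumption on hub neighbours leaves room for `q`.
        ...       | no empty = inj₂ (≤-trans (+-monoˡ-≤ q (≤-trans (mass-delete R x) (+-monoˡ-≤ _ (≤-reflexive mass0))))
                      (≤-trans (at-bound q (≤-trans (+-monoˡ-≤ q (p⊆q⇒∣p∣≤∣q∣ N⊆)) (hub (rpath∈ p (here refl)))) ρ<t)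
                        (≤-trans (≤-reflexive (sym (*-identityʳ (t C ρ)))) (*-monoʳ-≤ (t C ρ) (Nonempty⇒1≤ (x , rpath∈ p (here refl)))))))
          where
          mass0 : mass (R ─ ⁅ x ⁆) ≡ 0
          mass0 with mass (R ─ ⁅ x ⁆) in eq
          ... | zero = refl
          ... | suc _ = ⊥-elim (empty (mass-positive (R ─ ⁅ x ⁆) (subst (1 ≤_) (sym eq) (s≤s z≤n))))
          N⊆ : N x R ⊆ N x ∅
          N⊆ {y} y∈ with ∈-sub⁻ (nbr? R x) y∈
          ... | inj₂ y∈S , g = ∈-sub⁺ (nbr? ∅ x) (inj₂ y∈S , g)
          ... | inj₁ y∈R , g = ⊥-elim (empty (y , ∈-─⁺ y∈R (λ h → gr-irrefl (subst (Gr μ x) (x∈⁅y⁆⇒x≡y x h) g))))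
        ...       | yes ne′ with go fuel (s≤s⁻¹ (≤-trans (≤-reflexive (∣─⁅⁆∣ (rpath∈ p (here refl)))) bnd)) ne′
                       (λ y∈ → case ∈-─⁻ R ⁅ x ⁆ y∈ of λ { (y∈R , y∉) → delete-end p mx (re y∈R) (λ { refl → y∉ (x∈⁅x⁆ x) }) })
                       (λ y∈ → hub (proj₁ (∈-─⁻ R ⁅ x ⁆ y∈)))
        ...         | inj₁ (R′ , z , zs , sb , rest) = inj₁ (R′ , z , zs , (λ y∈ → proj₁ (∈-─⁻ R ⁅ x ⁆ (sb y∈))) , rest)
        ...         | inj₂ ih = inj₂ (begin
          mass R + q ≤⟨ +-monoˡ-≤ q (mass-delete R x) ⟩
          mass (R ─ ⁅ x ⁆) + ∣ sub (at? R x) ∣ + q ≡⟨ +-assoc (mass (R ─ ⁅ x ⁆)) _ q ⟩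
          mass (R ─ ⁅ x ⁆) + (∣ sub (at? R x) ∣ + q) ≡⟨ cong (mass (R ─ ⁅ x ⁆) +_) (+-comm _ q) ⟩
          mass (R ─ ⁅ x ⁆) + (q + ∣ sub (at? R x) ∣) ≡⟨ sym (+-assoc (mass (R ─ ⁅ x ⁆)) q _) ⟩
          mass (R ─ ⁅ x ⁆) + q + ∣ sub (at? R x) ∣ ≤⟨ +-mono-≤ ih (≤-trans (m≤m+n _ 0) (at-bound 0 (≤-trans (≤-reflexive (+-identityʳ _)) (≮⇒≥ ¬big)) ρ<t)) ⟩
          (t C ρ) * ∣ R ─ ⁅ x ⁆ ∣ + t C ρ ≡⟨ +-comm _ (t C ρ) ⟩
          t C ρ + (t C ρ) * ∣ R ─ ⁅ x ⁆ ∣ ≡⟨ sym (*-suc (t C ρ) _) ⟩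
          (t C ρ) * suc ∣ R ─ ⁅ x ⁆ ∣ ≡⟨ cong ((t C ρ) *_) (∣─⁅⁆∣ (rpath∈ p (here refl))) ⟩
          (t C ρ) * ∣ R ∣ ∎)
          where open ≤-Reasoning

  -- Berge paths

  data Walk : Fin n → List (Fin m) → List (Fin n) → Set where
    []   : ∀ {v} → Walk v [] []
    step : ∀ {v w e es vs} → v ∈ E e → w ∈ E e → Walk w es vs → Walk v (e ∷ es) (w ∷ vs)

  record BPath (v : Fin n) (es : List (Fin m)) (vs : List (Fin n)) : Set where
    constructor bpath
    field
      walk       : Walk v es vs
      unique-vs  : Unique (v ∷ vs)
      unique-es  : Unique es
  open BPath public

  NoLong : ℕ → Set
  NoLong k = ∀ {v es vs} → BPath v es vs → suc (length vs) < k

  ∉⇒All≢ : ∀ {A : Set} {x : A} {xs} → x ∉ₗ xs → All (x ≢_) xs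
  ∉⇒All≢ h = All.tabulate (λ { y∈ refl → h y∈ })

  prepend : ∀ {u v e es vs} → BPath v es vs → u ∈ E e → v ∈ E e → u ∉ₗ v ∷ vs → e ∉ₗ es → BPath u (e ∷ es) (v ∷ vs)
  prepend (bpath w uv ue) u∈ v∈ u∉ e∉ = bpath (step u∈ v∈ w) (∉⇒All≢ u∉ ∷ uv) (∉⇒All≢ e∉ ∷ ue)

  path-functions : ∀ j {v es vs} → BPath v es vs → j ≤ length vs →
    ∃[ f ] ∃[ g ] (f zero ≡ v × Injective _≡_ _≡_ f × Injective _≡_ _≡_ g × (∀ (i : Fin (suc j)) → f i ∈ₗ v ∷ vs) × (∀ (i : Fin j) → g i ∈ₗ es) ×
      (∀ i → f (inject₁ i) ∈ E (g i) × f (suc i) ∈ E (g i)))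
  path-functions zero {v} _ _ = (λ _ → v) , (λ ()) , refl , (λ { {zero} {zero} _ → refl }) , (λ { {()} }) , (λ _ → here refl) , (λ ()) , (λ ())
  path-functions (suc j) {v} {e ∷ es} (bpath (step v∈ w∈ w) (v∉ ∷ uv) (e∉ ∷ ue)) (s≤s le)
    with path-functions j (bpath w uv ue) le
  ... | f , g , f0 , f-inj , g-inj , f∈ , g∈ , inc = f′ , g′ , refl , f′-inj , g′-inj , f′∈ , g′∈ , inc′
    where
    f′ : Fin (suc (suc j)) → Fin n
    f′ zero = v
    f′ (suc i) = f i
    g′ : Fin (suc j) → Fin m
    g′ zero = e
    g′ (suc i) = g i
    f′-inj : Injective _≡_ _≡_ f′
    f′-inj {zero} {zero} _ = refl
    f′-inj {zero} {suc i} eq = ⊥-elim (All.lookup v∉ (f∈ i) eq)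
    f′-inj {suc i} {zero} eq = ⊥-elim (All.lookup v∉ (f∈ i) (sym eq))
    f′-inj {suc i} {suc i′} eq = cong suc (f-inj eq)
    g′-inj : Injective _≡_ _≡_ g′
    g′-inj {zero} {zero} _ = refl
    g′-inj {zero} {suc i} eq = ⊥-elim (All.lookup e∉ (g∈ i) eq)
    g′-inj {suc i} {zero} eq = ⊥-elim (All.lookup e∉ (g∈ i) (sym eq))
    g′-inj {suc i} {suc i′} eq = cong suc (g-inj eq)
    f′∈ : ∀ i → f′ i ∈ₗ v ∷ _
    f′∈ zero = here refl
    f′∈ (suc i) = there (f∈ i)
    g′∈ : ∀ i → g′ i ∈ₗ e ∷ es
    g′∈ zero = here refl
    g′∈ (suc i) = there (g∈ i)
    inc′ : ∀ i → f′ (inject₁ i) ∈ E (g′ i) × f′ (suc i) ∈ E (g′ i)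
    inc′ zero = v∈ , subst (_∈ E e) (sym f0) w∈
    inc′ (suc i) = inc i

  last : Fin n → List (Fin n) → Fin n
  last v [] = v
  last v (w ∷ vs) = last w vs

  -- The first path is reversed onto the second one step by step, with the common start moving along
  -- it.
  reverse-join : ∀ {b es₁ vs₁ es₂ vs₂} → BPath b es₁ vs₁ → BPath b es₂ vs₂ →
    (∀ {x} → x ∈ₗ vs₁ → x ∉ₗ vs₂) → (∀ {e} → e ∈ₗ es₁ → e ∉ₗ es₂) →
    ∃[ es ] ∃[ vs ] (BPath (last b vs₁) es vs × length vs ≡ length vs₁ + length vs₂ ×
      (∀ {x} → x ∈ₗ last b vs₁ ∷ vs → x ∈ₗ b ∷ vs₁ ⊎ x ∈ₗ b ∷ vs₂) × (∀ {e} → e ∈ₗ es → e ∈ₗ es₁ ⊎ e ∈ₗ es₂))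
  reverse-join (bpath [] _ _) q _ _ = _ , _ , q , refl , inj₂ , inj₂
  reverse-join {b} {e ∷ es₁} {w ∷ vs₁} {es₂} {vs₂} (bpath (step b∈ w∈ p) ((b≢w ∷ b∉) ∷ uv) (e∉ ∷ ue)) q dv de
    with reverse-join (bpath p uv ue)
           (prepend q w∈ b∈ (λ { (here refl) → b≢w refl ; (there h) → dv (here refl) h }) (de (here refl)))
           (λ { x∈ (here refl) → All.lookup b∉ x∈ refl ; x∈ (there h) → dv (there x∈) h })
           (λ { x∈ (here refl) → All.lookup e∉ x∈ refl ; x∈ (there h) → de (there x∈) h })
  ... | es , vs , r , len , sub-v , sub-e = es , vs , r , trans len (+-suc (length vs₁) (length vs₂)) ,
      (λ x∈ → case sub-v x∈ of λ { (inj₁ h) → inj₁ (there h) ; (inj₂ (here refl)) → inj₁ (there (here refl)) ; (inj₂ (there h)) → inj₂ h }) ,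
      (λ x∈ → case sub-e x∈ of λ { (inj₁ h) → inj₁ (there h) ; (inj₂ (here refl)) → inj₁ (here refl) ; (inj₂ (there h)) → inj₂ h })

  -- Growing Berge paths through hubs and zones

  module _ (μ : Fin m → Maybe (Fin n × Fin n)) where

    open Graph (Gr μ)

    -- Such a set lets a path pass from any hub of `P` to any other.
    record Zone (P Z : Subset n) : Set where
      field
        touches   : ∀ {a} → a ∈ P → ∃ λ y → y ∈ Z × Gr μ a y
        connected : Conn Z
        off       : Disjointˢ Z P

    zone-link : ∀ {P Z a b} → Zone P Z → a ∈ P → b ∈ P → ∃[ y ] ∃[ ys ] (RPath Z (Gr μ a) (y ∷ ys) × Gr μ b y)
    zone-link z a∈ b∈ with Zone.touches z a∈ | Zone.touches z b∈
    ... | x , x∈ , g | y , y∈ , g′ = y , _ , proj₂ (reach⇒rpath (reach-trans (root x∈ g) (Zone.connected z x∈ y∈))) , g′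

  -- U is a set of vertices to be avoided: each edge of the initial path represents a pair inside the path or a pair meeting U.
  module Grow (V S U : Subset n) {μ : Fin m → Maybe (Fin n × Fin n)} (valid : Mt.Valid V S μ) where

    open Colouring V S valid
    open Graph (Gr μ)

    record Cur (v : Fin n) (T : Subset n) (l : ℕ) : Set where
      constructor cur
      field
        {es}  : List (Fin m)
        {vs}  : List (Fin n)
        path  : BPath v es vs
        long  : l ≤ suc (length vs)
        verts : ∀ {x} → x ∈ₗ v ∷ vs → x ∈ T
        reps  : ∀ {e x y} → e ∈ₗ es → Rep μ e x y → x ∈ T ⊎ (x ∈ U ⊎ y ∈ U)

    cur-single : ∀ v → Cur v ⁅ v ⁆ 1
    cur-single v = cur (bpath [] ([] ∷ []) []) ≤-refl (λ { (here refl) → x∈⁅x⁆ v }) (λ ())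

    cur-⊆ : ∀ {v T U l} → T ⊆ U → Cur v T l → Cur v U l
    cur-⊆ h (cur p lg vt rp) = cur p lg (h ∘ vt) (λ e∈ r → [ inj₁ ∘ h , inj₂ ]′ (rp e∈ r))

    cur-prepend : ∀ {u v T l} → Cur v T l → Gr μ u v → u ∉ T → u ∉ U → v ∉ U → Cur u (T ∪ ⁅ u ⁆) (suc l)
    cur-prepend {u} {v} {T} (cur p lg vt rp) (e , r) u∉ u∉U v∉U = cur
      (prepend p (proj₁ (rep∈ r)) (proj₂ (rep∈ r)) (u∉ ∘ vt) (λ e∈ → [ u∉ , [ u∉U , v∉U ]′ ]′ (rp e∈ r))) (s≤s lg)
      (λ { (here refl) → x∈p∪q⁺ (inj₂ (x∈⁅x⁆ u)) ; (there h) → x∈p∪q⁺ (inj₁ (vt h)) })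
      (λ { (here refl) q → inj₁ (case rep-pair r q of λ { (inj₁ refl) → x∈p∪q⁺ (inj₂ (x∈⁅x⁆ u)) ; (inj₂ refl) → x∈p∪q⁺ (inj₁ (vt (here refl))) })
         ; (there h) q → [ (λ t → inj₁ (x∈p∪q⁺ (inj₁ t))) , inj₂ ]′ (rp h q) })

    front : ∀ {b T l R x xs} → Cur b T l → RPath R (Gr μ b) (x ∷ xs) → Disjointˢ R T → b ∉ U → Disjointˢ R U →
      ∃ λ T′ → Cur x T′ (length (x ∷ xs) + l) × (∀ {y} → y ∈ T′ → y ∈ T ⊎ y ∈ₗ x ∷ xs)
    front {T = T} {x = x} c (start x∈ g) d b∉U dU = T ∪ ⁅ x ⁆ , cur-prepend c (gr-sym {μ} g) (d x∈) (dU x∈) b∉U ,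
      (λ h → case x∈p∪q⁻ T ⁅ x ⁆ h of λ { (inj₁ a) → inj₁ a ; (inj₂ a) → inj₂ (here (x∈⁅y⁆⇒x≡y x a)) })
    front {x = x} c (grow p e x∈ x∉) d b∉U dU with front c p d b∉U dU
    ... | T′ , c′ , h = T′ ∪ ⁅ x ⁆ , cur-prepend c′ (gr-sym {μ} e) (λ x∈′ → case h x∈′ of λ { (inj₁ a) → d x∈ a ; (inj₂ a) → x∉ a }) (dU x∈) (dU (rpath∈ p (here refl))) ,
      (λ y∈ → case x∈p∪q⁻ T′ ⁅ x ⁆ y∈ of λ { (inj₂ a) → inj₂ (here (x∈⁅y⁆⇒x≡y x a)) ; (inj₁ a) → case h a of λ { (inj₁ b) → inj₁ b ; (inj₂ b) → inj₂ (there b) } })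

    -- The path is traversed from its grown end back to its root, so that `b` becomes the end at
    -- which the Berge path can be prolonged.
    outward : ∀ {b R x xs} → RPath R (Gr μ b) (x ∷ xs) → b ∉ R → b ∉ U → Disjointˢ R U → Cur b (R ∪ ⁅ b ⁆) (suc (length (x ∷ xs)))
    outward {b} {R} {x} {xs} p b∉ b∉U dU = subst (Cur b _) (cong suc (+-comm (length xs) 1)) (go p (cur-single x) (λ h → subst (_∈ R) (sym (x∈⁅y⁆⇒x≡y x h)) (rpath∈ p (here refl)))
        (λ h → subst (_∉ₗ _) (sym (x∈⁅y⁆⇒x≡y x h)) (Uniq.Unique[x∷xs]⇒x∉xs (rpath-unique p))))
      where
      go : ∀ {x xs T l} → RPath R (Gr μ b) (x ∷ xs) → Cur x T l → T ⊆ R → (∀ {y} → y ∈ T → y ∉ₗ xs) → Cur b (R ∪ ⁅ b ⁆) (suc (length xs + l))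
      go {T = T} (start x∈ g) c T⊆ _ = cur-⊆ up (cur-prepend c g (b∉ ∘ T⊆) b∉U (dU x∈))
        where
        up : T ∪ ⁅ b ⁆ ⊆ R ∪ ⁅ b ⁆
        up h = case x∈p∪q⁻ T ⁅ b ⁆ h of λ { (inj₁ a) → x∈p∪q⁺ (inj₁ (T⊆ a)) ; (inj₂ a) → x∈p∪q⁺ (inj₂ a) }
      go {x} {x′ ∷ xs} {T} {l} (grow p e x∈ _) c T⊆ d = subst (Cur b _) (cong suc (+-suc (length xs) l))
        (go p (cur-prepend c e (λ h → d h (here refl)) (dU (rpath∈ p (here refl))) (dU x∈))
          (λ h → case x∈p∪q⁻ T ⁅ x′ ⁆ h of λ { (inj₁ a) → T⊆ a ; (inj₂ a) → subst (_∈ R) (sym (x∈⁅y⁆⇒x≡y x′ a)) (rpath∈ p (here refl)) })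
          (λ h z∈ → case x∈p∪q⁻ T ⁅ x′ ⁆ h of λ { (inj₁ a) → d a (there z∈)
             ; (inj₂ a) → Uniq.Unique[x∷xs]⇒x∉xs (rpath-unique p) (subst (_∈ₗ xs) (x∈⁅y⁆⇒x≡y x′ a) z∈) }))

    -- Each further hub uses up one fresh zone and adds at least one vertex of that zone besides
    -- itself, hence the factor 2.
    chain : ∀ {P a T l} → Disjointˢ P U → (hubs : List (Fin n)) (Zs : List (Subset n)) → Cur a T l → a ∈ P → All (_∈ P) hubs → Unique hubs →
      (∀ {h} → h ∈ₗ hubs → h ∉ T) → All (Zone μ P) Zs → AllPairs Disjointˢ Zs → All (Disjointˢ T) Zs → All (Disjointˢ U) Zs → length hubs ≤ length Zs →
      ∃ λ T′ → Cur (last a hubs) T′ (2 * length hubs + l) × (∀ {y} → y ∈ T′ → y ∈ T ⊎ y ∈ₗ hubs ⊎ Any (y ∈_) Zs)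
    chain _ [] Zs c a∈ _ _ _ _ _ _ _ _ = _ , c , inj₁
    chain _ (h ∷ hs) [] c a∈ _ _ _ _ _ _ _ ()
    chain {P} {a} {T} {l} PU (h ∷ hs) (Z ∷ Zs) c a∈ (h∈ ∷ hs∈) (h∉ ∷ u) off (z ∷ zs) (dZ ∷ dZs) (dT ∷ dTs) (dU ∷ dUs) (s≤s le)
      with zone-link μ z a∈ h∈
    ... | y , ys , p , g with front c p (λ r t → dT t r) (PU a∈) (λ r t → dU t r)
    ...   | T₁ , c₁ , sub₁ with chain PU hs Zs (cur-prepend c₁ g h∉T₁ (PU h∈) (λ t → dU t (rpath∈ p (here refl)))) h∈ hs∈ u off′ zs dZs dTs′ dUs le
      where
      h∉T₁ : h ∉ T₁
      h∉T₁ h∈′ = case sub₁ h∈′ of λ { (inj₁ t) → off (here refl) t ; (inj₂ t) → Zone.off z (rpath∈ p t) h∈ }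
      T₂ = T₁ ∪ ⁅ h ⁆
      sub₂ : ∀ {x} → x ∈ T₂ → x ∈ T ⊎ x ∈ Z ⊎ x ≡ h
      sub₂ x∈ with x∈p∪q⁻ T₁ ⁅ h ⁆ x∈
      ... | inj₂ q = inj₂ (inj₂ (x∈⁅y⁆⇒x≡y h q))
      ... | inj₁ q with sub₁ q
      ...   | inj₁ t = inj₁ t
      ...   | inj₂ t = inj₂ (inj₁ (rpath∈ p t))
      off′ : ∀ {x} → x ∈ₗ hs → x ∉ T₂
      off′ x∈ t with sub₂ t
      ... | inj₁ q = off (there x∈) q
      ... | inj₂ (inj₁ q) = Zone.off z q (All.lookup hs∈ x∈)
      ... | inj₂ (inj₂ refl) = All.lookup h∉ x∈ refl
      dTs′ : All (Disjointˢ T₂) Zs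
      dTs′ = All.tabulate λ {Z′} Z′∈ {x} t x∈′ → case sub₂ t of λ
        { (inj₁ q) → All.lookup dTs Z′∈ q x∈′ ; (inj₂ (inj₁ q)) → All.lookup dZ Z′∈ q x∈′ ; (inj₂ (inj₂ refl)) → Zone.off (All.lookup zs Z′∈) x∈′ h∈ }
    ...     | T′ , c′ , sub′ = T′ , record { Cur c′ ; long = ≤-trans lens (Cur.long c′) } , sub″
      where
      T₂ = T₁ ∪ ⁅ h ⁆
      lens : 2 * suc (length hs) + l ≤ 2 * length hs + suc (length (y ∷ ys) + l)
      lens = begin
        2 * suc (length hs) + l ≡⟨ cong (_+ l) (*-suc 2 (length hs)) ⟩
        2 + 2 * length hs + l ≡⟨ cong (_+ l) (+-comm 2 (2 * length hs)) ⟩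
        2 * length hs + 2 + l ≡⟨ +-assoc (2 * length hs) 2 l ⟩
        2 * length hs + (2 + l) ≤⟨ +-monoʳ-≤ (2 * length hs) (s≤s (s≤s (m≤n+m l (length ys)))) ⟩
        2 * length hs + suc (length (y ∷ ys) + l) ∎
        where open ≤-Reasoning
      sub″ : ∀ {x} → x ∈ T′ → x ∈ T ⊎ x ∈ₗ h ∷ hs ⊎ Any (x ∈_) (Z ∷ Zs)
      sub″ x∈ with sub′ x∈
      ... | inj₂ (inj₁ q) = inj₂ (inj₁ (there q))
      ... | inj₂ (inj₂ q) = inj₂ (inj₂ (there q))
      ... | inj₁ q with x∈p∪q⁻ T₁ ⁅ h ⁆ q
      ...   | inj₂ q′ = inj₂ (inj₁ (here (x∈⁅y⁆⇒x≡y h q′)))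
      ...   | inj₁ q′ with sub₁ q′
      ...     | inj₁ t = inj₁ t
      ...     | inj₂ t = inj₂ (inj₂ (here (rpath∈ p t)))

    last-++ : ∀ b xs a → last b (xs ++ a ∷ []) ≡ a
    last-++ b [] a = refl
    last-++ b (x ∷ xs) a = last-++ x xs a

    -- The path comes out of one arm at `b`, runs through the other hubs with `a` placed last, and
    -- enters the second arm. It has at least `2 * (∣ P ∣ - 1)` vertices besides those of the arms
    -- and `b`. With a single hub both arms meet there.
    two-ends : ∀ {k} → NoLong k → ∀ {P a b T l R x xs} → Disjointˢ P U → Disjointˢ R U → (Zs : List (Subset n)) → Cur b T l → b ∈ P → (∀ {x} → x ∈ T → x ∈ P → x ≡ b) →
      a ∈ P → a ≢ b ⊎ ∣ P ∣ ≤ 1 → RPath R (Gr μ a) (x ∷ xs) → Disjointˢ R T → Disjointˢ R P →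
      All (Zone μ P) Zs → AllPairs Disjointˢ Zs → All (Disjointˢ T) Zs → All (Disjointˢ U) Zs → All (Disjointˢ R) Zs → ∣ P ∣ ≤ suc (length Zs) →
      2 * ∣ P ∣ + (length (x ∷ xs) + l) < 2 + k
    two-ends {k} noLong {P} {a} {b} {T} {l} {R} {x} {xs} PU RU Zs c b∈ TP a∈ (inj₁ a≢b) p dRT dRP zs dZs dT dU dR le =
      subst (λ z → 2 * z + (length (x ∷ xs) + l) < 2 + k) eqP
        (subst (λ z → z + (length (x ∷ xs) + l) < 2 + k) (sym (*-suc 2 (length hubs))) (s≤s (s≤s bound)))
      where
      Q = (P ─ ⁅ a ⁆) ─ ⁅ b ⁆
      hubs = elements Q ++ a ∷ []
      b∈′ : b ∈ P ─ ⁅ a ⁆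
      b∈′ = ∈-─⁺ b∈ (λ h → a≢b (sym (x∈⁅y⁆⇒x≡y a h)))
      Q⁻ : ∀ {y} → y ∈ Q → y ∈ P × y ≢ a × y ≢ b
      Q⁻ y∈ with ∈-─⁻ (P ─ ⁅ a ⁆) ⁅ b ⁆ y∈
      ... | u , v with ∈-─⁻ P ⁅ a ⁆ u
      ...   | w , z = w , (λ { refl → z (x∈⁅x⁆ a) }) , (λ { refl → v (x∈⁅x⁆ b) })
      hub∈ : ∀ {y} → y ∈ₗ hubs → y ∈ P × y ≢ b
      hub∈ y∈ with ∈-++⁻ (elements Q) y∈
      ... | inj₁ h = case Q⁻ (∈-elements⁻ h) of λ { (u , _ , v) → u , v }
      ... | inj₂ (here refl) = a∈ , a≢b
      lenQ : length hubs ≡ suc ∣ Q ∣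
      lenQ = trans (length-++ (elements Q)) (trans (+-comm _ 1) (cong suc (length-elements Q)))
      eqP : suc (length hubs) ≡ ∣ P ∣
      eqP = trans (cong suc (trans lenQ (∣─⁅⁆∣ b∈′))) (∣─⁅⁆∣ a∈)
      uniq : Unique hubs
      uniq = Uniq.++⁺ (Unique-elements Q) ([] ∷ []) λ { (h , here refl) → proj₁ (proj₂ (Q⁻ (∈-elements⁻ h))) refl }
      bound : 2 * length hubs + (length (x ∷ xs) + l) < k
      bound with chain PU hubs Zs c b∈ (All.tabulate (proj₁ ∘ hub∈)) uniq (λ h t → proj₂ (hub∈ h) (TP t (proj₁ (hub∈ h)))) zs dZs dT dU
                   (s≤s⁻¹ (≤-trans (≤-reflexive eqP) le))
      ... | T′ , c′ , sub′ with front (subst (λ z → Cur z T′ (2 * length hubs + l)) (last-++ b (elements Q) a) c′) p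
                (λ r t → case sub′ t of λ { (inj₁ q) → dRT r q ; (inj₂ (inj₁ q)) → dRP r (proj₁ (hub∈ q))
                                          ; (inj₂ (inj₂ q)) → case find q of λ { (Z , Z∈ , q′) → All.lookup dR Z∈ r q′ } }) (PU a∈) RU
      ...   | _ , d , _ = ≤-<-trans (≤-trans (≤-reflexive re-order) (Cur.long d)) (noLong (Cur.path d))
        where
        re-order : 2 * length hubs + (length (x ∷ xs) + l) ≡ length (x ∷ xs) + (2 * length hubs + l)
        re-order = trans (sym (+-assoc (2 * length hubs) (length (x ∷ xs)) l)) (trans (cong (_+ l) (+-comm (2 * length hubs) (length (x ∷ xs)))) (+-assoc (length (x ∷ xs)) (2 * length hubs) l))
    two-ends {k} noLong {P} {a} {b} {T} {l} {R} {x} {xs} PU RU Zs c b∈ TP a∈ (inj₂ P≤1) p dRT dRP zs dZs dT dU dR le with a ≟ᶠ b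
    ... | no a≢b = two-ends noLong PU RU Zs c b∈ TP a∈ (inj₁ a≢b) p dRT dRP zs dZs dT dU dR le
    ... | yes refl with front c p dRT (PU a∈) RU
    ...   | _ , d , _ = ≤-trans (s≤s (+-monoˡ-≤ _ (*-monoʳ-≤ 2 P≤1))) (s≤s (s≤s (≤-<-trans (Cur.long d) (noLong (Cur.path d)))))

  -- Pieces of the hypergraph and Berge paths into them

  Adj : Subset n → Fin n → Fin n → Set
  Adj V x y = ∃ λ e → E e ⊆ V × x ∈ E e × y ∈ E e

  adj-sym : ∀ {V x y} → Adj V x y → Adj V y x
  adj-sym (e , h , x∈ , y∈) = e , h , y∈ , x∈

  adj? : ∀ V x y → Dec (Adj V x y)
  adj? V x y = any? (λ e → (E e ⊆? V) ×-dec (x ∈? E e) ×-dec (y ∈? E e))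

  module GH (V : Subset n) = Graph (Adj V)

  Piece : (V S X : Subset n) → Set
  Piece V S X = GH.Component V (V ─ S) X

  piece-closed : ∀ {V S X e x y} → Piece V S X → E e ⊆ V → x ∈ E e → x ∈ X → y ∈ E e → y ∉ S → y ∈ X
  piece-closed {V} c h x∈ x∈X y∈ y∉ = GH.Component.closed c x∈X (∈-─⁺ (h y∈) y∉) (_ , h , x∈ , y∈)

  Attached : (V X : Subset n) → Fin n → Set
  Attached V X b = ∃[ e ] ∃[ x ] (E e ⊆ V × b ∈ E e × x ∈ E e × x ∈ X)

  walk-∉ : ∀ {u es vs} (D : Subset n) → Walk u es vs → All (_∉ D) vs → ∀ {e} → e ∈ₗ es → ∃ λ x → x ∈ E e × x ∉ D
  walk-∉ D (step {w = w} _ w∈ _) (w∉ ∷ _) (here refl) = w , w∈ , w∉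
  walk-∉ D (step _ _ p) (_ ∷ h) (there e∈) = walk-∉ D p h e∈

  last-in : ∀ {v es vs} (D : Subset n) → BPath v es vs → v ∈ D →
    ∃[ u ] ∃[ es′ ] ∃[ vs′ ] (BPath u es′ vs′ × u ∈ D × All (_∉ D) vs′ × last u vs′ ≡ last v vs ×
      (∀ {x} → x ∈ₗ u ∷ vs′ → x ∈ₗ v ∷ vs) × (∀ {e} → e ∈ₗ es′ → e ∈ₗ es))
  last-in D p v∈ with go D p
    where
    go : ∀ {v es vs} (D : Subset n) → BPath v es vs → (∃[ u ] ∃[ es′ ] ∃[ vs′ ] (BPath u es′ vs′ × u ∈ D × All (_∉ D) vs′ × last u vs′ ≡ last v vs ×
      (∀ {x} → x ∈ₗ u ∷ vs′ → x ∈ₗ v ∷ vs) × (∀ {e} → e ∈ₗ es′ → e ∈ₗ es))) ⊎ All (_∉ D) (v ∷ vs)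
    go {v} D q@(bpath [] _ _) with v ∈? D
    ... | yes p = inj₁ (_ , _ , _ , q , p , [] , refl , id , id)
    ... | no ¬p = inj₂ (¬p ∷ [])
    go {v} D q@(bpath (step _ _ w) (_ ∷ uv) (_ ∷ ue)) with go D (bpath w uv ue)
    ... | inj₁ (u , es′ , vs′ , r , u∈ , al , eq , sv , se) = inj₁ (u , es′ , vs′ , r , u∈ , al , eq , there ∘ sv , there ∘ se)
    ... | inj₂ al with v ∈? D
    ...   | yes p = inj₁ (_ , _ , _ , q , p , al , refl , id , id)
    ...   | no ¬p = inj₂ (¬p ∷ al)
  ... | inj₁ r = r
  ... | inj₂ (v∉ ∷ _) = ⊥-elim (v∉ v∈)

  module Approach {V S X K : Subset n} {b : Fin n} (pc : Piece V S X) (b∉X : b ∉ X) (K⊆X : K ⊆ X) where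

    -- No hyperedge of such a path represents a pair that meets `K`, so a path of the graph inside
    -- `K` can be attached to it without repetition.
    record Clear (y : Fin n) : Set where
      constructor clear
      field
        {es}  : List (Fin m)
        {vs}  : List (Fin n)
        path  : BPath y es vs
        ends  : last y vs ≡ b
        verts : ∀ {x} → x ∈ₗ y ∷ vs → x ≡ b ⊎ (x ∈ X × x ∉ K)
        links : ∀ {e} → e ∈ₗ es → E e ⊆ V × (∃ λ x → x ∈ E e × x ∈ X) × Disjointˢ (E e) K

    record Hit : Set where
      constructor hit
      field
        {y v} : Fin n
        {g}   : Fin m
        upto  : Clear y
        g⊆V   : E g ⊆ V
        y∈    : y ∈ E g
        v∈    : v ∈ E g
        v∈K   : v ∈ K

    extend : ∀ {y z e} → Clear y → E e ⊆ V → y ∈ E e → z ∈ E e → z ∈ X → Hit ⊎ Clear z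
    extend {y} {z} {e} c e⊆ y∈ z∈ z∈X with any? (λ v → (v ∈? E e) ×-dec (v ∈? K))
    ... | yes (v , v∈ , v∈K) = inj₁ (hit c e⊆ y∈ v∈ v∈K)
    ... | no none with last-in (E e) (Clear.path c) y∈
    ...   | u , es′ , vs′ , p , u∈ , al , eq , sv , se with z ≟ᶠ u
    ...     | yes refl = inj₂ (clear p (trans eq (Clear.ends c)) (Clear.verts c ∘ sv) (Clear.links c ∘ se))
    ...     | no z≢u = inj₂ (clear (prepend p z∈ u∈ (λ { (here q) → z≢u q ; (there h) → All.lookup al h z∈ })
                  (λ h → case walk-∉ (E e) (walk p) al h of λ { (x , x∈ , x∉) → x∉ x∈ })) (trans eq (Clear.ends c))
                (λ { (here refl) → inj₂ (z∈X , λ z∈K → none (z , z∈ , z∈K)) ; (there h) → Clear.verts c (sv h) })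
                (λ { (here refl) → e⊆ , (z , z∈ , z∈X) , (λ x∈ x∈K → none (_ , x∈ , x∈K)) ; (there h) → Clear.links c (se h) }))

    approach : Attached V X b → Nonempty K → Hit
    approach (e , x , e⊆ , b∈ , x∈ , x∈X) (v , v∈K) with go (GH.Component.connected pc x∈X (K⊆X v∈K))
      where
      go : ∀ {y} → GH.Reach V X (x ≡_) y → Hit ⊎ Clear y
      go (Graph.root _ refl) = extend (clear (bpath [] ([] ∷ []) []) refl (λ { (here refl) → inj₁ refl }) (λ ())) e⊆ b∈ x∈ x∈X
      go (Graph.step r (f , f⊆ , y∈ , z∈) z∈X) with go r
      ... | inj₁ h = inj₁ h
      ... | inj₂ c = extend c f⊆ y∈ z∈ z∈X
    ... | inj₁ h = h
    ... | inj₂ c with Clear.verts c (here refl)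
    ...   | inj₁ refl = ⊥-elim (b∉X (K⊆X v∈K))
    ...   | inj₂ (_ , v∉) = ⊥-elim (v∉ v∈K)

  -- Dense components without hub neighbours

  module Hubless (V S : Subset n) {μ : Fin m → Maybe (Fin n × Fin n)} (valid : Mt.Valid V S μ) {blue : Subset m}
                 (closed : Mt.Closed V S μ blue) (cover : ∀ e → e ∈ blue ⊎ Mt.Matched V S μ e) where

    open Colouring V S valid
    open Graph (Gr μ)

    root∈ : ∀ {R v zs} → RPath R (v ≡_) zs → v ∈ₗ zs
    root∈ (start _ refl) = here refl
    root∈ (grow p _ _ _) = there (root∈ p)

    module _ {X K : Subset n} {b : Fin n} (pc : Piece V S X) (b∉X : b ∉ X) (K⊆X : K ⊆ X) where

      open Approach pc b∉X K⊆X

      Rooted : Fin m → Fin n → Set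
      Rooted g v = ∀ {w w′} → w ∈ K → Rep μ g w w′ → v ≡ w ⊎ v ≡ w′

      -- The connecting edge g may itself represent an edge of K; choosing v in that pair, only the first edge of a path from v is affected.
      re-root : (h : Hit) → ∃ λ v → v ∈ E (Hit.g h) × v ∈ K × Rooted (Hit.g h) v
      re-root h with any? (λ w → (w ∈? K) ×-dec any? (λ w′ → rep? μ (Hit.g h) w w′))
      ... | yes (w , w∈ , w′ , r) = w , proj₁ (rep∈ r) , w∈ , λ _ r′ → rep-pair r′ r
      ... | no none = Hit.v h , Hit.v∈ h , Hit.v∈K h , λ w∈ r → ⊥-elim (none (_ , w∈ , _ , r))

      -- `long` does not count the initial path, although it contributes at least `y`. That vertex
      -- makes up for `v` in the case where `v` has to be skipped.
      record Grown (y : Fin n) (es₀ : List (Fin m)) (vs₀ : List (Fin n)) (g : Fin m) (z : Fin n) (zs : List (Fin n)) : Set where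
        constructor grown
        field
          {es}  : List (Fin m)
          {vs}  : List (Fin n)
          path  : BPath z es vs
          ends  : last z vs ≡ last y vs₀
          long  : length (z ∷ zs) ≤ suc (length vs)
          verts : ∀ {x} → x ∈ₗ z ∷ vs → x ∈ₗ z ∷ zs ⊎ x ∈ₗ y ∷ vs₀
          links : ∀ {e} → e ∈ₗ es → e ∈ₗ g ∷ es₀ ⊎ (∃[ x ] ∃[ x′ ] (Rep μ e x x′ × x ∈ₗ z ∷ zs × x′ ∈ₗ z ∷ zs))

      module _ (h : Hit) {v} (v∈ : v ∈ E (Hit.g h)) (v∈K : v ∈ K) (rooted : Rooted (Hit.g h) v) {R} (R⊆K : R ⊆ K) where

        open Hit h using (y; g; upto; y∈)
        open Clear upto using () renaming (es to es₀; vs to vs₀; path to path₀; verts to verts₀; links to links₀)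

        K∉path : ∀ {z} → z ∈ K → z ∉ₗ y ∷ vs₀
        K∉path z∈ h′ with verts₀ h′
        ... | inj₁ refl = b∉X (K⊆X z∈)
        ... | inj₂ (_ , z∉) = z∉ z∈

        g∉es₀ : g ∉ₗ es₀
        g∉es₀ h′ = proj₂ (proj₂ (links₀ h′)) v∈ v∈K

        by-g : ∀ {z} → z ∈ E g → z ∈ K → BPath z (g ∷ es₀) (y ∷ vs₀)
        by-g z∈ z∈K = prepend path₀ z∈ y∈ (K∉path z∈K) g∉es₀

        grow-further : ∀ {z x xs e} → Grown y es₀ vs₀ g x xs → Rep μ e x z → z ∈ R → z ∉ₗ x ∷ xs → e ≢ g → Grown y es₀ vs₀ g z (x ∷ xs)
        grow-further {z} {x} {xs} {e} (grown p ends long vt ed) r z∈ z∉ e≢g = grown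
          (prepend p (proj₂ (rep∈ r)) (proj₁ (rep∈ r)) (λ h′ → case vt h′ of λ { (inj₁ q) → z∉ q ; (inj₂ q) → K∉path (R⊆K z∈) q })
            (λ h′ → case ed h′ of λ
              { (inj₁ (here q)) → e≢g q
              ; (inj₁ (there q)) → proj₂ (proj₂ (links₀ q)) (proj₂ (rep∈ r)) (R⊆K z∈)
              ; (inj₂ (a , a′ , q , a∈ , a′∈)) → case rep-pair q (rep-sym {μ} {e} {x} {z} r) of λ { (inj₁ refl) → z∉ a∈ ; (inj₂ refl) → z∉ a′∈ } }))
          ends (s≤s long)
          (λ { (here refl) → inj₁ (here refl) ; (there h′) → case vt h′ of λ { (inj₁ q) → inj₁ (there q) ; (inj₂ q) → inj₂ q } })
          (λ { (here refl) → inj₂ (_ , _ , r , there (here refl) , here refl)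
             ; (there h′) → case ed h′ of λ { (inj₁ q) → inj₁ q ; (inj₂ (a , a′ , q , a∈ , a′∈)) → inj₂ (a , a′ , q , there a∈ , there a′∈) } })

        grow-all : ∀ {z zs} → RPath R (v ≡_) (z ∷ zs) → Grown y es₀ vs₀ g z zs
        grow-all (start z∈ refl) = grown (by-g v∈ v∈K) refl (s≤s z≤n) (λ { (here q) → inj₁ (here q) ; (there q) → inj₂ q }) inj₁
        grow-all (grow p@(start _ refl) (e , r) z∈ z∉) with e ≟ᶠ g
        ... | no e≢g = grow-further (grow-all p) r z∈ z∉ e≢g
        -- The first edge of the path is represented by `g` itself, so `g` leads directly to its
        -- second vertex and `v` is skipped.
        ... | yes refl = grown (by-g (proj₂ (rep∈ r)) (R⊆K z∈)) refl (s≤s (s≤s z≤n)) (λ { (here q) → inj₁ (here q) ; (there q) → inj₂ q }) inj₁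
        grow-all {z} (grow {x} p@(grow p′ _ x∈ x∉) (e , r) z∈ z∉) = grow-further (grow-all p) r z∈ z∉ e≢g
          where
          e≢g : e ≢ g
          e≢g refl = case rooted (R⊆K x∈) r of λ { (inj₁ refl) → x∉ (root∈ p′) ; (inj₂ refl) → z∉ (there (root∈ p′)) }

      -- Without hub neighbours the slack 1 is available in `degenerate`, so the density of `K`
      -- forces the end of some maximal path to have more than `t` neighbours, all of them on that
      -- path.
      hubless-path : ∀ {t} → ρ < t → Attached V X b → Component (V ─ S) K → (∀ {x a} → x ∈ K → a ∈ S → ¬ Gr μ x a) →
        (t C ρ) * ∣ K ∣ ≤ mass closed cover K →
        ∃[ es ] ∃[ vs ] (BPath b es vs × suc t ≤ length vs × (∀ {x} → x ∈ₗ vs → x ∈ X) ×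
          (∀ {e} → e ∈ₗ es → E e ⊆ V × (∃ λ x → x ∈ E e × x ∈ X)))
      hubless-path {t} ρ<t att cK nohub big with approach att (Component.inhabited cK)
      ... | h with re-root h
      ...   | v , v∈ , v∈K , rooted with degenerate closed cover t 1 {Root = v ≡_} ρ<t (v , v∈K)
                    (λ y∈ → Component.connected cK v∈K y∈)
                    (λ {x} x∈ → subst (λ z → z + 1 ≤ t) (sym (none x∈)) (≤-trans 1≤ρ (<⇒≤ ρ<t)))
        where
        none : ∀ {x} → x ∈ K → ∣ N closed cover x ∅ ∣ ≡ 0
        none {x} x∈ with ∣ N closed cover x ∅ ∣ in eq
        ... | zero = refl
        ... | suc _ with 1≤⇒Nonempty (N closed cover x ∅) (subst (1 ≤_) (sym eq) (s≤s z≤n))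
        ...   | y , y∈ with ∈-sub⁻ (nbr? closed cover ∅ x) y∈
        ...     | inj₁ y∈∅ , _ = ⊥-elim (∉⊥ y∈∅)
        ...     | inj₂ y∈S , gr = ⊥-elim (nohub x∈ y∈S gr)
      ...     | inj₂ small = ⊥-elim (<⇒≱ (subst (_≤ (t C ρ) * ∣ K ∣) (+-comm _ 1) small) big)
      ...     | inj₁ (R , x , xs , R⊆K , p , mx , deg) = result
        where
        gw = grow-all h v∈ v∈K rooted R⊆K p
        open Grown gw
        t<xs : t < length xs
        t<xs = <-≤-trans deg (∣∣≤length (N closed cover x R) xs into)
          where
          into : ∀ {z} → z ∈ N closed cover x R → z ∈ₗ xs
          into {z} z∈ with ∈-sub⁻ (nbr? closed cover R x) z∈
          ... | inj₂ z∈S , gr = ⊥-elim (nohub (R⊆K (rpath∈ p (here refl))) z∈S gr)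
          ... | inj₁ z∈R , gr with mx z∈R gr
          ...   | there q = q
          ...   | here refl = ⊥-elim (gr-irrefl gr)
        ends-b : last x vs ≡ b
        ends-b = trans ends (Clear.ends (Hit.upto h))
        vert-X : ∀ {w} → w ∈ₗ x ∷ vs → w ≡ b ⊎ w ∈ X
        vert-X w∈ with verts w∈
        ... | inj₁ q = inj₂ (K⊆X (R⊆K (rpath∈ p q)))
        ... | inj₂ q with Clear.verts (Hit.upto h) q
        ...   | inj₁ r = inj₁ r
        ...   | inj₂ (r , _) = inj₂ r
        edge-X : ∀ {e} → e ∈ₗ es → E e ⊆ V × (∃ λ w → w ∈ E e × w ∈ X)
        edge-X e∈ with links e∈
        ... | inj₁ (here refl) = Hit.g⊆V h , v , v∈ , K⊆X v∈K
        ... | inj₁ (there q) = proj₁ (Clear.links (Hit.upto h) q) , proj₁ (proj₂ (Clear.links (Hit.upto h) q))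
        ... | inj₂ (a , a′ , r , a∈ , _) = rep-⊆ r , a , proj₁ (rep∈ r) , K⊆X (R⊆K (rpath∈ p a∈))
        result : ∃[ es ] ∃[ vs ] (BPath b es vs × suc t ≤ length vs × (∀ {x} → x ∈ₗ vs → x ∈ X) ×
          (∀ {e} → e ∈ₗ es → E e ⊆ V × (∃ λ x → x ∈ E e × x ∈ X)))
        result with reverse-join path (bpath {v = x} [] ([] ∷ []) []) (λ _ ()) (λ _ ())
        ... | es′ , vs′ , q , len , sv , se = es′ , vs′ , subst (λ z → BPath z es′ vs′) ends-b q
            , subst (suc t ≤_) (sym (trans len (+-identityʳ _))) (≤-trans t<xs (s≤s⁻¹ long))
            , (λ {w} w∈ → case vert-X (back (there w∈)) of λ { (inj₂ r) → r
                 ; (inj₁ refl) → ⊥-elim (Uniq.Unique[x∷xs]⇒x∉xs (unique-vs q) (subst (_∈ₗ vs′) (sym ends-b) w∈)) })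
            , (λ e∈ → edge-X (case se e∈ of λ { (inj₁ r) → r ; (inj₂ ()) }))
          where
          back : ∀ {w} → w ∈ₗ last x vs ∷ vs′ → w ∈ₗ x ∷ vs
          back w∈ with sv w∈
          ... | inj₁ r = r
          ... | inj₂ (here refl) = here refl

  attached-exists : ∀ {V S X} → S ⊆ V → GH.Conn V V → Piece V S X → Nonempty S → ∃ λ a → a ∈ S × Attached V X a
  attached-exists {V} {S} {X} S⊆V cV pc (s , s∈) with GH.Component.inhabited pc
  ... | x , x∈ with GH.crossing V X (cV (proj₁ (∈-─⁻ V S (GH.Component.within pc x∈))) (S⊆V s∈)) x∈
                     (λ s∈X → proj₂ (∈-─⁻ V S (GH.Component.within pc s∈X)) s∈)
  ...   | u , v , u∈X , _ , v∉X , v∈V , (e , e⊆ , u∈ , v∈) with v ∈? S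
  ...     | yes v∈S = v , v∈S , e , u , e⊆ , v∈ , u∈ , u∈X
  ...     | no v∉S = ⊥-elim (v∉X (piece-closed pc e⊆ u∈ u∈X v∈ v∉S))

  module Mass (V S : Subset n) {μ : Fin m → Maybe (Fin n × Fin n)} (valid : Mt.Valid V S μ) {blue : Subset m}
              (closed : Mt.Closed V S μ blue) (cover : ∀ e → e ∈ blue ⊎ Mt.Matched V S μ e) where

    open Colouring V S valid
    open Graph (Gr μ)

    gr⇒adj : ∀ {x y} → Gr μ x y → Adj V x y
    gr⇒adj (e , r) = e , rep-⊆ r , rep∈ r

    massOf : Subset n → ℕ
    massOf = mass closed cover

    piece-of : ∀ {K} → Component (V ─ S) K → ∃ λ X → Piece V S X × K ⊆ X
    piece-of {K} c with Component.inhabited c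
    ... | x , x∈ with GH.component-of V (adj? V) adj-sym (V ─ S) (Component.within c x∈)
    ...   | X , x∈X , pc = X , pc , λ y∈ → closed-reach (GH.Component.closed pc) (Component.within c) (reach-map gr⇒adj (Component.connected c x∈ y∈)) x∈X

    -- This is averaging over components. If `K` fails, the rest has mass above `c` times its order,
    -- so it meets the condition with 1 and hence with any `δ ≤ 1`.
    find-component : ∀ c δ → δ ≤ 1 → ∀ fuel {R} → ∣ R ∣ ≤ fuel → R ⊆ V ─ S → ClosedIn (V ─ S) R → Nonempty R →
      c * ∣ R ∣ + δ ≤ massOf R → ∃ λ K → Component (V ─ S) K × K ⊆ R × c * ∣ K ∣ + δ ≤ massOf K
    find-component c δ δ≤1 zero bnd _ _ ne _ = ⊥-elim (<⇒≱ (Nonempty⇒1≤ ne) bnd)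
    find-component c δ δ≤1 (suc fuel) {R} bnd R⊆ cl (x , x∈) big with component-of (gr? μ) (gr-sym {μ}) (V ─ S) (R⊆ x∈)
    ... | K , x∈K , cK with c * ∣ K ∣ + δ ≤? massOf K
    ...   | yes p = K , cK , (λ y∈ → closed-reach cl (Component.within cK) (Component.connected cK x∈K y∈) x∈) , p
    ...   | no small = recurse
      where
      K⊆R : K ⊆ R
      K⊆R y∈ = closed-reach cl (Component.within cK) (Component.connected cK x∈K y∈) x∈
      R′ = R ─ K
      more : c * ∣ R′ ∣ < massOf R′
      more = +-cancelʳ-< (c * ∣ K ∣ + δ) (c * ∣ R′ ∣) (massOf R′) (begin-strict
        c * ∣ R′ ∣ + (c * ∣ K ∣ + δ) ≡⟨ sym (+-assoc (c * ∣ R′ ∣) (c * ∣ K ∣) δ) ⟩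
        c * ∣ R′ ∣ + c * ∣ K ∣ + δ ≡⟨ cong (_+ δ) (sym (*-distribˡ-+ c ∣ R′ ∣ ∣ K ∣)) ⟩
        c * (∣ R′ ∣ + ∣ K ∣) + δ ≡⟨ cong (λ z → c * z + δ) (∣─∣ K⊆R) ⟩
        c * ∣ R ∣ + δ ≤⟨ big ⟩
        massOf R ≤⟨ mass-split closed cover R⊆ (Component.closed cK) ⟩
        massOf K + massOf R′ ≡⟨ +-comm (massOf K) _ ⟩
        massOf R′ + massOf K <⟨ +-monoʳ-< (massOf R′) (≰⇒> small) ⟩
        massOf R′ + (c * ∣ K ∣ + δ) ∎)
        where open ≤-Reasoning
      R′<R : ∣ R′ ∣ < ∣ R ∣
      R′<R = p⊂q⇒∣p∣<∣q∣ ((λ h → proj₁ (∈-─⁻ R K h)) , x , x∈ , λ h → proj₂ (∈-─⁻ R K h) x∈K)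
      recurse : ∃ λ K → Component (V ─ S) K × K ⊆ R × c * ∣ K ∣ + δ ≤ massOf K
      recurse with find-component c δ δ≤1 fuel {R′} (s≤s⁻¹ (≤-trans R′<R bnd)) (λ h → R⊆ (proj₁ (∈-─⁻ R K h)))
                    (λ y∈ z∈ g → case ∈-─⁻ R K y∈ of λ { (y∈R , y∉K) → ∈-─⁺ (cl y∈R z∈ g) (λ z∈K → y∉K (Component.closed cK z∈K (R⊆ y∈R) (gr-sym {μ} g))) })
                    (mass-positive closed cover R′ (≤-trans (s≤s z≤n) more))
                    (≤-trans (≤-trans (+-monoʳ-≤ (c * ∣ R′ ∣) δ≤1) (≤-reflexive (+-comm (c * ∣ R′ ∣) 1))) more)
      ... | L , cL , L⊆ , p = L , cL , (λ h → proj₁ (∈-─⁻ R K (L⊆ h))) , p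

  -- s is ⌊k/2⌋ - 1, the size of the core of the extremal hypergraph.
  module LargeOrder (s k : ℕ) (ρ<s : ρ < s) (noLong : NoLong k) (k≥ : 2 + 2 * s ≤ k) (k≤ : k ≤ 3 + 2 * s) where

    3≤s : 3 ≤ s
    3≤s = ≤-trans (s≤s 2≤ρ) ρ<s

    s≤k : s ≤ k
    s≤k = ≤-trans (≤-trans (m≤m+n s (s + 0)) (m≤n+m (2 * s) 2)) k≥

    8≤k : 8 ≤ k
    8≤k = ≤-trans (+-monoʳ-≤ 2 (*-monoʳ-≤ 2 3≤s)) k≥

    size≥2 : ∀ {A : Subset n} {b} → 2 ≤ ∣ A ∣ → b ∈ A → ∃ λ a → a ∈ A × a ≢ b
    size≥2 {A} {b} h b∈ with 1≤⇒Nonempty (A ─ ⁅ b ⁆) (s≤s⁻¹ (≤-trans h (≤-reflexive (sym (∣─⁅⁆∣ b∈)))))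
    ... | a , a∈ with ∈-─⁻ A ⁅ b ⁆ a∈
    ...   | u , v = a , u , λ { refl → v (x∈⁅x⁆ a) }

    walk-lengths : ∀ {v es vs} → Walk v es vs → length es ≡ length vs
    walk-lengths [] = refl
    walk-lengths (step _ _ w) = cong suc (walk-lengths w)

    edgesIn : Subset n → Subset m
    edgesIn V = sub (λ e → E e ⊆? V)

    -- This is the number of hyperedges of the extremal hypergraph that contain both extra vertices,
    -- which exist for odd `k` only.
    extra : ℕ
    extra with k ≟ 3 + 2 * s
    ... | yes _ = s C pred ρ
    ... | no _ = 0

    extra-odd : k ≡ 3 + 2 * s → extra ≡ s C pred ρ
    extra-odd eq with k ≟ 3 + 2 * s
    ... | yes _ = refl
    ... | no ne = ⊥-elim (ne eq)

    extra-even : k ≢ 3 + 2 * s → extra ≡ 0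
    extra-even ne with k ≟ 3 + 2 * s
    ... | yes eq = ⊥-elim (ne eq)
    ... | no _ = refl

    -- The exact bound around a core of s hubs

    module Core (V A : Subset n) (A⊆V : A ⊆ V) (∣A∣ : ∣ A ∣ ≡ s) (cV : GH.Conn V V)
                {μ : Fin m → Maybe (Fin n × Fin n)} (valid : Mt.Valid V A μ) {blue : Subset m}
                (closed : Mt.Closed V A μ blue) (cover : ∀ e → e ∈ blue ⊎ Mt.Matched V A μ e)
                (Zs : List (Subset n)) (zones : All (Zone μ A) Zs) (disjoint : AllPairs Disjointˢ Zs) (many : 4 * k ≤ length Zs) where

      open Colouring V A valid
      open Graph (Gr μ)
      open Mass V A valid closed cover

      2≤∣A∣ : 2 ≤ ∣ A ∣
      2≤∣A∣ = subst (2 ≤_) (sym ∣A∣) (≤-trans (n≤1+n 2) 3≤s)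

      A-nonempty : Nonempty A
      A-nonempty = 1≤⇒Nonempty A (≤-trans (s≤s z≤n) 2≤∣A∣)

      module _ (U : Subset n) (AU : Disjointˢ A U) where

        open Grow V A U valid

        two-arms : ∀ {a b T l R x xs} → Cur b T l → b ∈ A → (∀ {x} → x ∈ T → x ∈ A → x ≡ b) → a ∈ A → a ≢ b →
          RPath R (Gr μ a) (x ∷ xs) → Disjointˢ (listSet (x ∷ xs)) T → Disjointˢ R A → Disjointˢ (listSet (x ∷ xs)) U →
          ∣ T ∣ + ∣ U ∣ + length (x ∷ xs) + s ≤ 4 * k → 2 * s + (length (x ∷ xs) + l) < 2 + k
        two-arms {T = T} {l = l} {x = x} {xs} c b∈ TA a∈ a≢b p LT RA LU enough with avoid Zs (T ∪ U ∪ listSet (x ∷ xs)) disjoint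
        ... | Zs′ , sb , ds , dA , len = subst (λ z → 2 * z + (length (x ∷ xs) + l) < 2 + k) ∣A∣ (two-ends noLong AU LU Zs′ c b∈ TA a∈ (inj₁ a≢b) (rpath-tight p) LT
              (λ h → RA (rpath∈ p (∈-listSet⁻ (x ∷ xs) h))) (All.tabulate (λ h → All.lookup zones (sb h))) ds
              (All.tabulate (λ h t → All.lookup dA h (x∈p∪q⁺ (inj₁ t))))
              (All.tabulate (λ h t → All.lookup dA h (x∈p∪q⁺ (inj₂ (x∈p∪q⁺ (inj₁ t))))))
              (All.tabulate (λ h t → All.lookup dA h (x∈p∪q⁺ (inj₂ (x∈p∪q⁺ (inj₂ t)))))) (subst (_≤ suc (length Zs′)) (sym ∣A∣) (m≤n⇒m≤1+n s≤Zs′)))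
          where
          t = ∣ T ∣
          u = ∣ U ∣
          w = length (x ∷ xs)
          s≤Zs′ : s ≤ length Zs′
          s≤Zs′ = +-cancelʳ-≤ (t + u + w) s (length Zs′) (begin
            s + (t + u + w) ≡⟨ +-comm s _ ⟩
            t + u + w + s ≤⟨ enough ⟩
            4 * k ≤⟨ many ⟩
            length Zs ≤⟨ len ⟩
            length Zs′ + ∣ T ∪ U ∪ listSet (x ∷ xs) ∣ ≤⟨ +-monoʳ-≤ (length Zs′) (≤-trans (∣∪∣≤ T _) (+-monoʳ-≤ t (≤-trans (∣∪∣≤ U _) (+-monoʳ-≤ u (∣listSet∣≤ (x ∷ xs)))))) ⟩
            length Zs′ + (t + (u + w)) ≡⟨ cong (length Zs′ +_) (sym (+-assoc t u w)) ⟩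
            length Zs′ + (t + u + w) ∎)
            where open ≤-Reasoning

        -- From `b` the path passes through the other `s - 1` hubs, with two vertices for each, and
        -- ends with one more zone vertex: `l + 2 * s - 1` vertices, which is less than `k`.
        one-arm : ∀ {b T l} → Cur b T l → b ∈ A → (∀ {x} → x ∈ T → x ∈ A → x ≡ b) → ∣ T ∣ + ∣ U ∣ + 1 + s ≤ 4 * k → l + 2 * s ≤ k
        one-arm {b} {T} {l} c b∈ TA enough with avoid Zs (T ∪ U) disjoint | size≥2 2≤∣A∣ b∈
        ... | [] , _ , _ , _ , len | _ = ⊥-elim (<⇒≱ (begin-strict
                ∣ T ∪ U ∣ ≤⟨ ∣∪∣≤ T U ⟩
                ∣ T ∣ + ∣ U ∣ <⟨ ≤-trans (≤-reflexive (+-comm 1 _)) (m≤m+n _ s) ⟩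
                ∣ T ∣ + ∣ U ∣ + 1 + s ≤⟨ enough ⟩
                4 * k ≤⟨ many ⟩
                length Zs ∎) len)
          where open ≤-Reasoning
        ... | Z ∷ Zs′ , sb , _ , (dZ ∷ _) , _ | a , a∈ , a≢b with Zone.touches (All.lookup zones (sb (here refl))) a∈
        ...   | y , y∈ , g = s≤s⁻¹ (s≤s⁻¹ (subst (_< 2 + k) (trans (+-suc (2 * s) l) (cong suc (+-comm (2 * s) l)))
                  (two-arms c b∈ TA a∈ a≢b (start y∈ g) (λ h t → dZ (x∈p∪q⁺ (inj₁ t)) (in-Z h)) (Zone.off (All.lookup zones (sb (here refl))))
                    (λ h t → dZ (x∈p∪q⁺ (inj₂ t)) (in-Z h)) enough)))
          where
          in-Z : ∀ {z} → z ∈ listSet (y ∷ []) → z ∈ Z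
          in-Z h with ∈-listSet⁻ (y ∷ []) h
          ... | here refl = y∈

      represented : List (Fin m) → List (Fin n)
      represented [] = []
      represented (e ∷ es) with μ e
      ... | just (a , b) = a ∷ b ∷ represented es
      ... | nothing = represented es

      represented-length : ∀ es → length (represented es) ≤ 2 * length es
      represented-length [] = z≤n
      represented-length (e ∷ es) with μ e
      ... | just _ = ≤-trans (s≤s (s≤s (represented-length es))) (≤-reflexive (sym (*-suc 2 (length es))))
      ... | nothing = ≤-trans (represented-length es) (*-monoʳ-≤ 2 (n≤1+n (length es)))

      ∈-represented : ∀ {es e x y} → e ∈ₗ es → Rep μ e x y → x ∈ₗ represented es
      ∈-represented {e ∷ es} (here refl) r with μ e
      ∈-represented (here refl) (inj₁ refl) | just _ = here refl
      ∈-represented (here refl) (inj₂ refl) | just _ = there (here refl)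
      ∈-represented (here refl) (inj₁ ()) | nothing
      ∈-represented (here refl) (inj₂ ()) | nothing
      ∈-represented {f ∷ es} (there e∈) r with μ f
      ... | just _ = there (there (∈-represented e∈ r))
      ... | nothing = ∈-represented e∈ r

      length-arm : ∀ {a es vs} → BPath a es vs → a ∈ A → (∀ {x} → x ∈ₗ vs → x ∉ A) → suc (length vs) + 2 * s ≤ k
      length-arm {a} {es} {vs} p a∈ off = one-arm U AU
          (Grow.cur p ≤-refl (λ h → ∈-listSet⁺ (a ∷ vs) h) reps′) a∈ (λ t x∈A → case ∈-listSet⁻ (a ∷ vs) t of λ { (here e) → e ; (there h) → ⊥-elim (off h x∈A) }) enough
        where
        U? : ∀ x → Dec (x ∉ A × x ∈ₗ represented es)
        U? x = ¬? (x ∈? A) ×-dec Any.any? (x ≟ᶠ_) (represented es)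
        U = sub U?
        AU : Disjointˢ A U
        AU x∈ x∈U = proj₁ (∈-sub⁻ U? x∈U) x∈
        reps′ : ∀ {e x y} → e ∈ₗ es → Rep μ e x y → x ∈ listSet (a ∷ vs) ⊎ (x ∈ U ⊎ y ∈ U)
        reps′ {e} {x} {y} e∈ r with x ∈? A
        ... | no x∉ = inj₂ (inj₁ (∈-sub⁺ U? (x∉ , ∈-represented e∈ r)))
        ... | yes x∈ = inj₂ (inj₂ (∈-sub⁺ U? (rep-hub r x∈ , ∈-represented e∈ (rep-sym {μ} {e} {x} {y} r))))
        T≤ : ∣ listSet (a ∷ vs) ∣ ≤ k
        T≤ = ≤-trans (∣listSet∣≤ (a ∷ vs)) (<⇒≤ (noLong p))
        U≤ : ∣ U ∣ + 2 ≤ 2 * k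
        U≤ = begin
          ∣ U ∣ + 2 ≤⟨ +-monoˡ-≤ 2 (∣∣≤length U (represented es) (λ h → proj₂ (∈-sub⁻ U? h))) ⟩
          length (represented es) + 2 ≤⟨ +-monoˡ-≤ 2 (represented-length es) ⟩
          2 * length es + 2 ≡⟨ cong (λ z → 2 * z + 2) (walk-lengths (walk p)) ⟩
          2 * length vs + 2 ≡⟨ trans (+-comm _ 2) (sym (*-suc 2 (length vs))) ⟩
          2 * suc (length vs) ≤⟨ *-monoʳ-≤ 2 (<⇒≤ (noLong p)) ⟩
          2 * k ∎
          where open ≤-Reasoning
        enough : ∣ listSet (a ∷ vs) ∣ + ∣ U ∣ + 1 + s ≤ 4 * k
        enough = begin
          ∣ listSet (a ∷ vs) ∣ + ∣ U ∣ + 1 + s ≤⟨ +-mono-≤ (≤-trans (≤-reflexive (+-assoc _ ∣ U ∣ 1)) (+-mono-≤ T≤ (≤-trans (+-monoʳ-≤ ∣ U ∣ (n≤1+n 1)) U≤))) s≤k ⟩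
          k + 2 * k + k ≡⟨ four k ⟩
          4 * k ∎
          where
          open ≤-Reasoning
          four : ∀ k → k + 2 * k + k ≡ 4 * k
          four = solve-∀

      open Grow V A ∅ valid using (Cur; outward)

      A∅ : Disjointˢ A ∅
      A∅ _ h = ∉⊥ h

      few : ∀ {l} (T : Subset n) → l ≤ 6 → ∣ T ∣ + l ≤ 8 → ∣ T ∣ + ∣ ∅ {n} ∣ + l + s ≤ 4 * k
      few {l} T _ h = begin
        ∣ T ∣ + ∣ ∅ {n} ∣ + l + s ≡⟨ cong (λ z → ∣ T ∣ + z + l + s) (∣⊥∣≡0 n) ⟩
        ∣ T ∣ + 0 + l + s ≡⟨ cong (λ z → z + l + s) (+-identityʳ ∣ T ∣) ⟩
        ∣ T ∣ + l + s ≤⟨ +-mono-≤ (≤-trans h 8≤k) s≤k ⟩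
        k + k ≤⟨ +-monoʳ-≤ k (m≤m+n k (2 * k)) ⟩
        k + (k + 2 * k) ≡⟨ four k ⟩
        4 * k ∎
        where
        open ≤-Reasoning
        four : ∀ k → k + (k + 2 * k) ≡ 4 * k
        four = solve-∀

      ∉A : ∀ {K} → Component (V ─ A) K → Disjointˢ K A
      ∉A c x∈ = proj₂ (∈-─⁻ V A (Component.within c x∈))

      tight-arm : ∀ {K b x xs} → Component (V ─ A) K → b ∈ A → RPath K (Gr μ b) (x ∷ xs) →
        Cur b (listSet (x ∷ xs) ∪ ⁅ b ⁆) (suc (length (x ∷ xs))) × (∀ {y} → y ∈ listSet (x ∷ xs) ∪ ⁅ b ⁆ → y ∈ A → y ≡ b) ×
        ∣ listSet (x ∷ xs) ∪ ⁅ b ⁆ ∣ ≤ suc (length (x ∷ xs))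
      tight-arm {K} {b} {x} {xs} c b∈ p = outward (rpath-tight p) (λ h → ∉A c (inK h) b∈) (A∅ b∈) (λ _ h → ∉⊥ h) , only ,
          ≤-trans (∣∪∣≤ (listSet (x ∷ xs)) ⁅ b ⁆) (subst (∣ listSet (x ∷ xs) ∣ + ∣ ⁅ b ⁆ ∣ ≤_) (+-comm (length (x ∷ xs)) 1) (+-mono-≤ (∣listSet∣≤ (x ∷ xs)) (≤-reflexive (∣⁅x⁆∣≡1 b))))
        where
        inK : ∀ {y} → y ∈ listSet (x ∷ xs) → y ∈ K
        inK h = rpath∈ p (∈-listSet⁻ (x ∷ xs) h)
        only : ∀ {y} → y ∈ listSet (x ∷ xs) ∪ ⁅ b ⁆ → y ∈ A → y ≡ b
        only h y∈A with x∈p∪q⁻ (listSet (x ∷ xs)) ⁅ b ⁆ h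
        ... | inj₁ q = ⊥-elim (∉A c (inK q) y∈A)
        ... | inj₂ q = x∈⁅y⁆⇒x≡y b q

      arm-length : ∀ {K b x xs} → Component (V ─ A) K → b ∈ A → RPath K (Gr μ b) (x ∷ xs) → length (x ∷ xs) ≤ 3 → suc (length (x ∷ xs)) + 2 * s ≤ k
      arm-length {K} {b} {x} {xs} c b∈ p l≤ with tight-arm c b∈ p
      ... | q , only , sz = one-arm ∅ A∅ q b∈ only (few (listSet (x ∷ xs) ∪ ⁅ b ⁆) (s≤s z≤n) (≤-trans (+-monoˡ-≤ 1 (≤-trans sz (s≤s l≤))) (m≤m+n 5 3)))

      -- Three vertices and the hub would form an arm of 4 vertices, and `4 + 2 * s` exceeds `k`.
      rpath-≤2 : ∀ {K b xs} → Component (V ─ A) K → b ∈ A → RPath K (Gr μ b) xs → length xs ≤ 2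
      rpath-≤2 {xs = xs} c b∈ p with length xs ≤? 2
      ... | yes h = h
      ... | no ¬h with rpath-take 3 (s≤s z≤n) (≰⇒> ¬h) p
      ...   | x ∷ ys , q , eq = ⊥-elim (<⇒≱ (s≤s (subst (λ z → z + 2 * s ≤ k) (cong suc eq) (arm-length c b∈ q (≤-reflexive eq)))) (s≤s k≤))

      Bad : Subset n → Set
      Bad K = Component (V ─ A) K × (s C ρ) * ∣ K ∣ + 1 ≤ massOf K

      N∅⊆A : ∀ {x} → N closed cover x ∅ ⊆ A
      N∅⊆A {x} h with ∈-sub⁻ (nbr? closed cover ∅ x) h
      ... | inj₁ y∈ , _ = ⊥-elim (∉⊥ y∈)
      ... | inj₂ y∈ , _ = y∈

      -- If `K` had no neighbour in `A`, `hubless-path` would give an arm of `s + 1` vertices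
      -- besides its hub, whereas `length-arm` allows only 2.
      bad-overfull : ∀ {K} → Bad K → ∃ λ b → b ∈ A × Overfull closed cover s (Gr μ b) K
      bad-overfull {K} (c , big) with any? (λ x → (x ∈? K) ×-dec any? (λ b → (b ∈? A) ×-dec gr? μ b x))
      ... | yes (x , x∈ , b , b∈ , g) with degenerate closed cover s 0 {Root = Gr μ b} ρ<s (x , x∈)
                 (λ y∈ → reach-trans (root x∈ g) (Component.connected c x∈ y∈))
                 (λ _ → ≤-trans (≤-reflexive (+-identityʳ _)) (≤-trans (p⊆q⇒∣p∣≤∣q∣ N∅⊆A) (≤-reflexive ∣A∣)))
      ...   | inj₁ o = b , b∈ , o
      ...   | inj₂ h = ⊥-elim (<⇒≱ (subst (_≤ massOf K) (+-comm ((s C ρ) * ∣ K ∣) 1) big) (subst (_≤ (s C ρ) * ∣ K ∣) (+-identityʳ (massOf K)) h))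
      bad-overfull {K} (c , big) | no none with piece-of c
      ...   | X , pc , K⊆X with attached-exists A⊆V cV pc A-nonempty
      ...     | a , a∈ , att with Hubless.hubless-path V A valid closed cover pc (λ a∈X → proj₂ (∈-─⁻ V A (GH.Component.within pc a∈X)) a∈) K⊆X ρ<s att c
                   (λ x∈ b∈ g → none (_ , x∈ , _ , b∈ , gr-sym {μ} g)) (≤-trans (m≤m+n _ 1) big)
      ...       | es , vs , p , len , inX , _ = ⊥-elim (<⇒≱ (begin-strict
                  3 + 2 * s <⟨ +-monoˡ-≤ (2 * s) (s≤s 3≤s) ⟩
                  suc s + 2 * s ≤⟨ +-monoˡ-≤ (2 * s) (m≤n⇒m≤1+n len) ⟩
                  suc (length vs) + 2 * s ≤⟨ length-arm p a∈ (λ h → proj₂ (∈-─⁻ V A (GH.Component.within pc (inX h)))) ⟩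
                  k ∎) k≤)
        where open ≤-Reasoning

      N≤ : ∀ {R x xs Root} → RPath R Root (x ∷ xs) → (∀ {z} → z ∈ R → Gr μ x z → z ∈ₗ x ∷ xs) →
        ∣ N closed cover x R ∣ ≤ length xs + ∣ N closed cover x ∅ ∣
      N≤ {R} {x} {xs} p mx = ≤-trans (p⊆q⇒∣p∣≤∣q∣ into) (≤-trans (∣∪∣≤ (listSet xs) _) (+-monoˡ-≤ _ (∣listSet∣≤ xs)))
        where
        into : N closed cover x R ⊆ listSet xs ∪ N closed cover x ∅
        into h with ∈-sub⁻ (nbr? closed cover R x) h
        ... | inj₂ z∈A , g = x∈p∪q⁺ (inj₂ (∈-sub⁺ (nbr? closed cover ∅ x) (inj₂ z∈A , g)))
        ... | inj₁ z∈R , g with mx z∈R g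
        ...   | here refl = ⊥-elim (gr-irrefl g)
        ...   | there q = x∈p∪q⁺ (inj₁ (∈-listSet⁺ xs q))

      ⊆-full : ∀ {p q : Subset n} → p ⊆ q → ∣ q ∣ ≤ ∣ p ∣ → q ⊆ p
      ⊆-full {p} {q} h le {x} x∈ with x ∈? p
      ... | yes r = r
      ... | no ¬r = ⊥-elim (<⇒≱ (p⊂q⇒∣p∣<∣q∣ (h , x , x∈ , ¬r)) le)

      record FullPair (K : Subset n) : Set where
        field
          {x x₁} : Fin n
          {b}    : Fin n
          x∈     : x ∈ K
          x₁∈    : x₁ ∈ K
          b∈     : b ∈ A
          joined : Gr μ x x₁
          first  : Gr μ b x₁
          hubs   : ∀ {a} → a ∈ A → Gr μ x a

      -- The end `x` has more than `s` neighbours, at most one of them on the path and the others in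
      -- `A`. So the path has two vertices and `x` sees all of `A`.
      bad⇒pair : ∀ {K} → Bad K → FullPair K
      bad⇒pair {K} bk with bad-overfull bk
      ... | b , b∈ , R , x , xs , R⊆ , p , mx , deg with rpath-≤2 (proj₁ bk) b∈ (rpath-⊆ R⊆ p) | p
      ...   | _ | start _ _ = ⊥-elim (<⇒≱ deg (≤-trans (N≤ p mx) (≤-trans (p⊆q⇒∣p∣≤∣q∣ N∅⊆A) (≤-reflexive ∣A∣))))
      ...   | s≤s (s≤s ()) | grow (grow _ _ _ _) _ _ _
      ...   | _ | grow (start x₁∈ g) e x∈ x∉ = record { x∈ = R⊆ x∈ ; x₁∈ = R⊆ x₁∈ ; b∈ = b∈ ; joined = gr-sym {μ} e ; first = g
                ; hubs = λ a∈ → proj₂ (∈-sub⁻ (nbr? closed cover ∅ x) (⊆-full N∅⊆A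
                    (≤-trans (≤-reflexive ∣A∣) (s≤s⁻¹ (≤-trans deg (N≤ p mx)))) a∈)) }

      gr-∉ : ∀ {x y} → Gr μ x y → x ∉ₗ y ∷ []
      gr-∉ g (here refl) = gr-irrefl g

      bad⇒odd : ∀ {K} → Bad K → k ≡ 3 + 2 * s
      bad⇒odd bk = ≤-antisym k≤ (arm-length (proj₁ bk) b∈ (grow (start x₁∈ first) (gr-sym {μ} joined) x∈ (gr-∉ joined)) (s≤s (s≤s z≤n)))
        where open FullPair (bad⇒pair bk)

      -- Each pair serves as an arm of two vertices. Since `x` in `K` sees every hub, its arm can
      -- start at a hub other than the one used by `L`, and the path gets `2 * s + 3` vertices.
      pairs-meet : ∀ {K L} → Component (V ─ A) K → Component (V ─ A) L → FullPair K → FullPair L → k ≡ 3 + 2 * s → Disjointˢ K L → ⊥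
      pairs-meet {K} {L} cK cL fk fl odd disj = <⇒≱ bound (≤-reflexive eq)
        where
        module F = FullPair fk
        module G = FullPair fl
        other = size≥2 2≤∣A∣ G.b∈
        a = proj₁ other
        a∈ = proj₁ (proj₂ other)
        arm = tight-arm cK a∈ (grow (start F.x∈ (gr-sym {μ} (F.hubs a∈))) F.joined F.x₁∈ (gr-∉ (gr-sym {μ} F.joined)))
        pathL : RPath L (Gr μ G.b) (G.x ∷ G.x₁ ∷ [])
        pathL = grow (start G.x₁∈ G.first) (gr-sym {μ} G.joined) G.x∈ (gr-∉ G.joined)
        inL : ∀ {y} → y ∈ listSet (G.x ∷ G.x₁ ∷ []) → y ∈ L
        inL h = rpath∈ pathL (∈-listSet⁻ (G.x ∷ G.x₁ ∷ []) h)
        inK : ∀ {y} → y ∈ listSet (F.x₁ ∷ F.x ∷ []) → y ∈ K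
        inK h with ∈-listSet⁻ (F.x₁ ∷ F.x ∷ []) h
        ... | here e = subst (_∈ K) (sym e) F.x₁∈
        ... | there (here e) = subst (_∈ K) (sym e) F.x∈
        bound : 2 * s + (2 + 3) < 2 + k
        bound = two-arms ∅ A∅ (proj₁ arm) a∈ (proj₁ (proj₂ arm)) G.b∈ (proj₂ (proj₂ other) ∘ sym) pathL
          (λ h t → case x∈p∪q⁻ (listSet (F.x₁ ∷ F.x ∷ [])) ⁅ a ⁆ t of λ
            { (inj₁ q) → disj (inK q) (inL h) ; (inj₂ q) → ∉A cL (inL h) (subst (_∈ A) (sym (x∈⁅y⁆⇒x≡y a q)) a∈) })
          (∉A cL) (λ _ h → ∉⊥ h) (few (listSet (F.x₁ ∷ F.x ∷ []) ∪ ⁅ a ⁆) (s≤s (s≤s z≤n)) (≤-trans (+-monoˡ-≤ 2 (proj₂ (proj₂ arm))) (m≤m+n 5 3)))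
        eq : 2 + k ≡ 2 * s + (2 + 3)
        eq = trans (cong (2 +_) odd) (+-comm 5 (2 * s))

      -- `K` has only the two vertices, because a third would create a path excluded by `rpath-≤2`.
      -- Deleting `x` at degree `s + 1` and then `x₁` at degree `s` gives the count by Pascal's
      -- rule.
      pair-mass : ∀ {K} → Component (V ─ A) K → FullPair K → massOf K ≤ (s C ρ) * ∣ K ∣ + s C pred ρ
      pair-mass {K} cK fp = begin
        massOf K ≤⟨ mass-delete closed cover K x ⟩
        massOf K₁ + ∣ sub (at? closed cover K x) ∣ ≤⟨ +-mono-≤ (mass-delete closed cover K₁ x₁) (≤-trans (m≤m+n _ 0) (at-bound closed cover 0 N-x (m≤n⇒m≤1+n ρ<s))) ⟩
        massOf (K₁ ─ ⁅ x₁ ⁆) + ∣ sub (at? closed cover K₁ x₁) ∣ + suc s C ρ ≤⟨ +-monoˡ-≤ (suc s C ρ) (+-mono-≤ (≤-reflexive mass0) (≤-trans (m≤m+n _ 0) (at-bound closed cover 0 N-x₁ ρ<s))) ⟩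
        s C ρ + suc s C ρ ≡⟨ cong (s C ρ +_) (pascal ρ 2≤ρ) ⟩
        s C ρ + (s C pred ρ + s C ρ) ≡⟨ arrange (s C ρ) (s C pred ρ) ⟩
        (s C ρ) * 2 + s C pred ρ ≤⟨ +-monoˡ-≤ (s C pred ρ) (*-monoʳ-≤ (s C ρ) 2≤∣K∣) ⟩
        (s C ρ) * ∣ K ∣ + s C pred ρ ∎
        where
        open ≤-Reasoning hiding (start)
        open FullPair fp
        K₁ = K ─ ⁅ x ⁆
        pascal : ∀ ρ → 2 ≤ ρ → suc s C ρ ≡ s C pred ρ + s C ρ
        pascal (suc r) _ = C-pascal s r
        arrange : ∀ a b → a + (b + a) ≡ a * 2 + b
        arrange = solve-∀
        x₁≢x : x₁ ≢ x
        x₁≢x e = gr-irrefl (subst (Gr μ x) e joined)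
        x₁∈K₁ : x₁ ∈ K₁
        x₁∈K₁ = ∈-─⁺ x₁∈ (λ h → x₁≢x (x∈⁅y⁆⇒x≡y x h))
        2≤∣K∣ : 2 ≤ ∣ K ∣
        2≤∣K∣ = subst (2 ≤_) (∣─⁅⁆∣ x∈) (s≤s (Nonempty⇒1≤ (x₁ , x₁∈K₁)))
        2<3 : ¬ (3 ≤ 2)
        2<3 (s≤s (s≤s ()))
        K⊆ : ∀ {z} → Reach K (x ≡_) z → z ≡ x ⊎ z ≡ x₁
        K⊆ (root _ refl) = inj₁ refl
        K⊆ {z} (step {y} r e z∈) with z ≟ᶠ x | z ≟ᶠ x₁
        ... | yes p | _ = inj₁ p
        ... | no _ | yes q = inj₂ q
        ... | no z≢x | no z≢x₁ with K⊆ r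
        ...   | inj₁ refl = ⊥-elim (2<3 (rpath-≤2 cK b∈ (grow (grow (start x₁∈ first) (gr-sym {μ} joined) x∈ (gr-∉ joined)) e z∈
                  (λ { (here p) → z≢x p ; (there (here p)) → z≢x₁ p }))))
        ...   | inj₂ refl = ⊥-elim (2<3 (rpath-≤2 cK b∈ (grow (grow (start x∈ (gr-sym {μ} (hubs b∈))) joined x₁∈ (gr-∉ (gr-sym {μ} joined))) e z∈
                  (λ { (here p) → z≢x₁ p ; (there (here p)) → z≢x p }))))
        both : ∀ {z} → z ∈ K → z ≡ x ⊎ z ≡ x₁
        both z∈ = K⊆ (Component.connected cK x∈ z∈)
        mass0 : massOf (K₁ ─ ⁅ x₁ ⁆) ≡ 0
        mass0 with massOf (K₁ ─ ⁅ x₁ ⁆) in eq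
        ... | zero = refl
        ... | suc _ with mass-positive closed cover (K₁ ─ ⁅ x₁ ⁆) (subst (1 ≤_) (sym eq) (s≤s z≤n))
        ...   | z , z∈ with ∈-─⁻ K₁ ⁅ x₁ ⁆ z∈
        ...     | z∈K₁ , z∉x₁ with ∈-─⁻ K ⁅ x ⁆ z∈K₁
        ...       | z∈K , z∉x with both z∈K
        ...         | inj₁ refl = ⊥-elim (z∉x (x∈⁅x⁆ x))
        ...         | inj₂ refl = ⊥-elim (z∉x₁ (x∈⁅x⁆ x₁))
        N-x : ∣ N closed cover x K ∣ + 0 ≤ suc s
        N-x = ≤-trans (≤-reflexive (+-identityʳ _)) (≤-trans (p⊆q⇒∣p∣≤∣q∣ into) (≤-trans (∣∪∣≤ ⁅ x₁ ⁆ A) (≤-reflexive (cong₂ _+_ (∣⁅x⁆∣≡1 x₁) ∣A∣))))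
          where
          into : N closed cover x K ⊆ ⁅ x₁ ⁆ ∪ A
          into h with ∈-sub⁻ (nbr? closed cover K x) h
          ... | inj₂ z∈ , _ = x∈p∪q⁺ (inj₂ z∈)
          ... | inj₁ z∈ , g with both z∈
          ...   | inj₁ refl = ⊥-elim (gr-irrefl g)
          ...   | inj₂ refl = x∈p∪q⁺ (inj₁ (x∈⁅x⁆ x₁))
        N-x₁ : ∣ N closed cover x₁ K₁ ∣ + 0 ≤ s
        N-x₁ = ≤-trans (≤-reflexive (+-identityʳ _)) (≤-trans (p⊆q⇒∣p∣≤∣q∣ into) (≤-reflexive ∣A∣))
          where
          into : N closed cover x₁ K₁ ⊆ A
          into h with ∈-sub⁻ (nbr? closed cover K₁ x₁) h
          ... | inj₂ z∈ , _ = z∈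
          ... | inj₁ z∈ , g with ∈-─⁻ K ⁅ x ⁆ z∈
          ...   | z∈K , z∉x with both z∈K
          ...     | inj₁ refl = ⊥-elim (z∉x (x∈⁅x⁆ x))
          ...     | inj₂ refl = ⊥-elim (gr-irrefl g)

      W = V ─ A

      find-bad : ∀ {R} → R ⊆ W → ClosedIn W R → ¬ (massOf R ≤ (s C ρ) * ∣ R ∣) → ∃ λ K → Bad K × K ⊆ R
      find-bad {R} R⊆ cl big with find-component (s C ρ) 1 ≤-refl _ ≤-refl R⊆ cl
                (mass-positive closed cover R (≤-trans (s≤s z≤n) (≰⇒> big))) (≤-trans (≤-reflexive (+-comm _ 1)) (≰⇒> big))
      ... | K , c , K⊆ , h = K , (c , h) , K⊆

      -- An excess in `W` produces a bad component, and an excess in the rest would produce a second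
      -- one. So the whole excess is that of a single pair.
      outside-mass : massOf W ≤ (s C ρ) * ∣ W ∣ + extra
      outside-mass with massOf W ≤? (s C ρ) * ∣ W ∣
      ... | yes h = ≤-trans h (m≤m+n _ extra)
      ... | no ¬h with find-bad id (λ _ z∈ _ → z∈) ¬h
      ...   | K , bk , K⊆ with massOf (W ─ K) ≤? (s C ρ) * ∣ W ─ K ∣
      ...     | no ¬h′ with find-bad (λ h → proj₁ (∈-─⁻ W K h))
                  (λ y∈ z∈ g → ∈-─⁺ z∈ (λ z∈K → proj₂ (∈-─⁻ W K y∈) (Component.closed (proj₁ bk) z∈K (proj₁ (∈-─⁻ W K y∈)) (gr-sym {μ} g)))) ¬h′
      ...       | L , bl , L⊆ = ⊥-elim (pairs-meet (proj₁ bk) (proj₁ bl) (bad⇒pair bk) (bad⇒pair bl) (bad⇒odd bk) (λ x∈K x∈L → proj₂ (∈-─⁻ W K (L⊆ x∈L)) x∈K))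
      outside-mass | no ¬h | K , bk , K⊆ | yes h = begin
        massOf W ≤⟨ mass-split closed cover id (Component.closed (proj₁ bk)) ⟩
        massOf K + massOf (W ─ K) ≤⟨ +-mono-≤ (pair-mass (proj₁ bk) (bad⇒pair bk)) h ⟩
        (s C ρ) * ∣ K ∣ + s C pred ρ + (s C ρ) * ∣ W ─ K ∣ ≡⟨ arrange (s C ρ) (∣ K ∣) (s C pred ρ) (∣ W ─ K ∣) ⟩
        (s C ρ) * (∣ W ─ K ∣ + ∣ K ∣) + s C pred ρ ≡⟨ cong₂ (λ a b → (s C ρ) * a + b) (∣─∣ K⊆) (sym (extra-odd (bad⇒odd bk))) ⟩
        (s C ρ) * ∣ W ∣ + extra ∎
        where
        open ≤-Reasoning
        arrange : ∀ c a e b → c * a + e + c * b ≡ c * (b + a) + e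
        arrange = solve-∀

      core-bound : ∣ edgesIn V ∣ + (s C ρ) * s ≤ (s C ρ) * ∣ V ∣ + (s C suc ρ + extra)
      core-bound = begin
        ∣ edgesIn V ∣ + (s C ρ) * s ≤⟨ +-monoˡ-≤ _ (≤-trans (p⊆q⇒∣p∣≤∣q∣ into) (∣∪∣≤ (edgesIn A) (sub (inner? closed cover W)))) ⟩
        ∣ edgesIn A ∣ + massOf W + (s C ρ) * s ≤⟨ +-monoˡ-≤ _ (+-mono-≤ within-A outside-mass) ⟩
        s C suc ρ + ((s C ρ) * ∣ W ∣ + extra) + (s C ρ) * s ≡⟨ arrange (s C suc ρ) (s C ρ) (∣ W ∣) extra s ⟩
        (s C ρ) * (∣ W ∣ + s) + (s C suc ρ + extra) ≡⟨ cong (λ z → (s C ρ) * z + (s C suc ρ + extra)) (trans (cong (∣ W ∣ +_) (sym ∣A∣)) (∣─∣ A⊆V)) ⟩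
        (s C ρ) * ∣ V ∣ + (s C suc ρ + extra) ∎
        where
        open ≤-Reasoning
        arrange : ∀ a c w e t → a + (c * w + e) + c * t ≡ c * (w + t) + (a + e)
        arrange = solve-∀
        into : edgesIn V ⊆ edgesIn A ∪ sub (inner? closed cover W)
        into {e} h with E e ⊆? A
        ... | yes q = x∈p∪q⁺ (inj₁ (∈-sub⁺ (λ e → E e ⊆? A) q))
        ... | no ¬q = x∈p∪q⁺ (inj₂ (∈-sub⁺ (inner? closed cover W) ((∈-sub⁻ (λ e → E e ⊆? V) h , ¬q) ,
                λ x∈ → ∈-─⁺ (∈-sub⁻ (λ e → E e ⊆? V) h (outsideOf-∈ closed cover {e} x∈)) (outsideOf-∉S closed cover {e} x∈))))
        within-A : ∣ edgesIn A ∣ ≤ s C suc ρ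
        within-A = subst (λ z → ∣ edgesIn A ∣ ≤ z C suc ρ) ∣A∣ (family-bound (edgesIn A) E A (suc ρ) (λ {e} h → ∈-sub⁻ (λ e → E e ⊆? A) h , uniform e) (λ _ _ → E-injective))

    -- The core contributes `s C suc ρ` and each other vertex `s C ρ`; the term for the `s` core
    -- vertices stands on the left to avoid subtraction.
    Bounded : Subset n → Set
    Bounded V = ∣ edgesIn V ∣ + (s C ρ) * s ≤ (s C ρ) * ∣ V ∣ + (s C suc ρ + extra)

    -- Rerun the matching with the hub set A, keeping all pairs matched so far.
    core⇒bounded : ∀ {V A S} → A ⊆ V → ∣ A ∣ ≡ s → GH.Conn V V → ∀ {μ} → Mt.Valid V S μ → A ⊆ S →
      ∀ {Zs} → All (Zone μ A) Zs → AllPairs Disjointˢ Zs → 4 * k ≤ length Zs → Bounded V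
    core⇒bounded {V} {A} {S} A⊆V ∣A∣ cV {μ₀} valid A⊆S {Zs} zones disj many =
        Core.core-bound V A A⊆V ∣A∣ cV (Mt.Deficient.valid D) (Mt.Deficient.closed D) (Mt.Deficient.cover D) Zs (All.map up zones) disj many
      where
      valid′ : Mt.Valid V A μ₀
      valid′ = record
        { admissible = λ {e} {p} eq → case ∈-pairs⁻ {V} {S} (Mt.admissible {V} {S} valid eq) of λ
            { (a , b , c , d , h) → ∈-pairs⁺ {V} {A} {e} {p} (a , b , c , d , λ { (x , y) → h (A⊆S x , A⊆S y) }) }
        ; injective = Mt.injective {V} {S} valid }
      D = Mt.maximum-matching V A valid′
      μ = Mt.Deficient.μ D
      gr-up : ∀ {x y} → Gr μ₀ x y → Gr μ x y
      gr-up (_ , inj₁ p) = case Mt.Deficient.extends D p of λ { (f , q) → f , inj₁ q }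
      gr-up (_ , inj₂ p) = case Mt.Deficient.extends D p of λ { (f , q) → f , inj₂ q }
      up : ∀ {Z} → Zone μ₀ A Z → Zone μ A Z
      up z = record { touches = λ a∈ → case Zone.touches z a∈ of λ { (y , y∈ , g) → y , y∈ , gr-up g }
                    ; connected = λ x∈ y∈ → reach-map gr-up (Zone.connected z x∈ y∈) ; off = Zone.off z }

    touch? : ∀ V X e → Dec (E e ⊆ V × (∃ λ x → x ∈ E e × x ∈ X))
    touch? V X e = (E e ⊆? V) ×-dec any? (λ x → (x ∈? E e) ×-dec (x ∈? X))

    touching : Subset n → Subset n → ℕ
    touching V X = ∣ sub (touch? V X) ∣

    -- Many dense components over a bounded set

    module Dense (V S : Subset n) (S⊆V : S ⊆ V) (cV : GH.Conn V V) (b : Fin n) (b∈S : b ∈ S)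
                 {μ : Fin m → Maybe (Fin n × Fin n)} (valid : Mt.Valid V S μ) {blue : Subset m}
                 (closed : Mt.Closed V S μ blue) (cover : ∀ e → e ∈ blue ⊎ Mt.Matched V S μ e) where

      open Colouring V S valid
      open Graph (Gr μ)
      open Mass V S valid closed cover

      record Dense : Set where
        field
          {X K}     : Subset n
          piece     : Piece V S X
          attached  : Attached V X b
          isComp    : Component (V ─ S) K
          K⊆X       : K ⊆ X
          dense     : (s C ρ) * ∣ K ∣ ≤ massOf K
      open Dense

      touching≤mass : ∀ {X} → Piece V S X → touching V X ≤ massOf X
      touching≤mass {X} pc = p⊆q⇒∣p∣≤∣q∣ λ {e} h → case ∈-sub⁻ (touch? V X) h of λ { (e⊆ , x , x∈ , x∈X) → ∈-sub⁺ (inner? closed cover X)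
        ((e⊆ , λ ⊆S → proj₂ (∈-─⁻ V S (GH.Component.within pc x∈X)) (⊆S x∈)) ,
         λ y∈ → piece-closed pc e⊆ x∈ x∈X (outsideOf-∈ closed cover {e} y∈) (outsideOf-∉S closed cover {e} y∈)) }

      dense-component : ∀ {X} → Piece V S X → Attached V X b → (s C ρ) * ∣ X ∣ ≤ touching V X → Σ Dense λ d → X ≡ Dense.X d
      dense-component {X} pc att big with find-component (s C ρ) 0 z≤n _ ≤-refl (GH.Component.within pc)
           (λ y∈ z∈ g → GH.Component.closed pc y∈ z∈ (gr⇒adj g)) (GH.Component.inhabited pc)
           (≤-trans (≤-reflexive (+-identityʳ ((s C ρ) * ∣ X ∣))) (≤-trans big (touching≤mass pc)))
      ... | K , c , K⊆ , h = record { piece = pc ; attached = att ; isComp = c ; K⊆X = K⊆ ; dense = subst (_≤ massOf K) (+-identityʳ _) h } , refl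

      hub? : ∀ K a → Dec (a ∈ S × ∃ λ x → x ∈ K × Gr μ a x)
      hub? K a = (a ∈? S) ×-dec any? (λ x → (x ∈? K) ×-dec gr? μ a x)

      hubs : Dense → Subset n
      hubs d = sub (hub? (K d))

      Apart : Dense → Dense → Set
      Apart d d′ = Disjointˢ (X d) (X d′)

      K-apart : ∀ {d d′} → Apart d d′ → Disjointˢ (K d) (K d′)
      K-apart {d} {d′} h x∈ x∈′ = h (K⊆X d x∈) (K⊆X d′ x∈′)

      Ks-disjoint : ∀ {ds} → AllPairs Apart ds → AllPairs Disjointˢ (map K ds)
      Ks-disjoint [] = []
      Ks-disjoint {d₀ ∷ _} (a ∷ as) = AllP.map⁺ (All.tabulate (λ {d} d∈ x∈ x∈′ → All.lookup a d∈ (K⊆X d₀ x∈) (K⊆X d x∈′))) ∷ Ks-disjoint as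

      -- Each component yields a path from the common vertex `b` with at least `s + 1` further
      -- vertices in its own piece. Joined at `b`, the two have at least `2 * s + 3` vertices.
      no-hubs : ∀ {d d′} → Apart d d′ → ∣ hubs d ∣ ≡ 0 → ∣ hubs d′ ∣ ≡ 0 → ⊥
      no-hubs {d} {d′} ap z z′ = <⇒≱ (noLong (proj₁ (proj₂ (proj₂ join)))) long
        where
        arm : ∀ d → ∣ hubs d ∣ ≡ 0 → ∃[ es ] ∃[ vs ] (BPath b es vs × suc s ≤ length vs × (∀ {x} → x ∈ₗ vs → x ∈ X d) ×
            (∀ {e} → e ∈ₗ es → E e ⊆ V × (∃ λ x → x ∈ E e × x ∈ X d)))
        arm d z = Hubless.hubless-path V S valid closed cover (piece d) (λ h → proj₂ (∈-─⁻ V S (GH.Component.within (piece d) h)) b∈S) (K⊆X d) ρ<s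
          (attached d) (isComp d) (λ {x} {a} x∈ a∈ g → <⇒≱ (Nonempty⇒1≤ (a , ∈-sub⁺ (hub? (K d)) (a∈ , x , x∈ , gr-sym {μ} g))) (≤-reflexive z)) (dense d)
        p = arm d z
        q = arm d′ z′
        join = reverse-join (proj₁ (proj₂ (proj₂ p))) (proj₁ (proj₂ (proj₂ q)))
          (λ x∈ x∈′ → ap (proj₁ (proj₂ (proj₂ (proj₂ (proj₂ p)))) x∈) (proj₁ (proj₂ (proj₂ (proj₂ (proj₂ q)))) x∈′))
          (λ e∈ e∈′ → case proj₂ (proj₂ (proj₂ (proj₂ (proj₂ p)))) e∈ , proj₂ (proj₂ (proj₂ (proj₂ (proj₂ q)))) e∈′ of λ
            { ((e⊆ , x , x∈ , x∈X) , (_ , y , y∈ , y∈X)) → ap (piece-closed (piece d) e⊆ x∈ x∈X y∈ (proj₂ (∈-─⁻ V S (GH.Component.within (piece d′) y∈X)))) y∈X })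
        long : k ≤ suc (length (proj₁ (proj₂ join)))
        long = begin
          k ≤⟨ k≤ ⟩
          3 + 2 * s ≡⟨ twice s ⟩
          suc (suc s + suc s) ≤⟨ s≤s (+-mono-≤ (proj₁ (proj₂ (proj₂ (proj₂ p)))) (proj₁ (proj₂ (proj₂ (proj₂ q))))) ⟩
          suc (length (proj₁ (proj₂ p)) + length (proj₁ (proj₂ q))) ≡⟨ cong suc (sym (proj₁ (proj₂ (proj₂ (proj₂ join))))) ⟩
          suc (length (proj₁ (proj₂ join))) ∎
          where
          open ≤-Reasoning
          twice : ∀ s → 3 + 2 * s ≡ suc (suc s + suc s)
          twice = solve-∀

      module SameHubs (P : Subset n) (P⊆S : P ⊆ S) where

        zone : ∀ {d} → hubs d ≡ P → Zone μ P (K d)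
        zone {d} refl = record { touches = λ a∈ → proj₂ (∈-sub⁻ (hub? (K d)) a∈) ; connected = Component.connected (isComp d)
          ; off = λ x∈ x∈P → proj₂ (∈-─⁻ V S (Component.within (isComp d) x∈)) (P⊆S x∈P) }

        open Grow V S ∅ valid

        two-zones : ∀ {d₁ d₂ ds a b x xs y ys} → hubs d₁ ≡ P → hubs d₂ ≡ P → All (λ d → hubs d ≡ P) ds → AllPairs Apart (d₁ ∷ d₂ ∷ ds) →
          ∣ P ∣ ≤ suc (length ds) → b ∈ P → a ∈ P → a ≢ b ⊎ ∣ P ∣ ≤ 1 → RPath (K d₁) (Gr μ b) (x ∷ xs) → RPath (K d₂) (Gr μ a) (y ∷ ys) →
          2 * ∣ P ∣ + (length (y ∷ ys) + suc (length (x ∷ xs))) < 2 + k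
        two-zones {d₁} {d₂} {ds} {a} {b} h₁ h₂ hs ((ap₁₂ ∷ ap₁) ∷ ap₂ ∷ aps) le b∈ a∈ ne p q =
          two-ends noLong (λ _ h → ∉⊥ h) (λ _ h → ∉⊥ h) (map K ds) (outward p (λ b∈K → off₁ b∈K b∈) (λ h → ∉⊥ h) (λ _ h → ∉⊥ h)) b∈
            (λ t x∈P → case x∈p∪q⁻ (K d₁) ⁅ b ⁆ t of λ { (inj₁ r) → ⊥-elim (off₁ r x∈P) ; (inj₂ r) → x∈⁅y⁆⇒x≡y b r })
            a∈ ne q
            (λ y∈ t → case x∈p∪q⁻ (K d₁) ⁅ b ⁆ t of λ { (inj₁ r) → K-apart {d₁} {d₂} ap₁₂ r y∈ ; (inj₂ r) → off₂ y∈ (subst (_∈ P) (sym (x∈⁅y⁆⇒x≡y b r)) b∈) })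
            off₂
            (AllP.map⁺ (All.map (λ {d} h → zone {d} h) hs))
            (Ks-disjoint aps)
            (AllP.map⁺ (All.tabulate (λ {d} d∈ t x∈K → case x∈p∪q⁻ (K d₁) ⁅ b ⁆ t of λ
              { (inj₁ r) → K-apart {d₁} {d} (All.lookup ap₁ d∈) r x∈K
              ; (inj₂ r) → Zone.off (zone {d} (All.lookup hs d∈)) x∈K (subst (_∈ P) (sym (x∈⁅y⁆⇒x≡y b r)) b∈) })))
            (AllP.map⁺ (All.tabulate (λ _ h _ → ∉⊥ h)))
            (AllP.map⁺ (All.tabulate (λ {d} d∈ x∈ x∈′ → All.lookup ap₂ d∈ (K⊆X d₂ x∈) (K⊆X d x∈′))))
            (subst (λ z → ∣ P ∣ ≤ suc z) (sym (length-map K ds)) le)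
          where
          off₁ = Zone.off (zone {d₁} h₁)
          off₂ = Zone.off (zone {d₂} h₂)

        two-hubs : 1 ≤ ∣ P ∣ → ∃[ a ] ∃[ b ] (a ∈ P × b ∈ P × (a ≢ b ⊎ ∣ P ∣ ≤ 1))
        two-hubs h with 1≤⇒Nonempty P h | ∣ P ∣ ≤? 1
        ... | b , b∈ | yes le = b , b , b∈ , b∈ , inj₂ le
        ... | b , b∈ | no gt with size≥2 (≰⇒> gt) b∈
        ...   | a , a∈ , ne = a , b , a∈ , b∈ , inj₁ ne

        -- With fewer than `s` hubs the slack 1 is available in `degenerate`, so density forces an
        -- end with more than `s` neighbours. At most `∣ P ∣` of them are hubs, and the others lie
        -- on the path.
        long-arm : ∀ {d b} → hubs d ≡ P → b ∈ P → ∣ P ∣ < s → ∃[ x ] ∃[ xs ] (RPath (K d) (Gr μ b) (x ∷ xs) × s < length xs + ∣ P ∣)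
        long-arm {d} {b} refl b∈ p<s with Zone.touches (zone {d} refl) b∈
        ... | x₀ , x₀∈ , g with degenerate closed cover s 1 {Root = Gr μ b} ρ<s (x₀ , x₀∈)
                  (λ y∈ → reach-trans (root x₀∈ g) (Component.connected (isComp d) x₀∈ y∈))
                  (λ {x} x∈ → subst (_≤ s) (+-comm 1 _) (<-≤-trans (s≤s (p⊆q⇒∣p∣≤∣q∣ (N∅⊆ x∈))) p<s))
          where
          N∅⊆ : ∀ {x} → x ∈ K d → N closed cover x ∅ ⊆ P
          N∅⊆ {x} x∈ h with ∈-sub⁻ (nbr? closed cover ∅ x) h
          ... | inj₁ y∈ , _ = ⊥-elim (∉⊥ y∈)
          ... | inj₂ y∈ , gr = ∈-sub⁺ (hub? (K d)) (y∈ , x , x∈ , gr-sym {μ} gr)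
        ...   | inj₂ h = ⊥-elim (<⇒≱ (subst (_≤ (s C ρ) * ∣ K d ∣) (+-comm _ 1) h) (dense d))
        ...   | inj₁ (R , x , xs , R⊆ , p , mx , deg) = x , xs , rpath-⊆ R⊆ p , <-≤-trans deg
                  (≤-trans (p⊆q⇒∣p∣≤∣q∣ into) (≤-trans (∣∪∣≤ (listSet xs) P) (+-monoˡ-≤ ∣ P ∣ (∣listSet∣≤ xs))))
          where
          into : N closed cover x R ⊆ listSet xs ∪ P
          into h with ∈-sub⁻ (nbr? closed cover R x) h
          ... | inj₂ z∈S , gr = x∈p∪q⁺ (inj₂ (∈-sub⁺ (hub? (K d)) (z∈S , x , R⊆ (rpath∈ p (here refl)) , gr-sym {μ} gr)))
          ... | inj₁ z∈R , gr with mx z∈R gr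
          ...   | here refl = ⊥-elim (gr-irrefl gr)
          ...   | there r = x∈p∪q⁺ (inj₁ (∈-listSet⁺ xs r))

        module _ {d₁ d₂ ds} (h₁ : hubs d₁ ≡ P) (h₂ : hubs d₂ ≡ P) (hs : All (λ d → hubs d ≡ P) ds) (ap : AllPairs Apart (d₁ ∷ d₂ ∷ ds))
                 (le : ∣ P ∣ ≤ suc (length ds)) where

          two-arms-bound : ∀ {a b x xs y ys} → b ∈ P → a ∈ P → a ≢ b ⊎ ∣ P ∣ ≤ 1 → RPath (K d₁) (Gr μ b) (x ∷ xs) → RPath (K d₂) (Gr μ a) (y ∷ ys) →
            2 * ∣ P ∣ + (suc (length ys) + suc (suc (length xs))) < 2 + k
          two-arms-bound = two-zones {d₁} {d₂} {ds} h₁ h₂ hs ap le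

          ≮s : 1 ≤ ∣ P ∣ → ¬ (∣ P ∣ < s)
          ≮s 1≤P p<s = case two-hubs 1≤P of λ { (a , b , a∈ , b∈ , ne) →
            case long-arm {d₁} h₁ b∈ p<s , long-arm {d₂} h₂ a∈ p<s of λ { ((_ , xs , p , lx) , (_ , ys , q , ly)) →
              long-arms-exceed k≤ lx ly (two-arms-bound b∈ a∈ ne p q) } }

          ≯s : 1 ≤ ∣ P ∣ → ¬ (s < ∣ P ∣)
          ≯s 1≤P p>s = case two-hubs 1≤P of λ { (a , b , a∈ , b∈ , ne) →
            case Zone.touches (zone {d₁} h₁) b∈ , Zone.touches (zone {d₂} h₂) a∈ of λ { ((_ , x∈ , g) , (_ , y∈ , g′)) →
              many-hubs-exceed k≤ p>s (two-arms-bound b∈ a∈ ne (start x∈ g) (start y∈ g′)) } }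

          ∣P∣≡s : 1 ≤ ∣ P ∣ → ∣ P ∣ ≡ s
          ∣P∣≡s 1≤P = ≤-antisym (≮⇒≥ (≯s 1≤P)) (≮⇒≥ (≮s 1≤P))

      dense⇒bounded : ∀ σ (ds : List Dense) → AllPairs Apart ds → ∣ S ∣ ≤ σ → (2 + (σ + 4 * k)) * 2 ^ σ < length ds → Bounded V
      dense⇒bounded σ ds ap S≤ many = case pigeonhole ≡-subset? hubs (2 + (σ + 4 * k)) (powerset S) ap
          (λ {d} _ → ∈-powerset (λ a∈ → proj₁ (∈-sub⁻ (hub? (K d)) a∈)))
          (≤-<-trans (*-monoʳ-≤ (2 + (σ + 4 * k)) (≤-trans (≤-reflexive (length-powerset S)) (^-monoʳ-≤ 2 S≤))) many) of
          λ { (P , zs , hs , apart , _ , lots) → same-hubs P zs hs apart lots }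
        where
        same-hubs : ∀ P zs → All (λ d → hubs d ≡ P) zs → AllPairs Apart zs → 2 + (σ + 4 * k) < length zs → Bounded V
        same-hubs P [] _ _ ()
        same-hubs P (_ ∷ []) _ _ (s≤s ())
        same-hubs P (d₁ ∷ d₂ ∷ es) h@(h₁ ∷ h₂ ∷ hs) ap@((ap₁₂ ∷ _) ∷ _) lots = by-size ∣ P ∣ refl
          where
          P⊆S : P ⊆ S
          P⊆S {a} a∈ = proj₁ (∈-sub⁻ (hub? (K d₁)) (subst (a ∈_) (sym h₁) a∈))
          few : ∣ P ∣ ≤ suc (length es)
          few = ≤-trans (≤-trans (p⊆q⇒∣p∣≤∣q∣ P⊆S) S≤) (≤-trans (m≤m+n σ (4 * k)) (≤-trans (s≤s⁻¹ (s≤s⁻¹ (<⇒≤ lots))) (n≤1+n (length es))))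
          by-size : ∀ p → ∣ P ∣ ≡ p → Bounded V
          by-size zero eq = ⊥-elim (no-hubs {d₁} {d₂} ap₁₂ (trans (cong ∣_∣ h₁) eq) (trans (cong ∣_∣ h₂) eq))
          by-size (suc p) eq = core⇒bounded (λ h → S⊆V (P⊆S h)) (SameHubs.∣P∣≡s P P⊆S {d₁} {d₂} {es} h₁ h₂ hs ap few (≤-trans (s≤s z≤n) (≤-reflexive (sym eq))))
            cV valid P⊆S (AllP.map⁺ (All.map (λ {d} e → SameHubs.zone P P⊆S {d} e) h)) (Ks-disjoint ap)
            (subst (4 * k ≤_) (sym (length-map K (d₁ ∷ d₂ ∷ es))) (≤-trans (≤-trans (m≤n+m (4 * k) σ) (m≤n+m (σ + 4 * k) 2)) (<⇒≤ lots)))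

    -- Splitting off many small pieces

    open Constants ρ k

    record Pieces (V S : Subset n) (M t : ℕ) : Set where
      constructor pieces
      field
        list     : List (Subset n)
        count    : length list ≡ M
        are      : All (Piece V S) list
        disjoint : AllPairs Disjointˢ list
        small    : All (λ X → ∣ X ∣ ≤ t) list

    split : ∀ {V S} M t {R} → R ⊆ V ─ S → GH.ClosedIn V (V ─ S) R → M * suc t ≤ ∣ R ∣ →
      (∃ λ X → Piece V S X × X ⊆ R × suc t ≤ ∣ X ∣) ⊎ (Σ (Pieces V S M t) λ p → All (_⊆ R) (Pieces.list p))
    split zero t _ _ _ = inj₂ (pieces [] refl [] [] [] , [])
    split {V} {S} (suc M) t {R} R⊆ cl big with 1≤⇒Nonempty R (≤-trans (s≤s z≤n) big)
    ... | x , x∈ with GH.component-of V (adj? V) adj-sym (V ─ S) (R⊆ x∈)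
    ...   | X , x∈X , pc with suc t ≤? ∣ X ∣
    ...     | yes h = inj₁ (X , pc , (λ y∈ → closed-reach cl (GH.Component.within pc) (GH.Component.connected pc x∈X y∈) x∈) , h)
    ...     | no h with split M t {R ─ X} (λ y∈ → R⊆ (proj₁ (∈-─⁻ R X y∈)))
                   (λ y∈ z∈ e → case ∈-─⁻ R X y∈ of λ { (y∈R , y∉X) → ∈-─⁺ (cl y∈R z∈ e) (λ z∈X → y∉X (GH.Component.closed pc z∈X (R⊆ y∈R) (adj-sym e))) })
                   (+-cancelˡ-≤ (suc t) _ _ (≤-trans big (≤-trans (≤-reflexive (sym (∣─∣ X⊆R))) (≤-trans (≤-reflexive (+-comm ∣ R ─ X ∣ ∣ X ∣)) (+-monoˡ-≤ _ (<⇒≤ (≰⇒> h)))))))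
      where
      X⊆R : X ⊆ R
      X⊆R y∈ = closed-reach cl (GH.Component.within pc) (GH.Component.connected pc x∈X y∈) x∈
    ...       | inj₁ (Y , py , Y⊆ , b) = inj₁ (Y , py , (λ y∈ → proj₁ (∈-─⁻ R X (Y⊆ y∈))) , b)
    ...       | inj₂ (pieces l c a d sm , sub-R) = inj₂ (pieces (X ∷ l) (cong suc c) (pc ∷ a)
                  (All.tabulate (λ Y∈ x∈X x∈Y → proj₂ (∈-─⁻ R X (All.lookup sub-R Y∈ x∈Y)) x∈X) ∷ d) (s≤s⁻¹ (≰⇒> h) ∷ sm) ,
                  (λ y∈ → closed-reach cl (GH.Component.within pc) (GH.Component.connected pc x∈X y∈) x∈) ∷
                  All.tabulate (λ Y∈ y∈ → proj₁ (∈-─⁻ R X (All.lookup sub-R Y∈ y∈))))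

    Split : Subset n → ℕ → ℕ → Set
    Split V a t = ∃ λ S → S ⊆ V × Nonempty S × ∣ S ∣ ≤ a × Pieces V S M₀ t

    weaken : ∀ {V a b t u} → a ≤ b → t ≤ u → Split V a t → Split V b u
    weaken h h′ (S , S⊆ , ne , sz , pieces l c a d sm) = S , S⊆ , ne , ≤-trans sz h , pieces l c a d (All.map (λ q → ≤-trans q h′) sm)

    -- S is the set of vertices of the path edges; the path is prolonged into a large component left after removing one more edge.
    descend : ∀ d {V S W v es vs} → S ⊆ V → Piece V S W → BPath v es vs → (∀ {x} → x ∈ₗ v ∷ vs → x ∈ S) →
      (∀ {e} → e ∈ₗ es → Disjointˢ (E e) W) → Attached V W v → length (v ∷ vs) + d ≡ k → large M₀ d ≤ ∣ W ∣ →
      Split V (∣ S ∣ + suc ρ * d) (large M₀ d)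
    descend zero {v = v} {vs = vs} _ _ p _ _ _ len _ = ⊥-elim (<-irrefl (trans (sym (+-identityʳ _)) len) (noLong p))
    descend (suc d) {V} {S} {W} {v} {es} {vs} S⊆ pc p verts edges (g , x , g⊆ , v∈ , x∈ , x∈W) len big
      with split {V} {S ∪ E g} M₀ (large M₀ d) {W ─ E g}
             (λ y∈ → case ∈-─⁻ W (E g) y∈ of λ { (y∈W , y∉g) → ∈-─⁺ (proj₁ (∈-─⁻ V S (GH.Component.within pc y∈W)))
               (λ h → case x∈p∪q⁻ S (E g) h of λ { (inj₁ q) → proj₂ (∈-─⁻ V S (GH.Component.within pc y∈W)) q ; (inj₂ q) → y∉g q }) })
             (λ y∈ z∈ e → case ∈-─⁻ V (S ∪ E g) z∈ of λ { (z∈V , z∉) →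
               ∈-─⁺ (GH.Component.closed pc (proj₁ (∈-─⁻ W (E g) y∈)) (∈-─⁺ z∈V (λ q → z∉ (x∈p∪q⁺ (inj₁ q)))) e) (λ q → z∉ (x∈p∪q⁺ (inj₂ q))) })
             (+-cancelˡ-≤ (suc ρ) _ _ (≤-trans big (≤-trans W≤ (≤-reflexive (+-comm ∣ W ─ E g ∣ (suc ρ))))))
      where
      W≤ : ∣ W ∣ ≤ ∣ W ─ E g ∣ + suc ρ
      W≤ = ≤-trans (p⊆q⇒∣p∣≤∣q∣ {q = (W ─ E g) ∪ E g} (λ {y} y∈ → case y ∈? E g of λ { (yes q) → x∈p∪q⁺ (inj₂ q) ; (no q) → x∈p∪q⁺ (inj₁ (∈-─⁺ y∈ q)) }))
             (≤-trans (∣∪∣≤ (W ─ E g) (E g)) (≤-reflexive (cong (∣ W ─ E g ∣ +_) (uniform g))))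
    ... | inj₂ (ps , _) = weaken (≤-trans S₁≤ (+-monoʳ-≤ ∣ S ∣ (≤-trans (m≤m+n (suc ρ) (suc ρ * d)) (≤-reflexive (sym (*-suc (suc ρ) d))))))
          (large-≤ d 1≤M₀)
          (S ∪ E g , (λ h → case x∈p∪q⁻ S (E g) h of λ { (inj₁ q) → S⊆ q ; (inj₂ q) → g⊆ q }) , (v , x∈p∪q⁺ (inj₂ v∈)) , ≤-refl , ps)
      where
      S₁≤ : ∣ S ∪ E g ∣ ≤ ∣ S ∣ + suc ρ
      S₁≤ = ≤-trans (∣∪∣≤ S (E g)) (≤-reflexive (cong (∣ S ∣ +_) (uniform g)))
    ... | inj₁ (W′ , pc′ , W′⊆ , big′) with GH.Component.inhabited pc′
    -- `W` is connected and contains `x` in `E g`, so some hyperedge leaves `W′` towards a vertex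
    -- `w` of `W`. As `W′` is a piece off `S ∪ E g` and `w` is not in `S`, it lies in `E g`, and `g`
    -- takes the path from `v` to `w`.
    ...   | y₀ , y₀∈ with GH.crossing V W′ (GH.Component.connected pc (proj₁ (∈-─⁻ W (E g) (W′⊆ y₀∈))) x∈W) y₀∈ (λ h → proj₂ (∈-─⁻ W (E g) (W′⊆ h)) x∈)
    ...     | u , w , u∈W′ , _ , w∉W′ , w∈W , (e , e⊆ , u∈ , w∈) =
      weaken (≤-trans (+-monoˡ-≤ (suc ρ * d) S₁≤) (≤-reflexive (trans (+-assoc ∣ S ∣ (suc ρ) (suc ρ * d)) (cong (∣ S ∣ +_) (sym (*-suc (suc ρ) d))))))
        (large-≤ d 1≤M₀)
        (descend d (λ h → case x∈p∪q⁻ S (E g) h of λ { (inj₁ q) → S⊆ q ; (inj₂ q) → g⊆ q }) pc′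
          -- `g` is new because it meets `W` in `x`, while the earlier hyperedges avoid `W`.
          (prepend p w∈g v∈ (λ h → w∉S (verts h)) (λ h → edges h x∈ x∈W))
          (λ { (here refl) → x∈p∪q⁺ (inj₂ w∈g) ; (there h) → x∈p∪q⁺ (inj₁ (verts h)) })
          (λ { (here refl) y∈ y∈W′ → proj₂ (∈-─⁻ W (E g) (W′⊆ y∈W′)) y∈ ; (there h) y∈ y∈W′ → edges h y∈ (proj₁ (∈-─⁻ W (E g) (W′⊆ y∈W′))) })
          (e , u , e⊆ , w∈ , u∈ , u∈W′) (trans (sym (+-suc (length (v ∷ vs)) d)) len) (≤-trans (n≤1+n _) big′))
      where
      S₁≤ : ∣ S ∪ E g ∣ ≤ ∣ S ∣ + suc ρ
      S₁≤ = ≤-trans (∣∪∣≤ S (E g)) (≤-reflexive (cong (∣ S ∣ +_) (uniform g)))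
      w∉S : w ∉ S
      w∉S = proj₂ (∈-─⁻ V S (GH.Component.within pc w∈W))
      w∈g : w ∈ E g
      w∈g with w ∈? (S ∪ E g)
      ... | no w∉ = ⊥-elim (w∉W′ (piece-closed pc′ e⊆ u∈ u∈W′ w∈ w∉))
      ... | yes q with x∈p∪q⁻ S (E g) q
      ...   | inj₁ r = ⊥-elim (w∉S r)
      ...   | inj₂ r = r

    decompose : ∀ {V} → 1 ≤ k → GH.Conn V V → N₀ ≤ ∣ V ∣ → Split V σ T
    decompose {V} 1≤k cV big = go (1≤⇒Nonempty V (≤-trans (s≤s z≤n) big′))
      where
      big′ : suc (M₀ * suc T) ≤ ∣ V ∣
      big′ = subst (_≤ ∣ V ∣) N₀-def big
      go : Nonempty V → Split V σ T
      go (v , v∈) = [ from-large , from-small ]′ (split {V} {⁅ v ⁆} M₀ T {V ─ ⁅ v ⁆} id (λ _ z∈ _ → z∈) (s≤s⁻¹ (≤-trans big′ (≤-reflexive (sym (∣─⁅⁆∣ v∈))))))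
        where
        v⊆V : ⁅ v ⁆ ⊆ V
        v⊆V h = subst (_∈ V) (sym (x∈⁅y⁆⇒x≡y v h)) v∈
        from-small : (Σ (Pieces V ⁅ v ⁆ M₀ T) λ p → All (_⊆ (V ─ ⁅ v ⁆)) (Pieces.list p)) → Split V σ T
        from-small (ps , _) = ⁅ v ⁆ , v⊆V , (v , x∈⁅x⁆ v) , ≤-trans (≤-reflexive (∣⁅x⁆∣≡1 v)) (≤-trans (m≤m+n 1 (suc ρ * (k ∸ 1))) (≤-reflexive (sym σ-def))) , ps
        from-large : (∃ λ X → Piece V ⁅ v ⁆ X × X ⊆ V ─ ⁅ v ⁆ × suc T ≤ ∣ X ∣) → Split V σ T
        from-large (W , pc , _ , lg) = case attached-exists v⊆V cV pc (v , x∈⁅x⁆ v) of λ { (a , a∈ , att) →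
          weaken (≤-reflexive (trans (cong (_+ suc ρ * (k ∸ 1)) (∣⁅x⁆∣≡1 v)) (sym σ-def))) (≤-reflexive (sym T-def))
            (descend (k ∸ 1) v⊆V pc (bpath [] ([] ∷ []) []) (λ { (here refl) → x∈⁅x⁆ v }) (λ ())
              (subst (Attached V W) (x∈⁅y⁆⇒x≡y v a∈) att) (m+[n∸m]≡n 1≤k) (subst (_≤ ∣ W ∣) T-def (≤-trans (n≤1+n T) lg))) }

    -- A walk enters and leaves `X` through vertices of `S` attached to `X`. They are attached to
    -- `X′` as well, so the walk can be rerouted through `X′`, whose hyperedges avoid `X`.
    conn-delete : ∀ {V S X X′} → GH.Conn V V → Piece V S X → Piece V S X′ → Disjointˢ X X′ →
      (∀ {a} → a ∈ S → Attached V X a → Attached V X′ a) → GH.Conn (V ─ X) (V ─ X)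
    conn-delete {V} {S} {X} {X′} cV pc pc′ disj att {u} {w} u∈ w∈ = proj₁ (go (cV (proj₁ (∈-─⁻ V X u∈)) (proj₁ (∈-─⁻ V X w∈)))) (proj₂ (∈-─⁻ V X w∈))
      where
      Link : Fin n → Fin n → Set
      Link a = GH.Reach (V ─ X) (V ─ X) (a ≡_)
      X∉S : ∀ {x} → x ∈ X → x ∉ S
      X∉S x∈ = proj₂ (∈-─⁻ V S (GH.Component.within pc x∈))
      safe : ∀ {e x} → E e ⊆ V → x ∈ E e → x ∈ X′ → E e ⊆ V ─ X
      safe e⊆ x∈ x∈X′ y∈ = ∈-─⁺ (e⊆ y∈) (λ y∈X → disj y∈X (piece-closed pc′ e⊆ x∈ x∈X′ y∈ (X∉S y∈X)))
      through : ∀ {x y} → GH.Reach V X′ (x ≡_) y → Link x y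
      through (Graph.root x∈ refl) = Graph.root (∈-─⁺ (proj₁ (∈-─⁻ V S (GH.Component.within pc′ x∈))) (λ h → disj h x∈)) refl
      through (Graph.step r (e , e⊆ , y∈ , z∈) z∈X′) = Graph.step (through r) (e , safe e⊆ z∈ z∈X′ , y∈ , z∈) (safe e⊆ z∈ z∈X′ z∈)
      link : ∀ {a b} → a ∈ S → b ∈ S → Attached V X a → Attached V X b → Link a b
      link a∈S b∈S ax bx with att a∈S ax | att b∈S bx
      ... | e , x , e⊆ , a∈ , x∈ , x∈X′ | f , y , f⊆ , b∈ , y∈ , y∈X′ =
        GH.reach-trans (V ─ X) (GH.reach-trans (V ─ X) (Graph.step (Graph.root (safe e⊆ x∈ x∈X′ a∈) refl) (e , safe e⊆ x∈ x∈X′ , a∈ , x∈) (safe e⊆ x∈ x∈X′ x∈))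
          (through (GH.Component.connected pc′ x∈X′ y∈X′)))
          (Graph.step (Graph.root (safe f⊆ y∈ y∈X′ y∈) refl) (f , safe f⊆ y∈ y∈X′ , y∈ , b∈) (safe f⊆ y∈ y∈X′ b∈))
      hub-of : ∀ {e x y} → E e ⊆ V → x ∈ E e → x ∈ X → y ∈ E e → y ∉ X → y ∈ S × Attached V X y
      hub-of {e} {x} {y} e⊆ x∈ x∈X y∈ y∉X with y ∈? S
      ... | yes q = q , e , x , e⊆ , y∈ , x∈ , x∈X
      ... | no q = ⊥-elim (y∉X (piece-closed pc e⊆ x∈ x∈X y∈ q))
      go : ∀ {y} → GH.Reach V V (u ≡_) y → (y ∉ X → Link u y) × (y ∈ X → ∃ λ a → a ∈ S × Attached V X a × Link u a)
      go (Graph.root _ refl) = (λ _ → Graph.root u∈ refl) , (λ h → ⊥-elim (proj₂ (∈-─⁻ V X u∈) h))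
      go (Graph.step {y} {z} r (e , e⊆ , y∈ , z∈) z∈V) with go r | y ∈? X
      ... | _ , back | yes y∈X with back y∈X
      ...   | a , a∈S , aa , la = (λ z∉ → case hub-of e⊆ y∈ y∈X z∈ z∉ of λ { (z∈S , za) → GH.reach-trans (V ─ X) la (link a∈S z∈S aa za) }) , (λ _ → a , a∈S , aa , la)
      go (Graph.step {y} {z} r (e , e⊆ , y∈ , z∈) z∈V) | fwd , _ | no y∉X =
          out , (λ z∈X → case hub-of e⊆ z∈ z∈X y∈ y∉X of λ { (y∈S , ya) → y , y∈S , ya , fwd y∉X })
        where
        out : z ∉ X → Link u z
        out z∉X with any? (λ x → (x ∈? E e) ×-dec (x ∈? X))
        ... | no none = Graph.step (fwd y∉X) (e , (λ x∈ → ∈-─⁺ (e⊆ x∈) (λ x∈X → none (_ , x∈ , x∈X))) , y∈ , z∈) (∈-─⁺ z∈V z∉X)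
        ... | yes (x , x∈ , x∈X) with hub-of e⊆ x∈ x∈X y∈ y∉X | hub-of e⊆ x∈ x∈X z∈ z∉X
        ...   | y∈S , ya | z∈S , za = GH.reach-trans (V ─ X) (fwd y∉X) (link y∈S z∈S ya za)

    -- Removing sparse pieces

    record Removable (V : Subset n) : Set where
      field
        {X}     : Subset n
        X⊆V     : X ⊆ V
        small   : ∣ X ∣ ≤ T
        nonempty : Nonempty X
        rest    : GH.Conn (V ─ X) (V ─ X)
        sparse  : touching V X < (s C ρ) * ∣ X ∣

    attached? : ∀ V S X a → Dec (a ∈ S × Attached V X a)
    attached? V S X a = (a ∈? S) ×-dec any? (λ e → any? (λ x → (E e ⊆? V) ×-dec (a ∈? E e) ×-dec (x ∈? E e) ×-dec (x ∈? X)))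

    -- Equal attachments serve two purposes: a removed piece can be replaced by another one in
    -- walks, and dense pieces share a vertex `b` at which their paths can be joined.
    module Alike (V S : Subset n) (S⊆V : S ⊆ V) (S≤ : ∣ S ∣ ≤ σ) (cV : GH.Conn V V) (A : Subset n) {b : Fin n} (b∈S : b ∈ S) (b∈A : b ∈ A)
                 (zs : List (Subset n)) (all-A : All (λ X → sub (attached? V S X) ≡ A) zs) (are : All (Piece V S) zs)
                 (apart : AllPairs Disjointˢ zs) (small : All (λ X → ∣ X ∣ ≤ T) zs) (many : M₁ < length zs)
                 {μ : Fin m → Maybe (Fin n × Fin n)} (valid : Mt.Valid V S μ) {blue : Subset m}
                 (closed : Mt.Closed V S μ blue) (cover : ∀ e → e ∈ blue ⊎ Mt.Matched V S μ e) where

      open Dense V S S⊆V cV b b∈S valid closed cover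

      attached-b : ∀ {X} → X ∈ₗ zs → Attached V X b
      attached-b {X} h = proj₂ (∈-sub⁻ (attached? V S X) (subst (b ∈_) (sym (All.lookup all-A h)) b∈A))

      dense-or-sparse : ∀ ys → (∀ {X} → X ∈ₗ ys → X ∈ₗ zs) →
        (Σ (List Dense) λ ds → map Dense.X ds ≡ ys) ⊎ (∃ λ X → X ∈ₗ zs × touching V X < (s C ρ) * ∣ X ∣)
      dense-or-sparse [] _ = inj₁ ([] , refl)
      dense-or-sparse (X ∷ ys) h with (s C ρ) * ∣ X ∣ ≤? touching V X
      ... | no q = inj₂ (X , h (here refl) , ≰⇒> q)
      ... | yes q with dense-component (All.lookup are (h (here refl))) (attached-b (h (here refl))) q | dense-or-sparse ys (h ∘ there)
      ...   | _ | inj₂ r = inj₂ r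
      ...   | d , eq | inj₁ (ds , eqs) = inj₁ (d ∷ ds , cong₂ _∷_ (sym eq) eqs)

      removable : ∀ {X} → X ∈ₗ zs → touching V X < (s C ρ) * ∣ X ∣ → Removable V
      removable {X} X∈ sparse = case another apart X∈ (≤-trans (s≤s 1≤M₁) many) of λ { (Y , Y∈ , disj) → record
        { X⊆V = λ h → proj₁ (∈-─⁻ V S (GH.Component.within (All.lookup are X∈) h)) ; small = All.lookup small X∈
        ; nonempty = GH.Component.inhabited (All.lookup are X∈)
        ; rest = conn-delete cV (All.lookup are X∈) (All.lookup are Y∈) disj (λ {a} a∈ at → proj₂ (∈-sub⁻ (attached? V S Y)
            (subst (a ∈_) (trans (All.lookup all-A X∈) (sym (All.lookup all-A Y∈))) (∈-sub⁺ (attached? V S X) (a∈ , at)))))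
        ; sparse = sparse } }

      outcome : Bounded V ⊎ Removable V
      outcome = case dense-or-sparse zs id of λ
        { (inj₁ (ds , eq)) → inj₁ (dense⇒bounded σ ds (AllPairs.map⁻ (subst (AllPairs Disjointˢ) (sym eq) apart)) S≤
              (subst₂ _<_ M₁-def (trans (cong length (sym eq)) (length-map Dense.X ds)) many))
        ; (inj₂ (_ , X∈ , sparse)) → inj₂ (removable X∈ sparse) }

    bounded-or-removable : ∀ {V} → GH.Conn V V → N₀ ≤ ∣ V ∣ → Bounded V ⊎ Removable V
    bounded-or-removable {V} cV big = from-split (decompose {V} (≤-trans (s≤s z≤n) 8≤k) cV big)
      where
      from-split : Split V σ T → Bounded V ⊎ Removable V
      from-split (S , S⊆V , S-ne , S≤ , ps) = case pigeonhole ≡-subset? (λ X → sub (attached? V S X)) M₁ (powerset S) (Pieces.disjoint ps)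
                (λ {X} _ → ∈-powerset (λ a∈ → proj₁ (∈-sub⁻ (attached? V S X) a∈)))
                (≤-<-trans (*-monoʳ-≤ M₁ (≤-trans (≤-reflexive (length-powerset S)) (^-monoʳ-≤ 2 S≤))) (≤-reflexive (sym (trans (Pieces.count ps) M₀-def)))) of
                λ { (A , zs , all-A , apart , zs⊆ , many) → alike A zs all-A apart zs⊆ many }
        where
        D = Mt.maximum-matching V S {λ _ → nothing} (record { admissible = λ () ; injective = λ () })
        alike : ∀ A zs → All (λ X → sub (attached? V S X) ≡ A) zs → AllPairs Disjointˢ zs → (∀ {Z} → Z ∈ₗ zs → Z ∈ₗ Pieces.list ps) →
          M₁ < length zs → Bounded V ⊎ Removable V
        alike A [] _ _ _ ()
        alike A (Z ∷ zs) all-A apart zs⊆ many = case attached-exists S⊆V cV (All.lookup (Pieces.are ps) (zs⊆ (here refl))) S-ne of λ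
          { (b , b∈ , at) → Alike.outcome V S S⊆V S≤ cV A b∈ (subst (b ∈_) (All.lookup all-A (here refl)) (∈-sub⁺ (attached? V S Z) (b∈ , at)))
                (Z ∷ zs) all-A (All.tabulate (λ h → All.lookup (Pieces.are ps) (zs⊆ h))) apart (All.tabulate (λ h → All.lookup (Pieces.small ps) (zs⊆ h))) many
                (Mt.Deficient.valid D) (Mt.Deficient.closed D) (Mt.Deficient.cover D) }

    edges-split : ∀ {V X} → ∣ edgesIn V ∣ ≤ ∣ edgesIn (V ─ X) ∣ + touching V X
    edges-split {V} {X} = ≤-trans (p⊆q⇒∣p∣≤∣q∣ into) (∣∪∣≤ (edgesIn (V ─ X)) (sub (touch? V X)))
      where
      into : edgesIn V ⊆ edgesIn (V ─ X) ∪ sub (touch? V X)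
      into {e} h with any? (λ x → (x ∈? E e) ×-dec (x ∈? X))
      ... | yes p = x∈p∪q⁺ (inj₂ (∈-sub⁺ (touch? V X) (∈-sub⁻ (λ e → E e ⊆? V) h , p)))
      ... | no none = x∈p∪q⁺ (inj₁ (∈-sub⁺ (λ e → E e ⊆? (V ─ X)) (λ x∈ → ∈-─⁺ (∈-sub⁻ (λ e → E e ⊆? V) h x∈) (λ x∈X → none (_ , x∈ , x∈X)))))

    -- This pays for the end of the process, where fewer than `N₀` vertices carry at most
    -- `N₀ C suc ρ` hyperedges.
    slack : ℕ
    slack = suc T * (N₀ C suc ρ) + N₀

    -- Each removal of a sparse set gains at least one edge against the bound, and hence pays for its at most suc T vertices.
    Progress : Subset n → Set
    Progress V = suc T * ∣ edgesIn V ∣ + ∣ V ∣ ≤ suc T * ((s C ρ) * ∣ V ∣) + slack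

    edgesIn≤ : ∀ V → ∣ edgesIn V ∣ ≤ ∣ V ∣ C suc ρ
    edgesIn≤ V = family-bound (edgesIn V) E V (suc ρ) (λ {e} h → ∈-sub⁻ (λ e → E e ⊆? V) h , uniform e) (λ _ _ → E-injective)

    bounded-or-progress : ∀ fuel {V} → ∣ V ∣ ≤ fuel → GH.Conn V V → Bounded V ⊎ Progress V
    bounded-or-progress fuel {V} le cV with N₀ ≤? ∣ V ∣
    ... | no small = inj₂ (≤-trans (+-mono-≤ (*-monoʳ-≤ (suc T) (≤-trans (edgesIn≤ V) (C-monoˡ (suc ρ) (<⇒≤ (≰⇒> small))))) (<⇒≤ (≰⇒> small)))
                       (m≤n+m slack (suc T * ((s C ρ) * ∣ V ∣))))
    ... | yes big with fuel | bounded-or-removable cV big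
    ...   | _ | inj₁ b = inj₁ b
    ...   | zero | inj₂ r = ⊥-elim (<⇒≱ (≤-trans (Nonempty⇒1≤ (Removable.nonempty r)) (p⊆q⇒∣p∣≤∣q∣ (Removable.X⊆V r))) le)
    ...   | suc f | inj₂ r = [ inj₁ ∘ remove-bounded {s C ρ} {s} {s C suc ρ + extra} {∣ V ∣} {∣ V ─ X ∣} {∣ X ∣} edges-split sparse (∣─∣ X⊆V) , inj₂ ∘ remove-progress {s C ρ} {slack} {suc T} {∣ V ∣} {∣ V ─ X ∣} {∣ X ∣} edges-split sparse (∣─∣ X⊆V) (m≤n⇒m≤1+n small) ]′
              (bounded-or-progress f (s≤s⁻¹ (≤-trans shrinks le)) rest)
      where
      open Removable r
      shrinks : suc ∣ V ─ X ∣ ≤ ∣ V ∣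
      shrinks = ≤-trans (≤-reflexive (+-comm 1 ∣ V ─ X ∣)) (≤-trans (+-monoʳ-≤ ∣ V ─ X ∣ (Nonempty⇒1≤ nonempty)) (≤-reflexive (∣─∣ X⊆V)))

    threshold : ℕ
    threshold = slack + suc T * ((s C ρ) * s)

    connected⇒bounded : ∀ {V} → GH.Conn V V → threshold ≤ ∣ V ∣ → Bounded V
    connected⇒bounded {V} cV big = [ id , (λ p → ≤-trans (progress-bounded {s C ρ} {s} {slack} {T} {∣ V ∣} p big) (m≤m+n _ _)) ]′ (bounded-or-progress ∣ V ∣ ≤-refl cV)

-- The extremal number

module _ {n ρ : ℕ} (H : RGraph (suc ρ) n) where

  edge-injective : ∀ {i j} → edge H i ≡ edge H j → i ≡ j
  edge-injective = lookup-uniq (simple H)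

  edge-size : ∀ i → ∣ edge H i ∣ ≡ suc ρ
  edge-size i = All.lookup (uniform H) (∈-lookup i)

  module _ (2≤ρ : 2 ≤ ρ) where

    open Hypergraph (edge H) edge-injective edge-size 2≤ρ

    -- A Berge path with more than `k` vertices is first cut down to exactly `k`.
    free⇒noLong : ∀ {k} → BergePFree k H → NoLong k
    free⇒noLong {k} free {vs = vs} p = ≰⇒> λ k≤ → case path-functions (k ∸ 1) p (∸-monoˡ-≤ 1 k≤) of λ
      { (f , g , _ , f-inj , g-inj , _ , _ , inc) → free (f , g , f-inj , g-inj , inc) }

    connected⇒conn : Connected H → GH.Conn full full
    connected⇒conn con {x} {y} _ _ = case GH.component-of full (adj? full) adj-sym full (∈⊤ {x = x}) of λ
      { (X , x∈ , c) → case y ∈? X of λ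
        { (yes y∈) → GH.reach-⊆ full (λ _ → ∈⊤) (GH.Component.connected c x∈ y∈)
        ; (no y∉) → ⊥-elim (uncrossed c (con X (x , x∈) (y , y∉))) } }
      where
      uncrossed : ∀ {X} → GH.Component full full X → ¬ Any (λ e → (∃[ u ] (u ∈ X × u ∈ e)) × (∃[ w ] (w ∉ X × w ∈ e))) (edges H)
      uncrossed c cut = case lookup-index cut of λ
        { ((u , u∈ , u∈e) , (w , w∉ , w∈e)) → w∉ (GH.Component.closed c u∈ ∈⊤ (Any.index cut , (λ _ → ∈⊤) , u∈e , w∈e)) }

-- The threshold is restated without a hypergraph, since it has to be fixed before the order `n`.
threshold : (ρ s k : ℕ) → ℕ
threshold ρ s k = suc T * (N₀ C suc ρ) + N₀ + suc T * ((s C ρ) * s)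
  where open Constants ρ k

cancel-hubs : ∀ {c s t d a e q x} → x + c * s ≤ c * (t + (d + s)) + (a + e) → q ≡ d * c + (a + e) → x ≤ c * t + q
cancel-hubs {c} {s} {t} {d} {a} {e} {q} {x} h refl = +-cancelʳ-≤ (c * s) x _ (≤-trans h (≤-reflexive (arrange c s t d (a + e))))
  where
  arrange : ∀ c s t d b → c * (t + (d + s)) + b ≡ c * t + (d * c + b) + c * s
  arrange = solve-∀

upper-bound : ∀ {ρ s k} (t d : ℕ) → 2 ≤ ρ → ρ < s → k ≡ suc (2 * s + d) → d ≡ 1 ⊎ d ≡ 2 → threshold ρ s k ≤ t + (d + s) →
  (H : RGraph (suc ρ) (t + (d + s))) → Connected H → BergePFree k H → size H ≤ (s C ρ) * t + (d + s) C suc ρ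
upper-bound {ρ} {s} {k} t d 2≤ρ ρ<s k≡ parity big H con free = cancel-hubs {s C ρ} {s} {t} {d} {s C suc ρ} {extra}
    (subst (λ z → size H + (s C ρ) * s ≤ (s C ρ) * z + (s C suc ρ + extra)) (∣⊤∣≡n _) (≤-trans (+-monoˡ-≤ _ all-edges) bounded)) (closing parity)
  where
  k≥ : 2 + 2 * s ≤ k
  k≥ = case parity of λ { (inj₁ refl) → ≤-reflexive (trans (cong suc (+-comm 1 (2 * s))) (sym k≡)) ; (inj₂ refl) → ≤-trans (n≤1+n _) (≤-reflexive (trans (cong suc (+-comm 2 (2 * s))) (sym k≡))) }
  k≤ : k ≤ 3 + 2 * s
  k≤ = case parity of λ { (inj₁ refl) → ≤-trans (≤-reflexive (trans k≡ (cong suc (+-comm (2 * s) 1)))) (n≤1+n _) ; (inj₂ refl) → ≤-reflexive (trans k≡ (cong suc (+-comm (2 * s) 2))) }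
  open Hypergraph (edge H) (edge-injective H) (edge-size H) 2≤ρ using (module LargeOrder)
  open LargeOrder s k ρ<s (free⇒noLong H 2≤ρ {k} free) k≥ k≤ using (edgesIn; extra; extra-odd; extra-even; connected⇒bounded)
  bounded : ∣ edgesIn full ∣ + (s C ρ) * s ≤ (s C ρ) * ∣ full {t + (d + s)} ∣ + (s C suc ρ + extra)
  bounded = connected⇒bounded (connected⇒conn H 2≤ρ con) (subst (threshold ρ s k ≤_) (sym (∣⊤∣≡n (t + (d + s)))) big)
  all-edges : size H ≤ ∣ edgesIn full ∣
  all-edges = subst (_≤ ∣ edgesIn full ∣) (∣⊤∣≡n (size H)) (p⊆q⇒∣p∣≤∣q∣ {p = full} (λ {i} _ → ∈-sub⁺ (λ e → edge H e ⊆? full) {i} (λ _ → ∈⊤)))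
  closing : d ≡ 1 ⊎ d ≡ 2 → (d + s) C suc ρ ≡ d * (s C ρ) + (s C suc ρ + extra)
  closing (inj₁ refl) = trans (C-pascal s ρ) (one (s C ρ) (s C suc ρ) (extra-even (λ eq → 1+n≢n {2 + 2 * s} (trans (sym eq) (trans k≡ (cong suc (+-comm (2 * s) 1)))))))
    where
    one : ∀ c a {e} → e ≡ 0 → c + a ≡ 1 * c + (a + e)
    one c a refl = cong₂ _+_ (sym (+-identityʳ c)) (sym (+-identityʳ a))
  closing (inj₂ refl) = two ρ 2≤ρ
    where
    arrange : ∀ b c a → b + c + (c + a) ≡ 2 * c + (a + b)
    arrange = solve-∀
    two : ∀ ρ′ → 2 ≤ ρ′ → (2 + s) C suc ρ ≡ 2 * (s C ρ) + (s C suc ρ + extra)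
    two _ _ = trans (trans (C-pascal (suc s) ρ) (cong₂ _+_ (pascal′ ρ 2≤ρ) (C-pascal s ρ)))
      (trans (arrange (s C pred ρ) (s C ρ) (s C suc ρ)) (cong (λ z → 2 * (s C ρ) + (s C suc ρ + z)) (sym (extra-odd (trans k≡ (cong suc (+-comm (2 * s) 2)))))))
      where
      pascal′ : ∀ ρ → 2 ≤ ρ → suc s C ρ ≡ s C pred ρ + s C ρ
      pascal′ (suc ρ) _ = C-pascal s ρ

extremal-number : ∀ {ρ s k} (t d : ℕ) → 2 ≤ ρ → ρ < s → k ≡ suc (2 * s + d) → d ≡ 1 ⊎ d ≡ 2 → threshold ρ s k ≤ t + (d + s) →
  ExConnIs (suc ρ) (t + (d + s)) k ((s C ρ) * t + (d + s) C suc ρ)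
extremal-number {ρ} {s} t d 2≤ρ ρ<s refl parity big =
    (extremalGraph t d s ρ , extremal-connected t d s ρ (≤-trans (s≤s z≤n) 2≤ρ) ρ<s , extremal-free t d s ρ (case parity of λ { (inj₁ refl) → s≤s z≤n ; (inj₂ refl) → s≤s z≤n })
      , length-extremal t d s ρ)
  , upper-bound t d 2≤ρ ρ<s refl parity big

halves : ∀ k → ∃[ h ] (k ≡ h + h ⊎ k ≡ suc (h + h))
halves zero = 0 , inj₁ refl
halves (suc k) with halves k
... | h , inj₁ refl = h , inj₂ refl
... | h , inj₂ refl = suc h , inj₁ (cong suc (sym (+-suc h h)))

extremal-number-at : ∀ {ρ h k} (d s : ℕ) → 2 ≤ ρ → ρ < s → k ≡ suc (2 * s + d) → d ≡ 1 ⊎ d ≡ 2 → ⌊ k /2⌋ ≡ suc s → ⌈ k /2⌉ ≡ d + s →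
  h ≡ threshold ρ s k + (d + s) → (n : ℕ) → h < n → ExConnIs (suc ρ) n k (extremalValue (suc ρ) k n)
extremal-number-at {ρ} {k = k} d s 2≤ρ ρ<s k≡ parity fl cl refl n big =
  subst (ExConnIs (suc ρ) n k) (sym (cong₂ (λ a b → ((a ∸ 1) C ρ) * (n ∸ b) + b C suc ρ) fl cl))
    (subst (λ z → ExConnIs (suc ρ) z k ((s C ρ) * (n ∸ (d + s)) + (d + s) C suc ρ)) split
      (extremal-number (n ∸ (d + s)) d 2≤ρ ρ<s k≡ parity (subst (threshold ρ s k ≤_) (sym split) (≤-trans (m≤m+n _ (d + s)) (<⇒≤ big)))))
  where
  split : n ∸ (d + s) + (d + s) ≡ n
  split = m∸n+n≡m (≤-trans (m≤n+m (d + s) (threshold ρ s k)) (<⇒≤ big))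

half-≤ : ∀ {a b} → a + a ≤ suc (b + b) → a ≤ b
half-≤ {zero} _ = z≤n
half-≤ {suc a} {zero} (s≤s h) rewrite +-suc a a = ⊥-elim (1+n≰0 h)
  where
  1+n≰0 : ∀ {x} → ¬ (suc x ≤ 0)
  1+n≰0 ()
half-≤ {suc a} {suc b} (s≤s h) rewrite +-suc a a | +-suc b b = s≤s (half-≤ (s≤s⁻¹ h))

double : ∀ s → suc s + suc s ≡ suc (2 * s + 1)
double = solve-∀

theorem1p8 : (r k : ℕ) → 8 ≤ 2 * r + 2 → 2 * r + 2 ≤ k →
    ∃[ N ] ((n : ℕ) → N < n → ExConnIs r n k (extremalValue r k n))
theorem1p8 r k 8≤ r≤ = by-size r 3≤r (λ {h} → r<h {h}) (halves k)
  where
  twice : ∀ r → 2 * r ≡ r + r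
  twice = solve-∀
  twice-suc : ∀ r → 2 * r + 2 ≡ suc r + suc r
  twice-suc = solve-∀
  3≤r : 3 ≤ r
  3≤r = half-≤ (≤-trans (+-cancelʳ-≤ 2 6 (2 * r) 8≤) (≤-trans (≤-reflexive (twice r)) (n≤1+n (r + r))))
  r<h : ∀ {h} → k ≡ h + h ⊎ k ≡ suc (h + h) → suc r ≤ h
  r<h (inj₁ eq) = half-≤ (≤-trans (≤-reflexive (sym (twice-suc r))) (≤-trans r≤ (≤-trans (≤-reflexive eq) (n≤1+n _))))
  r<h (inj₂ eq) = half-≤ (≤-trans (≤-reflexive (sym (twice-suc r))) (≤-trans r≤ (≤-reflexive eq)))
  by-size : ∀ r → 3 ≤ r → (∀ {h} → k ≡ h + h ⊎ k ≡ suc (h + h) → suc r ≤ h) → ∃[ h ] (k ≡ h + h ⊎ k ≡ suc (h + h)) →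
    ∃[ N ] ((n : ℕ) → N < n → ExConnIs r n k (extremalValue r k n))
  by-size (suc ρ) (s≤s 2≤ρ) lo (zero , parity) with lo {zero} parity
  ... | ()
  -- The number `d` of extra vertices is 1 for even and 2 for odd `k`, so that `d + s` is the upper
  -- half of `k`.
  by-size (suc ρ) (s≤s 2≤ρ) lo (suc s , inj₁ eq) = _ , extremal-number-at 1 s 2≤ρ (s≤s⁻¹ (lo (inj₁ eq))) (trans eq (double s)) (inj₁ refl)
    (trans (cong ⌊_/2⌋ eq) (sym (n≡⌊n+n/2⌋ (suc s)))) (trans (cong ⌈_/2⌉ eq) (sym (n≡⌈n+n/2⌉ (suc s)))) refl
  by-size (suc ρ) (s≤s 2≤ρ) lo (suc s , inj₂ eq) = _ , extremal-number-at 2 s 2≤ρ (s≤s⁻¹ (lo (inj₂ eq))) (trans eq (cong suc (trans (double s) (sym (+-suc (2 * s) 1)))))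
    (inj₂ refl) (trans (cong ⌊_/2⌋ eq) (sym (n≡⌈n+n/2⌉ (suc s)))) (trans (cong ⌈_/2⌉ eq) (cong suc (sym (n≡⌊n+n/2⌋ (suc s))))) refl
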